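{- For every $n\geq 0$, $C\Sigma_n\subseteq I\Sigma_{n+1}$, i.e. every theorem of $C\Sigma_n$ is a theorem of $I\Sigma_{n+1}$.
   Context: Language of arithmetic $\{0,\mathsf{s},+,\times,<\}$, formulae in De Morgan normal form. $\Sigma_0=\Pi_0$ are bounded formulae; $\Sigma_{n+1}$: $\exists\vec x.\phi$ with $\phi\in\Pi_n$; $\Pi_{n+1}$: $\forall\vec x.\phi$ with $\phi\in\Sigma_n$. $\mathsf{Q}$ is Robinson arithmetic with inequality ($\mathsf{s}x\neq 0$; $\mathsf{s}x=\mathsf{s}y\supset x=y$; $x\neq0\supset\exists y.x=\mathsf{s}y$; $x+0=x$; $x+\mathsf{s}y=\mathsf{s}(x+y)$; $x\cdot0=0$; $x\cdot\mathsf{s}y=x\cdot y+x$; $x<y\equiv\exists z.(x+\mathsf{s}z=y)$); $I\Sigma_n$ is $\mathsf{Q}$ plus induction for $\Sigma_n$ formulae. Cyclic proofs: sequent calculus for first-order logic with equality (cedents finite sets; identity, equality and negation axioms, weakening, cut, left/right rules for $\wedge,\vee,\forall,\exists$ with fresh eigenvariables, substitution rule from $\Gamma\Rightarrow\Delta$ to $\theta(\Gamma)\Rightarrow\theta(\Delta)$, initial sequents for instances of axioms of $\mathsf{Q}$). A preproof is a possibly infinite locally correct labelled tree; regular if finitely many distinct subtrees. Along an infinite branch $(\Gamma_i\Rightarrow\Delta_i)_i$, $t'$ is a precursor of $t$ at $i$ if the step at $i$ is a substitution $\theta$ with $t=\theta(t')$, or another step and $t'=t$ occurs in $\Gamma_i$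 or $t'$ is $t$. A trace $(t_i)_{i\ge m}$ has $t_i$ in the $i$-th sequent and either $t_{i+1}$ a precursor of $t_i$ at $i$ or $t_{i+1}<t\in\Gamma_{i+1}$ for some precursor $t$ of $t_i$ at $i$ (progress). A cyclic proof is a regular preproof whose every infinite branch has an infinitely progressing trace. $C\Sigma_n$ is the theory axiomatised by universal closures of conclusions of cyclic proofs containing only $\Sigma_n$ formulae. -}

module Defs where

open import Data.Nat using (ℕ; zero; suc; _≤_)
open import Data.Fin using (Fin)
open import Data.List using (List; []; _∷_; map; foldr; _++_)
open import Data.List.Membership.Propositional using (_∈_)
open import Data.List.Relation.Binary.Subset.Propositional using (_⊆_)
open import Data.List.Relation.Unary.All using (All)
open import Data.List.Relation.Binary.Pointwise using (Pointwise)
open import Data.Product using (Σ; ∃; _×_; _,_)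
open import Data.Sum using (_⊎_)
open import Data.Empty using (⊥)
open import Relation.Nullary using (¬_)
open import Relation.Binary.PropositionalEquality using (_≡_)

infixl 10 _⊕_
infixl 11 _⊗_

data Term : Set where
  var  : ℕ → Term
  𝟎    : Term
  S    : Term → Term
  _⊕_  : Term → Term → Term
  _⊗_  : Term → Term → Term

-- Formulae in De Morgan normal form (negation only on atoms).
infixr 8 _∧ᶠ_
infixr 7 _∨ᶠ_
infix 9 _≐_ _≠_ _≺_ _⊀_

data Formula : Set where
  _≐_ _≠_ _≺_ _⊀_ : Term → Term → Formula
  _∧ᶠ_ _∨ᶠ_      : Formula → Formula → Formula
  ∀ᶠ ∃ᶠ          : Formula → Formula         -- binds de Bruijn index 0

dual : Formula → Formula
dual (t ≐ u) = t ≠ u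
dual (t ≠ u) = t ≐ u
dual (t ≺ u) = t ⊀ u
dual (t ⊀ u) = t ≺ u
dual (φ ∧ᶠ ψ) = dual φ ∨ᶠ dual ψ
dual (φ ∨ᶠ ψ) = dual φ ∧ᶠ dual ψ
dual (∀ᶠ φ) = ∃ᶠ (dual φ)
dual (∃ᶠ φ) = ∀ᶠ (dual φ)

Subst : Set
Subst = ℕ → Term

substT : Subst → Term → Term
substT σ (var i) = σ i
substT σ 𝟎 = 𝟎
substT σ (S t) = S (substT σ t)
substT σ (t ⊕ u) = substT σ t ⊕ substT σ u
substT σ (t ⊗ u) = substT σ t ⊗ substT σ u

wk : Term → Term
wk = substT (λ i → var (suc i))

liftS : Subst → Subst
liftS σ zero = var zero
liftS σ (suc i) = wk (σ i)

substF : Subst → Formula → Formula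
substF σ (t ≐ u) = substT σ t ≐ substT σ u
substF σ (t ≠ u) = substT σ t ≠ substT σ u
substF σ (t ≺ u) = substT σ t ≺ substT σ u
substF σ (t ⊀ u) = substT σ t ⊀ substT σ u
substF σ (φ ∧ᶠ ψ) = substF σ φ ∧ᶠ substF σ ψ
substF σ (φ ∨ᶠ ψ) = substF σ φ ∨ᶠ substF σ ψ
substF σ (∀ᶠ φ) = ∀ᶠ (substF (liftS σ) φ)
substF σ (∃ᶠ φ) = ∃ᶠ (substF (liftS σ) φ)

single : Term → Subst
single t zero = t
single t (suc i) = var i

_[_]₀ : Formula → Term → Formula
φ [ t ]₀ = substF (single t) φ

FreeT : ℕ → Term → Set
FreeT a (var i) = a ≡ i
FreeT a 𝟎 = ⊥
FreeT a (S t) = FreeT a t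
FreeT a (t ⊕ u) = FreeT a t ⊎ FreeT a u
FreeT a (t ⊗ u) = FreeT a t ⊎ FreeT a u

FreeF : ℕ → Formula → Set
FreeF a (t ≐ u) = FreeT a t ⊎ FreeT a u
FreeF a (t ≠ u) = FreeT a t ⊎ FreeT a u
FreeF a (t ≺ u) = FreeT a t ⊎ FreeT a u
FreeF a (t ⊀ u) = FreeT a t ⊎ FreeT a u
FreeF a (φ ∧ᶠ ψ) = FreeF a φ ⊎ FreeF a ψ
FreeF a (φ ∨ᶠ ψ) = FreeF a φ ⊎ FreeF a ψ
FreeF a (∀ᶠ φ) = FreeF (suc a) φ
FreeF a (∃ᶠ φ) = FreeF (suc a) φ

Sentence : Formula → Set
Sentence φ = ∀ a → ¬ FreeF a φ

data SubTerm (u : Term) : Term → Set where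
  here : SubTerm u u
  inS  : ∀ {t} → SubTerm u t → SubTerm u (S t)
  ⊕l   : ∀ {t t'} → SubTerm u t → SubTerm u (t ⊕ t')
  ⊕r   : ∀ {t t'} → SubTerm u t' → SubTerm u (t ⊕ t')
  ⊗l   : ∀ {t t'} → SubTerm u t → SubTerm u (t ⊗ t')
  ⊗r   : ∀ {t t'} → SubTerm u t' → SubTerm u (t ⊗ t')

-- the term t occurs (free, i.e. with none of its variables captured) in φ
OccF : Term → Formula → Set
OccF t (u ≐ v) = SubTerm t u ⊎ SubTerm t v
OccF t (u ≠ v) = SubTerm t u ⊎ SubTerm t v
OccF t (u ≺ v) = SubTerm t u ⊎ SubTerm t v
OccF t (u ⊀ v) = SubTerm t u ⊎ SubTerm t v
OccF t (φ ∧ᶠ ψ) = OccF t φ ⊎ OccF t ψ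
OccF t (φ ∨ᶠ ψ) = OccF t φ ⊎ OccF t ψ
OccF t (∀ᶠ φ) = OccF (wk t) φ
OccF t (∃ᶠ φ) = OccF (wk t) φ

data Bounded : Formula → Set where
  b≐ : ∀ t u → Bounded (t ≐ u)
  b≠ : ∀ t u → Bounded (t ≠ u)
  b≺ : ∀ t u → Bounded (t ≺ u)
  b⊀ : ∀ t u → Bounded (t ⊀ u)
  b∧ : ∀ {φ ψ} → Bounded φ → Bounded ψ → Bounded (φ ∧ᶠ ψ)
  b∨ : ∀ {φ ψ} → Bounded φ → Bounded ψ → Bounded (φ ∨ᶠ ψ)
  b∀ : ∀ {φ} t → Bounded φ → Bounded (∀ᶠ ((var zero ⊀ wk t) ∨ᶠ φ))
  b∃ : ∀ {φ} t → Bounded φ → Bounded (∃ᶠ ((var zero ≺ wk t) ∧ᶠ φ))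

exs alls : ℕ → Formula → Formula
exs zero φ = φ
exs (suc k) φ = ∃ᶠ (exs k φ)
alls zero φ = φ
alls (suc k) φ = ∀ᶠ (alls k φ)

Sig Pi : ℕ → Formula → Set
Sig zero φ = Bounded φ
Sig (suc n) φ = Σ ℕ λ k → Σ Formula λ ψ → (φ ≡ exs k ψ) × Pi n ψ
Pi zero φ = Bounded φ
Pi (suc n) φ = Σ ℕ λ k → Σ Formula λ ψ → (φ ≡ alls k ψ) × Sig n ψ

-- Sequents (cedents are lists read as finite sets)

infix 2 _⇒_
data Seq : Set where
  _⇒_ : List Formula → List Formula → Seq

ante succ : Seq → List Formula
ante (Γ ⇒ Δ) = Γ
succ (Γ ⇒ Δ) = Δ

formulasOf : Seq → List Formula
formulasOf (Γ ⇒ Δ) = Γ ++ Δ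

_≈S_ : Seq → Seq → Set
(Γ ⇒ Δ) ≈S (Γ' ⇒ Δ') = (Γ ⊆ Γ' × Γ' ⊆ Γ) × (Δ ⊆ Δ' × Δ' ⊆ Δ)

FreshIn : ℕ → List Formula → Set
FreshIn a Γ = All (λ φ → ¬ FreeF a φ) Γ

data Inst : Seq → List Seq → Set where
  id     : ∀ φ → Inst (φ ∷ [] ⇒ φ ∷ []) []
  eqRefl : ∀ t → Inst ([] ⇒ (t ≐ t) ∷ []) []
  eqSub  : ∀ t u φ → Inst ((t ≐ u) ∷ (φ [ t ]₀) ∷ [] ⇒ (φ [ u ]₀) ∷ []) []
  negL   : ∀ φ → Inst (φ ∷ dual φ ∷ [] ⇒ []) []
  negR   : ∀ φ → Inst ([] ⇒ φ ∷ dual φ ∷ []) []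
  weak   : ∀ {Γ Γ' Δ Δ'} → Γ ⊆ Γ' → Δ ⊆ Δ' → Inst (Γ' ⇒ Δ') ((Γ ⇒ Δ) ∷ [])
  cut    : ∀ {Γ Δ} φ → Inst (Γ ⇒ Δ) ((Γ ⇒ φ ∷ Δ) ∷ (φ ∷ Γ ⇒ Δ) ∷ [])
  ∧L     : ∀ {Γ Δ φ ψ} → Inst ((φ ∧ᶠ ψ) ∷ Γ ⇒ Δ) ((φ ∷ ψ ∷ Γ ⇒ Δ) ∷ [])
  ∧R     : ∀ {Γ Δ φ ψ} → Inst (Γ ⇒ (φ ∧ᶠ ψ) ∷ Δ) ((Γ ⇒ φ ∷ Δ) ∷ (Γ ⇒ ψ ∷ Δ) ∷ [])
  ∨L     : ∀ {Γ Δ φ ψ} → Inst ((φ ∨ᶠ ψ) ∷ Γ ⇒ Δ) ((φ ∷ Γ ⇒ Δ) ∷ (ψ ∷ Γ ⇒ Δ) ∷ [])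
  ∨R     : ∀ {Γ Δ φ ψ} → Inst (Γ ⇒ (φ ∨ᶠ ψ) ∷ Δ) ((Γ ⇒ φ ∷ ψ ∷ Δ) ∷ [])
  ∀L     : ∀ {Γ Δ φ} t → Inst (∀ᶠ φ ∷ Γ ⇒ Δ) ((φ [ t ]₀ ∷ Γ ⇒ Δ) ∷ [])
  ∀R     : ∀ {Γ Δ φ} a → FreshIn a (∀ᶠ φ ∷ Γ ++ Δ) →
           Inst (Γ ⇒ ∀ᶠ φ ∷ Δ) ((Γ ⇒ φ [ var a ]₀ ∷ Δ) ∷ [])
  ∃L     : ∀ {Γ Δ φ} a → FreshIn a (∃ᶠ φ ∷ Γ ++ Δ) →
           Inst (∃ᶠ φ ∷ Γ ⇒ Δ) ((φ [ var a ]₀ ∷ Γ ⇒ Δ) ∷ [])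
  ∃R     : ∀ {Γ Δ φ} t → Inst (Γ ⇒ ∃ᶠ φ ∷ Δ) ((Γ ⇒ φ [ t ]₀ ∷ Δ) ∷ [])
  sub    : ∀ {Γ Δ} (θ : Subst) → Inst (map (substF θ) Γ ⇒ map (substF θ) Δ) ((Γ ⇒ Δ) ∷ [])

data QInit : Seq → Set where
  q1 : ∀ t → QInit ([] ⇒ (S t ≠ 𝟎) ∷ [])
  q2 : ∀ t u → QInit ((S t ≐ S u) ∷ [] ⇒ (t ≐ u) ∷ [])
  q3 : ∀ t → QInit ((t ≠ 𝟎) ∷ [] ⇒ ∃ᶠ (wk t ≐ S (var zero)) ∷ [])
  q4 : ∀ t → QInit ([] ⇒ (t ⊕ 𝟎 ≐ t) ∷ [])
  q5 : ∀ t u → QInit ([] ⇒ (t ⊕ S u ≐ S (t ⊕ u)) ∷ [])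
  q6 : ∀ t → QInit ([] ⇒ (t ⊗ 𝟎 ≐ 𝟎) ∷ [])
  q7 : ∀ t u → QInit ([] ⇒ (t ⊗ S u ≐ t ⊗ u ⊕ t) ∷ [])
  q8 : ∀ t u → QInit ((t ≺ u) ∷ [] ⇒ ∃ᶠ (wk t ⊕ S (var zero) ≐ wk u) ∷ [])
  q9 : ∀ t u v → QInit ((t ⊕ S v ≐ u) ∷ [] ⇒ (t ≺ u) ∷ [])

data CStep : Seq → List Seq → Set where
  logic : ∀ {c ps} → Inst c ps → CStep c ps
  qinit : ∀ {c} → QInit c → CStep c []

-- Precursors (for a step with actual conclusion sequent s)

Precursor : ∀ {c ps} → CStep c ps → Seq → Term → Term → Set
Precursor (logic (sub θ)) s t t' = substT θ t' ≡ t
Precursor (logic (id _)) s t t' = ((t' ≐ t) ∈ ante s) ⊎ (t' ≡ t)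
Precursor (logic (eqRefl _)) s t t' = ((t' ≐ t) ∈ ante s) ⊎ (t' ≡ t)
Precursor (logic (eqSub _ _ _)) s t t' = ((t' ≐ t) ∈ ante s) ⊎ (t' ≡ t)
Precursor (logic (negL _)) s t t' = ((t' ≐ t) ∈ ante s) ⊎ (t' ≡ t)
Precursor (logic (negR _)) s t t' = ((t' ≐ t) ∈ ante s) ⊎ (t' ≡ t)
Precursor (logic (weak _ _)) s t t' = ((t' ≐ t) ∈ ante s) ⊎ (t' ≡ t)
Precursor (logic (cut _)) s t t' = ((t' ≐ t) ∈ ante s) ⊎ (t' ≡ t)
Precursor (logic ∧L) s t t' = ((t' ≐ t) ∈ ante s) ⊎ (t' ≡ t)
Precursor (logic ∧R) s t t' = ((t' ≐ t) ∈ ante s) ⊎ (t' ≡ t)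
Precursor (logic ∨L) s t t' = ((t' ≐ t) ∈ ante s) ⊎ (t' ≡ t)
Precursor (logic ∨R) s t t' = ((t' ≐ t) ∈ ante s) ⊎ (t' ≡ t)
Precursor (logic (∀L _)) s t t' = ((t' ≐ t) ∈ ante s) ⊎ (t' ≡ t)
Precursor (logic (∀R _ _)) s t t' = ((t' ≐ t) ∈ ante s) ⊎ (t' ≡ t)
Precursor (logic (∃L _ _)) s t t' = ((t' ≐ t) ∈ ante s) ⊎ (t' ≡ t)
Precursor (logic (∃R _)) s t t' = ((t' ≐ t) ∈ ante s) ⊎ (t' ≡ t)
Precursor (qinit _) s t t' = ((t' ≐ t) ∈ ante s) ⊎ (t' ≡ t)

-- Regular preproofs, presented as finite graphs (their unfoldings are
-- exactly the regular trees).

record LabelledStep : Set where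
  constructor step
  field
    concl    : Seq
    premises : List Seq
    rule     : CStep concl premises

record Preproof : Set where
  field
    size    : ℕ
    root    : Fin size
    seqAt   : Fin size → Seq
    stepAt  : Fin size → LabelledStep
    kids    : Fin size → List (Fin size)
    correct : ∀ v → (seqAt v ≈S LabelledStep.concl (stepAt v))
                  × Pointwise _≈S_ (map seqAt (kids v)) (LabelledStep.premises (stepAt v))

module _ (P : Preproof) where
  open Preproof P

  record Branch : Set where
    field
      node  : ℕ → Fin size
      start : node zero ≡ root
      next  : ∀ i → node (suc i) ∈ kids (node i)

  OccS : Term → Seq → Set
  OccS t s = Σ Formula λ φ → (φ ∈ formulasOf s) × OccF t φ

  module _ (b : Branch) where
    open Branch b

    seqB : ℕ → Seq
    seqB i = seqAt (node i)

    Prec : ℕ → Term → Term → Set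
    Prec i t t' = Precursor (LabelledStep.rule (stepAt (node i))) (seqB i) t t'

    ProgressAt : (ℕ → Term) → ℕ → Set
    ProgressAt τ i = Σ Term λ t → Prec i (τ i) t × ((τ (suc i) ≺ t) ∈ ante (seqB (suc i)))

    InfProgTrace : Set
    InfProgTrace = Σ ℕ λ m → Σ (ℕ → Term) λ τ →
        (∀ i → m ≤ i → OccS (τ i) (seqB i))
      × (∀ i → m ≤ i → Prec i (τ i) (τ (suc i)) ⊎ ProgressAt τ i)
      × (∀ k → Σ ℕ λ i → k ≤ i × m ≤ i × ProgressAt τ i)

  IsCyclicProof : Set
  IsCyclicProof = (b : Branch) → InfProgTrace b

  OnlySig : ℕ → Set
  OnlySig n = ∀ v → All (Sig n) (formulasOf (seqAt v))

  conclusion : Seq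
  conclusion = seqAt root

bigOr : List Formula → Formula
bigOr = foldr _∨ᶠ_ (𝟎 ≠ 𝟎)

seqFormula : Seq → Formula
seqFormula (Γ ⇒ Δ) = bigOr (map dual Γ ++ Δ)

UClosureOf : Formula → Formula → Set
UClosureOf φ ψ = Σ ℕ λ k → (φ ≡ alls k ψ) × Sentence φ

Theory : Set₁
Theory = Formula → Set

CΣ : ℕ → Theory
CΣ n φ = Σ Preproof λ P → IsCyclicProof P × OnlySig P n × UClosureOf φ (seqFormula (conclusion P))

x0 x1 : Term
x0 = var zero
x1 = var (suc zero)

data QAxiom : Formula → Set where
  a1 : QAxiom (S x0 ≠ 𝟎)
  a2 : QAxiom ((S x0 ≠ S x1) ∨ᶠ (x0 ≐ x1))
  a3 : QAxiom ((x0 ≐ 𝟎) ∨ᶠ ∃ᶠ (x1 ≐ S x0))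
  a4 : QAxiom (x0 ⊕ 𝟎 ≐ x0)
  a5 : QAxiom (x0 ⊕ S x1 ≐ S (x0 ⊕ x1))
  a6 : QAxiom (x0 ⊗ 𝟎 ≐ 𝟎)
  a7 : QAxiom (x0 ⊗ S x1 ≐ x0 ⊗ x1 ⊕ x0)
  a8 : QAxiom (((x0 ⊀ x1) ∨ᶠ ∃ᶠ (x1 ⊕ S x0 ≐ var 2))
               ∧ᶠ (∀ᶠ ((x1 ⊕ S x0 ≠ var 2)) ∨ᶠ (x0 ≺ x1)))

-- induction formula for φ (var 0 is the induction variable, others are parameters):
-- ¬φ(0) ∨ ∃x(φ(x) ∧ ¬φ(sx)) ∨ ∀x φ(x)
sucSub : Subst
sucSub zero = S (var zero)
sucSub (suc i) = var (suc i)

Ind : Formula → Formula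
Ind φ = dual (φ [ 𝟎 ]₀) ∨ᶠ (∃ᶠ (φ ∧ᶠ dual (substF sucSub φ)) ∨ᶠ ∀ᶠ φ)

IΣ : ℕ → Theory
IΣ n φ = (Σ Formula λ ψ → QAxiom ψ × UClosureOf φ ψ)
       ⊎ (Σ Formula λ ψ → Sig n ψ × UClosureOf φ (Ind ψ))

data Deriv : Seq → Set where
  by : ∀ {c ps} → Inst c ps → All Deriv ps → Deriv c

_⊢_ : Theory → Formula → Set
T ⊢ φ = Σ (List Formula) λ Γ → All T Γ × Deriv (Γ ⇒ φ ∷ [])

{-# OPTIONS --safe #-}
module Submission where

-- A cyclic proof is unfolded into nested inductions inside IΣ_{n+1}. Attach to the traces of the proof finitely many
-- slots, each holding a number that bounds the traces passing through it: a progressing trace opens a younger slot, and once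
-- every trace through a slot has also entered a younger one, the number in the slot can be decremented. This is Safra's
-- determinisation of the trace condition: on every cycle the oldest slot affected is decremented and never discarded, so the
-- numbers decrease lexicographically. Hence all sequents are proved by nested induction on the slots, oldest first. Each
-- induction formula universally closes a Boolean combination of Σ_n formulas, so it is Π_{n+1} and IΣ_{n+1} suffices.

open import Defs
open import Data.Bool using (Bool; true; false; if_then_else_)
import Data.Bool.Properties as Bool
open import Data.Empty using (⊥; ⊥-elim)
open import Data.Fin as Fin using (Fin; toℕ; inject₁; fromℕ; fromℕ<; combine)
import Data.Fin.Properties as Fin
open import Data.Fin.Induction using (spo-wellFounded)
import Data.Fin.Subset as Sub
open import Data.Fin.Subset using (Subset)
open import Data.Fin.Subset.Properties using (p⊆p∪q; q⊆p∪q; x∈p∪q⁻; x∈⁅y⁆⇒x≡y; x∈⁅x⁆; _∈?_; ∉⊥)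
open import Data.Fin.Subset.Induction using (⊃-wellFounded)
open import Data.List as List using (List; []; _∷_; _++_; map; concatMap; allFin; upTo; length)
open import Data.List.Properties using (map-++; map-∘; map-cong; map-cong-local; map-id)
open import Data.List.Membership.Propositional using (_∈_; find; lose)
open import Data.List.Membership.Propositional.Properties using (∈-++⁺ˡ; ∈-++⁺ʳ; ∈-++⁻; ∈-concatMap⁺; ∈-concatMap⁻; ∈-allFin; ∈-map⁺; ∈-map⁻; ∈-upTo⁺; ∈-upTo⁻)
open import Data.List.Relation.Binary.Pointwise using (Pointwise; []; _∷_)
open import Data.List.Relation.Binary.Subset.Propositional using (_⊆_)
open import Data.List.Relation.Binary.Subset.Propositional.Properties using (map⁺; xs⊆xs++ys; xs⊆ys++xs; ∷⁺ʳ; ++⁺ʳ; ++⁺)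
open import Data.List.Relation.Unary.All as All using (All; []; _∷_)
import Data.List.Relation.Unary.All.Properties as All
open import Data.List.Relation.Unary.Any as Any using (here; there; any?)
open import Data.List.Relation.Unary.Any.Properties using (lookup-index)
open import Data.Nat
open import Data.Nat.Properties
open import Data.List.Extrema ≤-totalOrder using (argmax; argmax-sel; f[xs]≤f[argmax])
open import Data.Product using (Σ; ∃; _×_; _,_; proj₁; proj₂)
open import Data.Sum as Sum using (_⊎_; inj₁; inj₂)
open import Data.Unit using (⊤; tt)
open import Data.Vec as Vec using (Vec; []; _∷_; lookup; tabulate; replicate; _∷ʳ_)
open import Data.Vec.Properties using (lookup-map; lookup∘tabulate; lookup-replicate)
open import Function using (_∘_)
open import Induction.WellFounded using (Acc; acc; WellFounded)
open import Relation.Binary.Construct.Closure.ReflexiveTransitive using (Star; ε; _◅_; _◅◅_; gmap)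
open import Relation.Binary.PropositionalEquality
open import Relation.Binary.Structures using (IsStrictPartialOrder)
open import Relation.Nullary using (¬_; Dec; yes; no)
open import Relation.Nullary.Decidable using (map′; _×-dec_; _⊎-dec_)

-- Substitution calculus

-- The trace condition chooses a trace only once a whole branch is known, whereas a nest of
-- inductions must fix at every sequent what it inducts on; this is why the condition has to be
-- determinised. A slot holds an upper bound rather than the value of a term, so when several traces
-- meet at one term a single set of slots can be kept, and the only arithmetic needed is that of
-- successor, sum and order. The numbers live in extra variables above those of the preproof, so the
-- states of the automaton, and with them the induction hypotheses, remain finite in number. A
-- hypothesis attached to slot `p` speaks of unchanged older slots and a smaller number in slot `p`.
-- It survives whatever happens to younger slots and is given up once an older one changes. The
-- combinatorial core is therefore a parity condition: no reachable cycle discards the oldest slot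
-- that it affects. Such a cycle, repeated for ever, would yield an ultimately periodic branch, and
-- the trace condition is applied to branches of this kind only.

substT-cong : ∀ t {σ τ} → (∀ a → FreeT a t → σ a ≡ τ a) → substT σ t ≡ substT τ t
substT-cong (var i) h = h i refl
substT-cong 𝟎 h = refl
substT-cong (S t) h = cong S (substT-cong t h)
substT-cong (t ⊕ u) h = cong₂ _⊕_ (substT-cong t λ a f → h a (inj₁ f)) (substT-cong u λ a f → h a (inj₂ f))
substT-cong (t ⊗ u) h = cong₂ _⊗_ (substT-cong t λ a f → h a (inj₁ f)) (substT-cong u λ a f → h a (inj₂ f))

substT-comp : ∀ σ τ t → substT σ (substT τ t) ≡ substT (substT σ ∘ τ) t
substT-comp σ τ (var i) = refl
substT-comp σ τ 𝟎 = refl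
substT-comp σ τ (S t) = cong S (substT-comp σ τ t)
substT-comp σ τ (t ⊕ u) = cong₂ _⊕_ (substT-comp σ τ t) (substT-comp σ τ u)
substT-comp σ τ (t ⊗ u) = cong₂ _⊗_ (substT-comp σ τ t) (substT-comp σ τ u)

substT-id : ∀ t → substT var t ≡ t
substT-id (var i) = refl
substT-id 𝟎 = refl
substT-id (S t) = cong S (substT-id t)
substT-id (t ⊕ u) = cong₂ _⊕_ (substT-id t) (substT-id u)
substT-id (t ⊗ u) = cong₂ _⊗_ (substT-id t) (substT-id u)

substT-≗id : ∀ {σ} t → (∀ a → FreeT a t → σ a ≡ var a) → substT σ t ≡ t
substT-≗id t h = trans (substT-cong t h) (substT-id t)

private
  lift-cong : ∀ {σ τ} {φ} → (∀ a → FreeF (ℕ.suc a) φ → σ a ≡ τ a) →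
              ∀ a → FreeF a φ → liftS σ a ≡ liftS τ a
  lift-cong h zero f = refl
  lift-cong h (suc a) f = cong wk (h a f)

substF-cong : ∀ φ {σ τ} → (∀ a → FreeF a φ → σ a ≡ τ a) → substF σ φ ≡ substF τ φ
substF-cong (t ≐ u) h = cong₂ _≐_ (substT-cong t λ a f → h a (inj₁ f)) (substT-cong u λ a f → h a (inj₂ f))
substF-cong (t ≠ u) h = cong₂ _≠_ (substT-cong t λ a f → h a (inj₁ f)) (substT-cong u λ a f → h a (inj₂ f))
substF-cong (t ≺ u) h = cong₂ _≺_ (substT-cong t λ a f → h a (inj₁ f)) (substT-cong u λ a f → h a (inj₂ f))
substF-cong (t ⊀ u) h = cong₂ _⊀_ (substT-cong t λ a f → h a (inj₁ f)) (substT-cong u λ a f → h a (inj₂ f))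
substF-cong (φ ∧ᶠ ψ) h = cong₂ _∧ᶠ_ (substF-cong φ λ a f → h a (inj₁ f)) (substF-cong ψ λ a f → h a (inj₂ f))
substF-cong (φ ∨ᶠ ψ) h = cong₂ _∨ᶠ_ (substF-cong φ λ a f → h a (inj₁ f)) (substF-cong ψ λ a f → h a (inj₂ f))
substF-cong (∀ᶠ φ) h = cong ∀ᶠ (substF-cong φ (lift-cong {φ = φ} h))
substF-cong (∃ᶠ φ) h = cong ∃ᶠ (substF-cong φ (lift-cong {φ = φ} h))

substF-≗ : ∀ φ {σ τ} → (∀ a → σ a ≡ τ a) → substF σ φ ≡ substF τ φ
substF-≗ φ h = substF-cong φ (λ a _ → h a)

liftS-comp : ∀ σ τ i → substT (liftS σ) (liftS τ i) ≡ liftS (substT σ ∘ τ) i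
liftS-comp σ τ zero = refl
liftS-comp σ τ (suc i) = trans (substT-comp _ _ (τ i)) (sym (substT-comp _ _ (τ i)))

substF-comp : ∀ σ τ φ → substF σ (substF τ φ) ≡ substF (substT σ ∘ τ) φ
substF-comp σ τ (t ≐ u) = cong₂ _≐_ (substT-comp σ τ t) (substT-comp σ τ u)
substF-comp σ τ (t ≠ u) = cong₂ _≠_ (substT-comp σ τ t) (substT-comp σ τ u)
substF-comp σ τ (t ≺ u) = cong₂ _≺_ (substT-comp σ τ t) (substT-comp σ τ u)
substF-comp σ τ (t ⊀ u) = cong₂ _⊀_ (substT-comp σ τ t) (substT-comp σ τ u)
substF-comp σ τ (φ ∧ᶠ ψ) = cong₂ _∧ᶠ_ (substF-comp σ τ φ) (substF-comp σ τ ψ)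
substF-comp σ τ (φ ∨ᶠ ψ) = cong₂ _∨ᶠ_ (substF-comp σ τ φ) (substF-comp σ τ ψ)
substF-comp σ τ (∀ᶠ φ) = cong ∀ᶠ (trans (substF-comp _ _ φ) (substF-≗ φ (liftS-comp σ τ)))
substF-comp σ τ (∃ᶠ φ) = cong ∃ᶠ (trans (substF-comp _ _ φ) (substF-≗ φ (liftS-comp σ τ)))

liftS-var : ∀ i → liftS var i ≡ var i
liftS-var zero = refl
liftS-var (suc i) = refl

substF-id : ∀ φ → substF var φ ≡ φ
substF-id (t ≐ u) = cong₂ _≐_ (substT-id t) (substT-id u)
substF-id (t ≠ u) = cong₂ _≠_ (substT-id t) (substT-id u)
substF-id (t ≺ u) = cong₂ _≺_ (substT-id t) (substT-id u)
substF-id (t ⊀ u) = cong₂ _⊀_ (substT-id t) (substT-id u)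
substF-id (φ ∧ᶠ ψ) = cong₂ _∧ᶠ_ (substF-id φ) (substF-id ψ)
substF-id (φ ∨ᶠ ψ) = cong₂ _∨ᶠ_ (substF-id φ) (substF-id ψ)
substF-id (∀ᶠ φ) = cong ∀ᶠ (trans (substF-≗ φ liftS-var) (substF-id φ))
substF-id (∃ᶠ φ) = cong ∃ᶠ (trans (substF-≗ φ liftS-var) (substF-id φ))

substF-≗id : ∀ {σ} φ → (∀ a → FreeF a φ → σ a ≡ var a) → substF σ φ ≡ φ
substF-≗id φ h = trans (substF-cong φ h) (substF-id φ)

substF-map-comp : ∀ σ τ Γ → map (substF σ) (map (substF τ) Γ) ≡ map (substF (substT σ ∘ τ)) Γ
substF-map-comp σ τ Γ = trans (sym (map-∘ Γ)) (map-cong (substF-comp σ τ) Γ)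

single-wkT : ∀ u t → substT (single u) (wk t) ≡ t
single-wkT u t = trans (substT-comp _ _ t) (substT-id t)

dual-dual : ∀ φ → dual (dual φ) ≡ φ
dual-dual (t ≐ u) = refl
dual-dual (t ≠ u) = refl
dual-dual (t ≺ u) = refl
dual-dual (t ⊀ u) = refl
dual-dual (φ ∧ᶠ ψ) = cong₂ _∧ᶠ_ (dual-dual φ) (dual-dual ψ)
dual-dual (φ ∨ᶠ ψ) = cong₂ _∨ᶠ_ (dual-dual φ) (dual-dual ψ)
dual-dual (∀ᶠ φ) = cong ∀ᶠ (dual-dual φ)
dual-dual (∃ᶠ φ) = cong ∃ᶠ (dual-dual φ)

dual-substF : ∀ σ φ → dual (substF σ φ) ≡ substF σ (dual φ)
dual-substF σ (t ≐ u) = refl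
dual-substF σ (t ≠ u) = refl
dual-substF σ (t ≺ u) = refl
dual-substF σ (t ⊀ u) = refl
dual-substF σ (φ ∧ᶠ ψ) = cong₂ _∨ᶠ_ (dual-substF σ φ) (dual-substF σ ψ)
dual-substF σ (φ ∨ᶠ ψ) = cong₂ _∧ᶠ_ (dual-substF σ φ) (dual-substF σ ψ)
dual-substF σ (∀ᶠ φ) = cong ∃ᶠ (dual-substF _ φ)
dual-substF σ (∃ᶠ φ) = cong ∀ᶠ (dual-substF _ φ)

bndT : Term → ℕ
bndT (var i) = suc i
bndT 𝟎 = 0
bndT (S t) = bndT t
bndT (t ⊕ u) = bndT t ⊔ bndT u
bndT (t ⊗ u) = bndT t ⊔ bndT u

bndF : Formula → ℕ
bndF (t ≐ u) = bndT t ⊔ bndT u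
bndF (t ≠ u) = bndT t ⊔ bndT u
bndF (t ≺ u) = bndT t ⊔ bndT u
bndF (t ⊀ u) = bndT t ⊔ bndT u
bndF (φ ∧ᶠ ψ) = bndF φ ⊔ bndF ψ
bndF (φ ∨ᶠ ψ) = bndF φ ⊔ bndF ψ
bndF (∀ᶠ φ) = pred (bndF φ)
bndF (∃ᶠ φ) = pred (bndF φ)

private
  ⊔-case : ∀ {A B : Set} {a m n} → (A → a < m) → (B → a < n) → A ⊎ B → a < m ⊔ n
  ⊔-case {m = m} {n} f g (inj₁ x) = <-≤-trans (f x) (m≤m⊔n m n)
  ⊔-case {m = m} {n} f g (inj₂ y) = <-≤-trans (g y) (m≤n⊔m m n)

  pred-< : ∀ {a m} → suc a < m → a < pred m
  pred-< (s≤s p) = p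

free<bndT : ∀ t {a} → FreeT a t → a < bndT t
free<bndT (var i) refl = ≤-refl
free<bndT (S t) f = free<bndT t f
free<bndT (t ⊕ u) = ⊔-case (free<bndT t) (free<bndT u)
free<bndT (t ⊗ u) = ⊔-case (free<bndT t) (free<bndT u)

free<bndF : ∀ φ {a} → FreeF a φ → a < bndF φ
free<bndF (t ≐ u) = ⊔-case (free<bndT t) (free<bndT u)
free<bndF (t ≠ u) = ⊔-case (free<bndT t) (free<bndT u)
free<bndF (t ≺ u) = ⊔-case (free<bndT t) (free<bndT u)
free<bndF (t ⊀ u) = ⊔-case (free<bndT t) (free<bndT u)
free<bndF (φ ∧ᶠ ψ) = ⊔-case (free<bndF φ) (free<bndF ψ)
free<bndF (φ ∨ᶠ ψ) = ⊔-case (free<bndF φ) (free<bndF ψ)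
free<bndF (∀ᶠ φ) f = pred-< (free<bndF φ f)
free<bndF (∃ᶠ φ) f = pred-< (free<bndF φ f)

liftN : ℕ → Subst → Subst
liftN zero σ = σ
liftN (suc k) σ = liftN k (liftS σ)

up : ℕ → Subst
up m i = var (m + i)

alls-subst : ∀ k σ φ → substF σ (alls k φ) ≡ alls k (substF (liftN k σ) φ)
alls-subst zero σ φ = refl
alls-subst (suc k) σ φ = cong ∀ᶠ (alls-subst k (liftS σ) φ)

exs-subst : ∀ k σ φ → substF σ (exs k φ) ≡ exs k (substF (liftN k σ) φ)
exs-subst zero σ φ = refl
exs-subst (suc k) σ φ = cong ∃ᶠ (exs-subst k (liftS σ) φ)

dual-alls : ∀ k φ → dual (alls k φ) ≡ exs k (dual φ)
dual-alls zero φ = refl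
dual-alls (suc k) φ = cong ∃ᶠ (dual-alls k φ)

dual-exs : ∀ k φ → dual (exs k φ) ≡ alls k (dual φ)
dual-exs zero φ = refl
dual-exs (suc k) φ = cong ∀ᶠ (dual-exs k φ)

liftN-ge : ∀ k σ j → liftN k σ (k + j) ≡ substT (up k) (σ j)
liftN-ge zero σ j = sym (substT-id (σ j))
liftN-ge (suc k) σ j = begin
  liftN k (liftS σ) (suc (k + j))    ≡⟨ cong (liftN k (liftS σ)) (sym (+-suc k j)) ⟩
  liftN k (liftS σ) (k + suc j)      ≡⟨ liftN-ge k (liftS σ) (suc j) ⟩
  substT (up k) (wk (σ j))           ≡⟨ substT-comp _ _ (σ j) ⟩
  substT (λ i → var (k + suc i)) (σ j) ≡⟨ substT-cong (σ j) (λ a _ → cong var (+-suc k a)) ⟩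
  substT (up (suc k)) (σ j)          ∎
  where open ≡-Reasoning

liftN-lt : ∀ k σ i → i < k → liftN k σ i ≡ var i
liftN-lt (suc k) σ i (s≤s i≤k) with m≤n⇒m<n∨m≡n i≤k
... | inj₁ i<k = liftN-lt k (liftS σ) i i<k
... | inj₂ refl = trans (cong (liftN k (liftS σ)) (sym (+-identityʳ k)))
                  (trans (liftN-ge k (liftS σ) 0) (cong var (+-identityʳ k)))

glue : ℕ → Subst → Subst → Subst
glue m f g i with i <? m
... | yes _ = f i
... | no  _ = g (i ∸ m)

glue-lt : ∀ m f g {i} → i < m → glue m f g i ≡ f i
glue-lt m f g {i} p with i <? m
... | yes _ = refl
... | no ¬p = ⊥-elim (¬p p)

glue-ge : ∀ m f g j → glue m f g (m + j) ≡ g j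
glue-ge m f g j with m + j <? m
... | yes p = ⊥-elim (m+n≮m m j p)
... | no _ = cong g (m+n∸m≡n m j)

inst : ℕ → Subst → Subst
inst m s = glue m s var

inst-lt : ∀ m s {i} → i < m → inst m s i ≡ s i
inst-lt m s = glue-lt m s var

inst-ge : ∀ m s j → inst m s (m + j) ≡ var j
inst-ge m s = glue-ge m s var

split< : ∀ m i → i < m ⊎ ∃ λ j → i ≡ m + j
split< m i with i <? m
... | yes p = inj₁ p
... | no ¬p = inj₂ (i ∸ m , sym (m+[n∸m]≡n (≮⇒≥ ¬p)))

inst-up : ∀ m s t → substT (inst m s) (substT (up m) t) ≡ t
inst-up m s t = trans (substT-comp _ _ t) (substT-≗id t (λ a _ → inst-ge m s a))

-- The outermost quantifier of `alls (suc m) φ` binds index `m` of `φ`. So `allsE` first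
-- instantiates with `s m` and leaves the lower `m` indices to the recursive call.
inst-suc : ∀ m s i → substT (inst m s) (liftN m (single (s m)) i) ≡ inst (suc m) s i
inst-suc m s i with split< m i
... | inj₁ p = trans (cong (substT (inst m s)) (liftN-lt m _ i p))
               (trans (inst-lt m s p) (sym (inst-lt (suc m) s (m<n⇒m<1+n p))))
... | inj₂ (zero , refl) = trans (cong (substT (inst m s)) (liftN-ge m _ 0))
               (trans (inst-up m s (s m))
               (sym (trans (inst-lt (suc m) s (≤-reflexive (cong suc (+-identityʳ m)))) (cong s (+-identityʳ m)))))
... | inj₂ (suc j , refl) = trans (cong (substT (inst m s)) (liftN-ge m _ (suc j)))
               (trans (inst-ge m s j)
               (sym (trans (cong (inst (suc m) s) (+-suc m j)) (inst-ge (suc m) s j))))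

inst-lift-up : ∀ m i → substT (inst m var) (liftN m (up m) i) ≡ var i
inst-lift-up m i with split< m i
... | inj₁ p = trans (cong (substT (inst m var)) (liftN-lt m _ i p)) (inst-lt m var p)
... | inj₂ (j , refl) = trans (cong (substT (inst m var)) (liftN-ge m _ j)) (inst-up m var (var (m + j)))

alls-sentence : ∀ k φ → (∀ a → FreeF a φ → a < k) → Sentence (alls k φ)
alls-sentence k φ h a f = <-irrefl refl (<-≤-trans (h _ (unalls k a f)) (m≤m+n k a))
  where
  unalls : ∀ k a → FreeF a (alls k φ) → FreeF (k + a) φ
  unalls zero a f = f
  unalls (suc k) a f = subst (λ i → FreeF i φ) (+-suc k a) (unalls k (suc a) f)

-- The arithmetical hierarchy

Bounded-subst : ∀ σ {φ} → Bounded φ → Bounded (substF σ φ)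
Bounded-subst σ (b≐ t u) = b≐ _ _
Bounded-subst σ (b≠ t u) = b≠ _ _
Bounded-subst σ (b≺ t u) = b≺ _ _
Bounded-subst σ (b⊀ t u) = b⊀ _ _
Bounded-subst σ (b∧ p q) = b∧ (Bounded-subst σ p) (Bounded-subst σ q)
Bounded-subst σ (b∨ p q) = b∨ (Bounded-subst σ p) (Bounded-subst σ q)
Bounded-subst σ (b∀ {φ} t p) = subst (λ u → Bounded (∀ᶠ ((var 0 ⊀ u) ∨ᶠ substF (liftS σ) φ)))
  (trans (substT-comp _ _ t) (sym (substT-comp _ _ t))) (b∀ (substT σ t) (Bounded-subst (liftS σ) p))
Bounded-subst σ (b∃ {φ} t p) = subst (λ u → Bounded (∃ᶠ ((var 0 ≺ u) ∧ᶠ substF (liftS σ) φ)))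
  (trans (substT-comp _ _ t) (sym (substT-comp _ _ t))) (b∃ (substT σ t) (Bounded-subst (liftS σ) p))

Bounded-dual : ∀ {φ} → Bounded φ → Bounded (dual φ)
Bounded-dual (b≐ t u) = b≠ _ _
Bounded-dual (b≠ t u) = b≐ _ _
Bounded-dual (b≺ t u) = b⊀ _ _
Bounded-dual (b⊀ t u) = b≺ _ _
Bounded-dual (b∧ p q) = b∨ (Bounded-dual p) (Bounded-dual q)
Bounded-dual (b∨ p q) = b∧ (Bounded-dual p) (Bounded-dual q)
Bounded-dual (b∀ t p) = b∃ t (Bounded-dual p)
Bounded-dual (b∃ t p) = b∀ t (Bounded-dual p)

Sig-subst : ∀ n σ {φ} → Sig n φ → Sig n (substF σ φ)
Pi-subst : ∀ n σ {φ} → Pi n φ → Pi n (substF σ φ)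
Sig-subst zero σ p = Bounded-subst σ p
Sig-subst (suc n) σ (k , ψ , refl , p) = k , _ , exs-subst k σ ψ , Pi-subst n _ p
Pi-subst zero σ p = Bounded-subst σ p
Pi-subst (suc n) σ (k , ψ , refl , p) = k , _ , alls-subst k σ ψ , Sig-subst n _ p

Sig-dual : ∀ n {φ} → Sig n φ → Pi n (dual φ)
Pi-dual : ∀ n {φ} → Pi n φ → Sig n (dual φ)
Sig-dual zero p = Bounded-dual p
Sig-dual (suc n) (k , ψ , refl , p) = k , _ , dual-exs k ψ , Pi-dual n p
Pi-dual zero p = Bounded-dual p
Pi-dual (suc n) (k , ψ , refl , p) = k , _ , dual-alls k ψ , Sig-dual n p

Bounded⇒Sig : ∀ n {φ} → Bounded φ → Sig n φ
Bounded⇒Pi : ∀ n {φ} → Bounded φ → Pi n φ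
Bounded⇒Sig zero p = p
Bounded⇒Sig (suc n) p = 0 , _ , refl , Bounded⇒Pi n p
Bounded⇒Pi zero p = p
Bounded⇒Pi (suc n) p = 0 , _ , refl , Bounded⇒Sig n p

Sig-suc : ∀ n {φ} → Sig n φ → Sig (suc n) φ
Pi-suc : ∀ n {φ} → Pi n φ → Pi (suc n) φ
Sig-suc zero p = Bounded⇒Sig 1 p
Sig-suc (suc n) (k , ψ , e , p) = k , ψ , e , Pi-suc n p
Pi-suc zero p = Bounded⇒Pi 1 p
Pi-suc (suc n) (k , ψ , e , p) = k , ψ , e , Sig-suc n p

-- Sequent calculus with side contexts

seq-η : ∀ s → s ≡ (ante s ⇒ Defs.succ s)
seq-η (Γ ⇒ Δ) = refl

_+L_ : List Formula → Seq → Seq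
Θ +L (Γ ⇒ Δ) = Θ ++ Γ ⇒ Δ

-- Side formulas disturb a rule only through an eigenvariable or a substitution.
Fits : ∀ {c ps} → List Formula → Inst c ps → Set
Fits Θ (∀R a _) = FreshIn a Θ
Fits Θ (∃L a _) = FreshIn a Θ
Fits Θ (sub θ) = map (substF θ) Θ ≡ Θ
Fits Θ _ = ⊤

++∷⊆ : ∀ (Θ : List Formula) {φ Γ} → Θ ++ φ ∷ Γ ⊆ φ ∷ Θ ++ Γ
++∷⊆ [] m = m
++∷⊆ (θ ∷ Θ) (here e) = there (here e)
++∷⊆ (θ ∷ Θ) (there m) with ++∷⊆ Θ m
... | here e = here e
... | there m' = there (there m')

∷++⊆ : ∀ (Θ : List Formula) {φ Γ} → φ ∷ Θ ++ Γ ⊆ Θ ++ φ ∷ Γ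
∷++⊆ Θ (here e) = ∈-++⁺ʳ Θ (here e)
∷++⊆ Θ (there m) with ∈-++⁻ Θ m
... | inj₁ a = ∈-++⁺ˡ a
... | inj₂ b = ∈-++⁺ʳ Θ (there b)

∷∷⊆ : ∀ {φ ψ : Formula} {Γ} → φ ∷ ψ ∷ Γ ⊆ ψ ∷ φ ∷ Γ
∷∷⊆ (here e) = there (here e)
∷∷⊆ (there (here e)) = here e
∷∷⊆ (there (there m)) = there (there m)

∪-lub : ∀ (xs : List Formula) {ys zs} → xs ⊆ zs → ys ⊆ zs → xs ++ ys ⊆ zs
∪-lub xs f g m with ∈-++⁻ xs m
... | inj₁ a = f a
... | inj₂ b = g b

∷-lub : ∀ {φ : Formula} {xs zs} → φ ∈ zs → xs ⊆ zs → φ ∷ xs ⊆ zs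
∷-lub m f (here refl) = m
∷-lub m f (there x) = f x

[]⊆ : ∀ {xs : List Formula} → [] ⊆ xs
[]⊆ ()

same : ∀ {A : Set} {xs : List A} → xs ⊆ xs
same m = m

module _ (X : Seq → Set) (cl : ∀ {c ps} → Inst c ps → All X ps → X c) where

  private
    lift1 : ∀ Θ {φ Γ Δ} → X (Θ ++ φ ∷ Γ ⇒ Δ) → X (φ ∷ Θ ++ Γ ⇒ Δ)
    lift1 Θ d = cl (weak (++∷⊆ Θ) same) (d ∷ [])

    drop1 : ∀ Θ {φ Γ Δ} → X (φ ∷ Θ ++ Γ ⇒ Δ) → X (Θ ++ φ ∷ Γ ⇒ Δ)
    drop1 Θ d = cl (weak (∷++⊆ Θ) same) (d ∷ [])

    lift2 : ∀ Θ {φ ψ Γ Δ} → X (Θ ++ φ ∷ ψ ∷ Γ ⇒ Δ) → X (φ ∷ ψ ∷ Θ ++ Γ ⇒ Δ)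
    lift2 Θ d = cl (weak (λ m → ∷⁺ʳ _ (++∷⊆ Θ) (++∷⊆ Θ m)) same) (d ∷ [])

    leaf : ∀ Θ {c} → Inst c [] → X (Θ +L c)
    leaf Θ {Γ ⇒ Δ} r = cl (weak (xs⊆ys++xs Γ Θ) same) (cl r [] ∷ [])

    fresh++ : ∀ {a φ} Θ {Γ Δ} → FreshIn a Θ → FreshIn a (φ ∷ Γ ++ Δ) → FreshIn a (φ ∷ (Θ ++ Γ) ++ Δ)
    fresh++ Θ {Γ} f (g ∷ h) = g ∷ All.++⁺ (All.++⁺ f (All.++⁻ˡ Γ h)) (All.++⁻ʳ Γ h)

  -- Abstract in `X` because it serves twice: for plain derivations with axioms as side formulas,
  -- and for provability with induction hypotheses and slot bounds as side formulas.
  inContext : ∀ Θ {c ps} (r : Inst c ps) → Fits Θ r → All (X ∘ (Θ +L_)) ps → X (Θ +L c)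
  inContext Θ r@(id _) _ [] = leaf Θ r
  inContext Θ r@(eqRefl _) _ [] = leaf Θ r
  inContext Θ r@(eqSub _ _ _) _ [] = leaf Θ r
  inContext Θ r@(negL _) _ [] = leaf Θ r
  inContext Θ r@(negR _) _ [] = leaf Θ r
  inContext Θ (weak f g) _ (d ∷ []) = cl (weak (++⁺ʳ Θ f) g) (d ∷ [])
  inContext Θ (cut φ) _ (d ∷ e ∷ []) = cl (cut φ) (d ∷ lift1 Θ e ∷ [])
  inContext Θ ∧L _ (d ∷ []) = drop1 Θ (cl ∧L (lift2 Θ d ∷ []))
  inContext Θ ∧R _ (d ∷ e ∷ []) = cl ∧R (d ∷ e ∷ [])
  inContext Θ ∨L _ (d ∷ e ∷ []) = drop1 Θ (cl ∨L (lift1 Θ d ∷ lift1 Θ e ∷ []))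
  inContext Θ ∨R _ (d ∷ []) = cl ∨R (d ∷ [])
  inContext Θ (∀L t) _ (d ∷ []) = drop1 Θ (cl (∀L t) (lift1 Θ d ∷ []))
  inContext Θ (∀R a f) h (d ∷ []) = cl (∀R a (fresh++ Θ h f)) (d ∷ [])
  inContext Θ (∃L a f) h (d ∷ []) = drop1 Θ (cl (∃L a (fresh++ Θ h f)) (lift1 Θ d ∷ []))
  inContext Θ (∃R t) _ (d ∷ []) = cl (∃R t) (d ∷ [])
  inContext Θ (sub {Γ} {Δ} θ) h (d ∷ []) =
    subst (λ Ξ → X (Ξ ⇒ map (substF θ) Δ)) (trans (map-++ (substF θ) Θ Γ) (cong (_++ _) h)) (cl (sub θ) (d ∷ []))

-- Provability from the axioms and derived rules

module Theory (n : ℕ) where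

  infix 3 _⊩_

  -- With axioms as initial sequents no derivation has to carry the list of axioms that it uses;
  -- `extract` collects them once at the end.
  data Prov : Seq → Set where
    infer : ∀ {c ps} → Inst c ps → All Prov ps → Prov c
    axiom : ∀ {φ} → IΣ (suc n) φ → Prov ([] ⇒ φ ∷ [])

  IΣ-sentence : ∀ {φ} → IΣ (suc n) φ → Sentence φ
  IΣ-sentence (inj₁ (_ , _ , _ , _ , s)) = s
  IΣ-sentence (inj₂ (_ , _ , _ , _ , s)) = s

  private
    FromAxioms : Seq → Set
    FromAxioms s = Σ (List Formula) λ Ax → All (IΣ (suc n)) Ax × Deriv (Ax +L s)

    fits : ∀ {c ps Ax} → All (IΣ (suc n)) Ax → (r : Inst c ps) → Fits Ax r
    fits ax (id _) = tt
    fits ax (eqRefl _) = tt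
    fits ax (eqSub _ _ _) = tt
    fits ax (negL _) = tt
    fits ax (negR _) = tt
    fits ax (weak _ _) = tt
    fits ax (cut _) = tt
    fits ax ∧L = tt
    fits ax ∧R = tt
    fits ax ∨L = tt
    fits ax ∨R = tt
    fits ax (∀L _) = tt
    fits ax (∀R a _) = All.map (λ p → IΣ-sentence p a) ax
    fits ax (∃L a _) = All.map (λ p → IΣ-sentence p a) ax
    fits ax (∃R _) = tt
    fits [] (sub θ) = refl
    fits (p ∷ ax) (sub {Γ} {Δ} θ) = cong₂ _∷_ (substF-≗id _ (λ a f → ⊥-elim (IΣ-sentence p a f))) (fits ax (sub {Γ} {Δ} θ))

    moreAxioms : ∀ {Ax Ax' s} → Ax ⊆ Ax' → Deriv (Ax +L s) → Deriv (Ax' +L s)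
    moreAxioms {s = Γ ⇒ Δ} i d = by (weak (++⁺ {ws = _} {_} {Γ} i same) same) (d ∷ [])

  -- Axioms are sentences: no eigenvariable or substitution touches them, so the collected ones pass
  -- through every rule as side formulas.
  extract : ∀ {s} → Prov s → FromAxioms s
  private
    extractAll : ∀ {ss} → All Prov ss → Σ (List Formula) λ Ax → All (IΣ (suc n)) Ax × All (Deriv ∘ (Ax +L_)) ss
  extract (infer r ds) with Ax , ok , ds' ← extractAll ds = Ax , ok , inContext Deriv by Ax r (fits ok r) ds'
  extract (axiom {φ} p) = φ ∷ [] , p ∷ [] , by (weak (xs⊆xs++ys _ []) same) (by (id φ) [] ∷ [])
  extractAll [] = [] , [] , []
  extractAll {s ∷ ss} (d ∷ ds)
    with Ax , ok , d' ← extract d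
    with Ax' , ok' , ds' ← extractAll ds =
    Ax ++ Ax' , All.++⁺ ok ok' ,
    moreAxioms {s = s} (xs⊆xs++ys Ax Ax') d' ∷ All.map (λ {s} → moreAxioms {s = s} (xs⊆ys++xs Ax' Ax)) ds'

  fromDeriv : ∀ {s} → Deriv s → Prov s
  private
    fromDerivs : ∀ {ss} → All Deriv ss → All Prov ss
  fromDeriv (by r ds) = infer r (fromDerivs ds)
  fromDerivs [] = []
  fromDerivs (d ∷ ds) = fromDeriv d ∷ fromDerivs ds

  _⊩_ : List Formula → Formula → Set
  Γ ⊩ φ = Prov (Γ ⇒ φ ∷ [])

  weaken : ∀ {Γ Γ' Δ Δ'} → Γ ⊆ Γ' → Δ ⊆ Δ' → Prov (Γ ⇒ Δ) → Prov (Γ' ⇒ Δ')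
  weaken f g d = infer (weak f g) (d ∷ [])

  weakenL : ∀ {Γ Γ' Δ} → Γ ⊆ Γ' → Prov (Γ ⇒ Δ) → Prov (Γ' ⇒ Δ)
  weakenL f = weaken f same

  private
    [φ]⊆ : ∀ {φ : Formula} {Δ} → φ ∷ [] ⊆ φ ∷ Δ
    [φ]⊆ (here e) = here e

  hyp : ∀ {Γ φ} → φ ∈ Γ → Γ ⊩ φ
  hyp m = weakenL (∷-lub m []⊆) (infer (id _) [])

  substP : ∀ σ {Γ Δ} → Prov (Γ ⇒ Δ) → Prov (map (substF σ) Γ ⇒ map (substF σ) Δ)
  substP σ d = infer (sub σ) (d ∷ [])

  have : ∀ {Γ Δ φ} → Γ ⊩ φ → Prov (φ ∷ Γ ⇒ Δ) → Prov (Γ ⇒ Δ)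
  have d e = infer (cut _) (weaken same [φ]⊆ d ∷ e ∷ [])

  haves : ∀ Φ {Γ Δ} → All (Γ ⊩_) Φ → Prov (Φ ++ Γ ⇒ Δ) → Prov (Γ ⇒ Δ)
  haves [] [] e = e
  haves (φ ∷ Φ) (d ∷ ds) e = haves Φ ds (have (weakenL (xs⊆ys++xs _ Φ) d) e)

  close : ∀ {Γ Δ φ} → Γ ⊩ φ → Γ ⊩ dual φ → Prov (Γ ⇒ Δ)
  close d e = have d (have (weakenL there e)
    (weaken (∷-lub (there (here refl)) (∷-lub (here refl) []⊆)) []⊆ (infer (negL _) [])))

  em : ∀ {Γ Δ} φ → Prov (φ ∷ Γ ⇒ Δ) → Prov (dual φ ∷ Γ ⇒ Δ) → Prov (Γ ⇒ Δ)
  em φ d e = infer (cut φ) (infer (cut (dual φ))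
    (weaken []⊆ (∷-lub (there (here refl)) (∷-lub (here refl) []⊆)) (infer (negR φ) []) ∷ weaken same there e ∷ []) ∷ d ∷ [])

  raa : ∀ {Γ φ} → Prov (dual φ ∷ Γ ⇒ []) → Γ ⊩ φ
  raa {φ = φ} d = em φ (hyp (here refl)) (weaken same []⊆ d)

  ∧I : ∀ {Γ φ ψ} → Γ ⊩ φ → Γ ⊩ ψ → Γ ⊩ φ ∧ᶠ ψ
  ∧I d e = infer ∧R (d ∷ e ∷ [])

  ∧E : ∀ {Γ Δ φ ψ} → Γ ⊩ φ ∧ᶠ ψ → Prov (φ ∷ ψ ∷ Γ ⇒ Δ) → Prov (Γ ⇒ Δ)
  ∧E d e = have d (infer ∧L (e ∷ []))

  ∨I₁ : ∀ {Γ φ ψ} → Γ ⊩ φ → Γ ⊩ φ ∨ᶠ ψ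
  ∨I₁ d = infer ∨R (weaken same [φ]⊆ d ∷ [])

  ∨I₂ : ∀ {Γ φ ψ} → Γ ⊩ ψ → Γ ⊩ φ ∨ᶠ ψ
  ∨I₂ d = infer ∨R (weaken same there d ∷ [])

  ∨E : ∀ {Γ Δ φ ψ} → Γ ⊩ φ ∨ᶠ ψ → Prov (φ ∷ Γ ⇒ Δ) → Prov (ψ ∷ Γ ⇒ Δ) → Prov (Γ ⇒ Δ)
  ∨E d e f = have d (infer ∨L (e ∷ f ∷ []))

  ↑ : ℕ → List Formula → List Formula
  ↑ m = map (substF (up m))

  private
    bndL : List Formula → ℕ
    bndL [] = 0
    bndL (φ ∷ Γ) = bndF φ ⊔ bndL Γ

    freshAt : ∀ Γ {a} → bndL Γ ≤ a → FreshIn a Γ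
    freshAt [] le = []
    freshAt (φ ∷ Γ) le = (λ f → <-irrefl refl (<-≤-trans (free<bndF φ f) (≤-trans (m≤m⊔n _ (bndL Γ)) le)))
                        ∷ freshAt Γ (≤-trans (m≤n⊔m (bndF φ) _) le)

    single-up : ∀ t Γ → map (substF (single t)) (↑ 1 Γ) ≡ Γ
    single-up t Γ = trans (substF-map-comp _ _ Γ) (trans (map-cong substF-id Γ) (map-id Γ))

  -- The de Bruijn form of the rule: substituting a variable beyond all free ones for index 0 turns
  -- the shifted premise into the premise with a named eigenvariable.
  ∃L' : ∀ {Γ Δ φ} → Prov (φ ∷ ↑ 1 Γ ⇒ ↑ 1 Δ) → Prov (∃ᶠ φ ∷ Γ ⇒ Δ)
  ∃L' {Γ} {Δ} {φ} d = infer (∃L a (freshAt _ ≤-refl))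
    (subst₂ (λ Γ' Δ' → Prov (φ [ var a ]₀ ∷ Γ' ⇒ Δ')) (single-up _ Γ) (single-up _ Δ) (substP (single (var a)) d) ∷ [])
    where a = bndL (∃ᶠ φ ∷ Γ ++ Δ)

  ∀R' : ∀ {Γ Δ φ} → Prov (↑ 1 Γ ⇒ φ ∷ ↑ 1 Δ) → Prov (Γ ⇒ ∀ᶠ φ ∷ Δ)
  ∀R' {Γ} {Δ} {φ} d = infer (∀R a (freshAt _ ≤-refl))
    (subst₂ (λ Γ' Δ' → Prov (Γ' ⇒ φ [ var a ]₀ ∷ Δ')) (single-up _ Γ) (single-up _ Δ) (substP (single (var a)) d) ∷ [])
    where a = bndL (∀ᶠ φ ∷ Γ ++ Δ)

  ∃I : ∀ {Γ φ} t → Γ ⊩ φ [ t ]₀ → Γ ⊩ ∃ᶠ φ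
  ∃I t d = infer (∃R t) (d ∷ [])

  ∃E : ∀ {Γ Δ φ} → Γ ⊩ ∃ᶠ φ → Prov (φ ∷ ↑ 1 Γ ⇒ ↑ 1 Δ) → Prov (Γ ⇒ Δ)
  ∃E d e = have d (∃L' e)

  ∀E : ∀ {Γ φ} t → Γ ⊩ ∀ᶠ φ → Γ ⊩ φ [ t ]₀
  ∀E t d = have d (infer (∀L t) (hyp (here refl) ∷ []))

  allsE : ∀ m s {Γ φ} → Γ ⊩ alls m φ → Γ ⊩ substF (inst m s) φ
  allsE zero s {Γ} {φ} d = subst (Γ ⊩_) (sym (substF-≗id φ (λ a _ → inst-ge 0 s a))) d
  allsE (suc m) s {Γ} {φ} d = subst (Γ ⊩_) (trans (substF-comp _ _ φ) (substF-≗ φ (inst-suc m s)))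
    (allsE m s (subst (Γ ⊩_) (alls-subst m (single (s m)) φ) (∀E (s m) d)))

  allsI : ∀ m {Γ φ} → ↑ m Γ ⊩ φ → Γ ⊩ alls m φ
  allsI zero {Γ} {φ} d = subst (_⊩ φ) (trans (map-cong substF-id Γ) (map-id Γ)) d
  allsI (suc m) {Γ} {φ} d = ∀R' (allsI m (subst (_⊩ φ) (sym eq) d))
    where
    eq : ↑ m (↑ 1 Γ) ≡ ↑ (suc m) Γ
    eq = trans (substF-map-comp _ _ Γ) (map-cong (λ φ → substF-≗ φ λ a → cong var (+-suc m a)) Γ)

  -- In a context shifted by `m` the indices below `m` are free to stand for the bound variables of
  -- the block, so instantiating each by itself returns the matrix.
  allsE-self : ∀ m {Γ φ} → ↑ m Γ ⊩ substF (up m) (alls m φ) → ↑ m Γ ⊩ φ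
  allsE-self m {Γ} {φ} d = subst (↑ m Γ ⊩_) (trans (substF-comp _ _ φ) (substF-≗id φ (λ a _ → inst-lift-up m a)))
    (allsE m var (subst (↑ m Γ ⊩_) (alls-subst m (up m) φ) d))

  orR : ∀ L {Γ Δ} → Prov (Γ ⇒ L ++ Δ) → Prov (Γ ⇒ bigOr L ∷ Δ)
  orR [] d = weaken same there d
  orR (φ ∷ L) d = infer ∨R (weaken same ∷∷⊆ (orR L (weaken same (∷++⊆ L) d)) ∷ [])

  dualR : ∀ Γ {Θ Δ} → Prov (Γ ++ Θ ⇒ Δ) → Prov (Θ ⇒ map dual Γ ++ Δ)
  dualR [] d = d
  dualR (φ ∷ Γ) d = weaken same (++∷⊆ (map dual Γ)) (dualR Γ (em φ (weaken same there d) (hyp' (here refl))))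
    where
    hyp' : ∀ {φ Γ Δ} → φ ∈ Γ → Prov (Γ ⇒ φ ∷ Δ)
    hyp' m = weaken same [φ]⊆ (hyp m)

  seqFormulaI : ∀ {Θ Γ Δ} → Prov (Γ ++ Θ ⇒ Δ) → Θ ⊩ seqFormula (Γ ⇒ Δ)
  seqFormulaI {Γ = Γ} {Δ} d = orR (map dual Γ ++ Δ) (weaken same (xs⊆xs++ys _ []) (dualR Γ d))

  orL : ∀ {Θ Ξ} L → All (λ φ → Prov (φ ∷ Θ ⇒ Ξ)) L → Prov (bigOr L ∷ Θ ⇒ Ξ)
  orL [] [] = close (weakenL []⊆ (infer (eqRefl 𝟎) [])) (hyp (here refl))
  orL (φ ∷ L) (d ∷ ds) = infer ∨L (d ∷ orL L ds ∷ [])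

  seqFormulaE : ∀ {Θ Ξ Γ Δ} → Θ ⊩ seqFormula (Γ ⇒ Δ) → All (Θ ⊩_) Γ → All (λ δ → Prov (δ ∷ Θ ⇒ Ξ)) Δ → Prov (Θ ⇒ Ξ)
  seqFormulaE {Γ = Γ} d as bs = have d (orL _ (All.++⁺ (All.map⁺ (All.map neg as)) bs))
    where
    neg : ∀ {γ Θ Ξ} → Θ ⊩ γ → Prov (dual γ ∷ Θ ⇒ Ξ)
    neg d = close (weakenL there d) (hyp (here refl))

-- Equality, order and induction inside the theory

module Arithmetic (n : ℕ) where

  open Theory n

  infixr 5 _•_
  _•_ : Term → Subst → Subst
  (t • ρ) zero = t
  (t • ρ) (suc i) = ρ i

  -- The theory contains every universal closure; the one over all indices below `bndF ψ` is a
  -- sentence, and instantiating it by the variables themselves recovers `ψ` with its parameters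
  -- free.
  closedAxiom : ∀ ψ → (∀ {φ} → UClosureOf φ ψ → IΣ (suc n) φ) → ∀ {Γ} → Γ ⊩ ψ
  closedAxiom ψ f = weakenL []⊆ (subst ([] ⊩_) (substF-≗id ψ λ a h → inst-lt k var (free<bndF ψ h))
      (allsE k var (axiom (f (k , refl , alls-sentence k ψ λ a → free<bndF ψ)))))
    where k = bndF ψ

  qAxiom : ∀ {ψ Γ} → QAxiom ψ → Γ ⊩ ψ
  qAxiom q = closedAxiom _ λ u → inj₁ (_ , q , u)

  cast : ∀ {Γ φ ψ} → φ ≡ ψ → Γ ⊩ φ → Γ ⊩ ψ
  cast {Γ} = subst (Γ ⊩_)

  castL : ∀ {Γ Γ' Δ} → Γ ≡ Γ' → Prov (Γ ⇒ Δ) → Prov (Γ' ⇒ Δ)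
  castL {Δ = Δ} = subst (λ Γ → Prov (Γ ⇒ Δ))

  ≐-refl : ∀ {Γ} t → Γ ⊩ t ≐ t
  ≐-refl t = weakenL []⊆ (infer (eqRefl t) [])

  rewrite' : ∀ φ {Γ t u} → Γ ⊩ t ≐ u → Γ ⊩ φ [ t ]₀ → Γ ⊩ φ [ u ]₀
  rewrite' φ d e = haves (_ ∷ _ ∷ []) (d ∷ e ∷ []) (weakenL (∷-lub (here refl) (∷-lub (there (here refl)) []⊆)) (infer (eqSub _ _ φ) []))

  ≐-sym : ∀ {Γ t u} → Γ ⊩ t ≐ u → Γ ⊩ u ≐ t
  ≐-sym {Γ} {t} {u} d = subst (λ s → Γ ⊩ u ≐ s) (single-wkT u t)
    (rewrite' (var 0 ≐ wk t) d (subst (λ s → Γ ⊩ t ≐ s) (sym (single-wkT t t)) (≐-refl t)))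

  ≐-trans : ∀ {Γ t u v} → Γ ⊩ t ≐ u → Γ ⊩ u ≐ v → Γ ⊩ t ≐ v
  ≐-trans {Γ} {t} {u} {v} d e = subst (λ s → Γ ⊩ s ≐ v) (single-wkT v t)
    (rewrite' (wk t ≐ var 0) e (subst (λ s → Γ ⊩ s ≐ u) (sym (single-wkT u t)) d))

  S-cong : ∀ {Γ t u} → Γ ⊩ t ≐ u → Γ ⊩ S t ≐ S u
  S-cong {Γ} {t} {u} d = subst (λ s → Γ ⊩ S s ≐ S u) (single-wkT u t)
    (rewrite' (S (wk t) ≐ S (var 0)) d (subst (λ s → Γ ⊩ S s ≐ S t) (sym (single-wkT t t)) (≐-refl (S t))))

  ⊕-congˡ : ∀ {Γ t u} v → Γ ⊩ t ≐ u → Γ ⊩ t ⊕ v ≐ u ⊕ v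
  ⊕-congˡ {Γ} {t} {u} v d = subst₂ (λ s r → Γ ⊩ s ⊕ r ≐ u ⊕ r) (single-wkT u t) (single-wkT u v)
    (rewrite' (wk t ⊕ wk v ≐ var 0 ⊕ wk v) d
      (subst₂ (λ s r → Γ ⊩ s ⊕ r ≐ t ⊕ r) (sym (single-wkT t t)) (sym (single-wkT t v)) (≐-refl (t ⊕ v))))

  ⊕-congʳ : ∀ {Γ t u} v → Γ ⊩ t ≐ u → Γ ⊩ v ⊕ t ≐ v ⊕ u
  ⊕-congʳ {Γ} {t} {u} v d = subst₂ (λ s r → Γ ⊩ r ⊕ s ≐ r ⊕ u) (single-wkT u t) (single-wkT u v)
    (rewrite' (wk v ⊕ wk t ≐ wk v ⊕ var 0) d
      (subst₂ (λ s r → Γ ⊩ r ⊕ s ≐ r ⊕ t) (sym (single-wkT t t)) (sym (single-wkT t v)) (≐-refl (v ⊕ t))))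

  ≺-rewˡ : ∀ {Γ t u v} → Γ ⊩ t ≐ u → Γ ⊩ t ≺ v → Γ ⊩ u ≺ v
  ≺-rewˡ {Γ} {t} {u} {v} d e = subst (λ s → Γ ⊩ u ≺ s) (single-wkT u v)
    (rewrite' (var 0 ≺ wk v) d (subst (λ s → Γ ⊩ t ≺ s) (sym (single-wkT t v)) e))

  ≺-rewʳ : ∀ {Γ t u v} → Γ ⊩ t ≐ u → Γ ⊩ v ≺ t → Γ ⊩ v ≺ u
  ≺-rewʳ {Γ} {t} {u} {v} d e = subst (λ s → Γ ⊩ s ≺ u) (single-wkT u v)
    (rewrite' (wk v ≺ var 0) d (subst (λ s → Γ ⊩ s ≺ t) (sym (single-wkT t v)) e))

  -- Robinson arithmetic

  private
    instQ : ∀ σ {φ Γ} → [] ⊩ φ → Γ ⊩ substF σ φ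
    instQ σ d = weakenL []⊆ (substP σ d)

  S≢0 : ∀ {Γ} t → Γ ⊩ S t ≠ 𝟎
  S≢0 t = instQ (λ _ → t) (qAxiom a1)

  S-injective : ∀ {Γ t u} → Γ ⊩ S t ≐ S u → Γ ⊩ t ≐ u
  S-injective {t = t} {u} d = ∨E (instQ (t • λ _ → u) (qAxiom a2)) (close (weakenL there d) (hyp (here refl))) (hyp (here refl))

  zero-or-suc : ∀ {Γ} t → Γ ⊩ (t ≐ 𝟎) ∨ᶠ ∃ᶠ (wk t ≐ S x0)
  zero-or-suc t = instQ (λ _ → t) (qAxiom a3)

  ⊕-zero : ∀ {Γ} t → Γ ⊩ t ⊕ 𝟎 ≐ t
  ⊕-zero t = instQ (λ _ → t) (qAxiom a4)

  ⊕-suc : ∀ {Γ} t u → Γ ⊩ t ⊕ S u ≐ S (t ⊕ u)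
  ⊕-suc t u = instQ (t • λ _ → u) (qAxiom a5)

  ≺-elim : ∀ {Γ t u} → Γ ⊩ t ≺ u → Γ ⊩ ∃ᶠ (wk t ⊕ S x0 ≐ wk u)
  ≺-elim {t = t} {u} d = ∧E (instQ (t • λ _ → u) (qAxiom a8))
    (∨E (hyp (here refl)) (close (weakenL (there ∘ there ∘ there) d) (hyp (here refl))) (hyp (here refl)))

  ≺-intro : ∀ {Γ t u} v → Γ ⊩ t ⊕ S v ≐ u → Γ ⊩ t ≺ u
  ≺-intro {Γ} {t} {u} v d = ∧E (instQ (t • λ _ → u) (qAxiom a8))
    (∨E (hyp (there (here refl)))
      (close (weakenL (there ∘ there ∘ there) d)
        (cast (cong₂ (λ a b → a ⊕ S v ≠ b) (single-wkT v t) (single-wkT v u)) (∀E {φ = wk t ⊕ S x0 ≠ wk u} v (hyp (here refl)))))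
      (hyp (here refl)))

  QInit-sound : ∀ {s} → QInit s → Prov s
  QInit-sound (q1 t) = S≢0 t
  QInit-sound (q2 t u) = S-injective (hyp (here refl))
  QInit-sound (q3 t) = ∨E (zero-or-suc t) (close (hyp (here refl)) (hyp (there (here refl)))) (hyp (here refl))
  QInit-sound (q4 t) = ⊕-zero t
  QInit-sound (q5 t u) = ⊕-suc t u
  QInit-sound (q6 t) = instQ (λ _ → t) (qAxiom a6)
  QInit-sound (q7 t u) = instQ (t • λ _ → u) (qAxiom a7)
  QInit-sound (q8 t u) = ≺-elim (hyp (here refl))
  QInit-sound (q9 t u v) = ≺-intro v (hyp (here refl))

  ⊀0 : ∀ {Γ Δ t} → Γ ⊩ t ≺ 𝟎 → Prov (Γ ⇒ Δ)
  ⊀0 {t = t} d = ∃E (≺-elim d) (close (≐-trans (≐-sym (⊕-suc (wk t) x0)) (hyp (here refl))) (S≢0 _))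

  ≺-S : ∀ {Γ} t → Γ ⊩ t ≺ S t
  ≺-S t = ≺-intro 𝟎 (≐-trans (⊕-suc t 𝟎) (S-cong (⊕-zero t)))

  ≺-S-mono : ∀ {Γ t u} → Γ ⊩ t ≺ u → Γ ⊩ t ≺ S u
  ≺-S-mono {t = t} {u} d = ∃E (≺-elim d) (≺-intro (S x0) (≐-trans (⊕-suc _ _) (S-cong (hyp (here refl)))))

  ≺S-cases : ∀ {Γ t u} → Γ ⊩ t ≺ S u → Γ ⊩ (t ≺ u) ∨ᶠ (t ≐ u)
  ≺S-cases {t = t} {u} d = ∃E (≺-elim d)
    (have (S-injective (≐-trans (≐-sym (⊕-suc (wk t) x0)) (hyp (here refl))))
    (∨E (zero-or-suc x0)
      (∨I₂ (≐-trans (≐-sym (⊕-zero (wk t))) (≐-trans (⊕-congʳ (wk t) (≐-sym (hyp (here refl)))) (hyp (there (here refl))))))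
      (∃E (hyp (here refl))
        (∨I₁ (≺-intro x0 (≐-trans (⊕-congʳ _ (≐-sym (hyp (here refl)))) (hyp (there (there (here refl))))))))))

  -- Equivalence and prenex forms

  infix 3 _⊣⊢_
  _⊣⊢_ : Formula → Formula → Set
  φ ⊣⊢ ψ = (φ ∷ [] ⊩ ψ) × (ψ ∷ [] ⊩ φ)

  via : ∀ {Γ φ ψ} → Γ ⊩ φ → φ ∷ [] ⊩ ψ → Γ ⊩ ψ
  via d e = have d (weakenL (∷-lub (here refl) []⊆) e)

  ⊣⊢-refl : ∀ {φ} → φ ⊣⊢ φ
  ⊣⊢-refl = hyp (here refl) , hyp (here refl)

  ⊣⊢-trans : ∀ {φ ψ χ} → φ ⊣⊢ ψ → ψ ⊣⊢ χ → φ ⊣⊢ χ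
  ⊣⊢-trans (a , b) (c , d) = via a c , via d b

  private
    single-lift-up : ∀ φ → substF (single x0) (substF (liftS (up 1)) φ) ≡ φ
    single-lift-up φ = trans (substF-comp _ _ φ) (substF-≗id φ λ { zero _ → refl ; (suc a) _ → refl })

    ∃-mono : ∀ {φ ψ} → φ ∷ [] ⊩ ψ → ∃ᶠ φ ∷ [] ⊩ ∃ᶠ ψ
    ∃-mono {ψ = ψ} d = ∃L' (∃I x0 (cast (sym (single-lift-up ψ)) d))

    ∀-mono : ∀ {φ ψ} → φ ∷ [] ⊩ ψ → ∀ᶠ φ ∷ [] ⊩ ∀ᶠ ψ
    ∀-mono {φ} d = ∀R' (via (cast (single-lift-up φ) (∀E x0 (hyp (here refl)))) d)

    ∧-mono : ∀ {φ ψ φ' ψ'} → φ ∷ [] ⊩ φ' → ψ ∷ [] ⊩ ψ' → φ ∧ᶠ ψ ∷ [] ⊩ φ' ∧ᶠ ψ'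
    ∧-mono d e = ∧E (hyp (here refl)) (∧I (via (hyp (here refl)) d) (via (hyp (there (here refl))) e))

  ∃-cong : ∀ {φ ψ} → φ ⊣⊢ ψ → ∃ᶠ φ ⊣⊢ ∃ᶠ ψ
  ∃-cong (a , b) = ∃-mono a , ∃-mono b

  ∀-cong : ∀ {φ ψ} → φ ⊣⊢ ψ → ∀ᶠ φ ⊣⊢ ∀ᶠ ψ
  ∀-cong (a , b) = ∀-mono a , ∀-mono b

  ∧-cong : ∀ {φ ψ φ' ψ'} → φ ⊣⊢ φ' → ψ ⊣⊢ ψ' → φ ∧ᶠ ψ ⊣⊢ φ' ∧ᶠ ψ'
  ∧-cong (a , b) (c , d) = ∧-mono a c , ∧-mono b d

  ∧-comm : ∀ {φ ψ} → φ ∧ᶠ ψ ⊣⊢ ψ ∧ᶠ φ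
  ∧-comm = flip , flip
    where
    flip : ∀ {φ ψ} → φ ∧ᶠ ψ ∷ [] ⊩ ψ ∧ᶠ φ
    flip = ∧E (hyp (here refl)) (∧I (hyp (there (here refl))) (hyp (here refl)))

  private
    ↑₁ : Formula → Formula
    ↑₁ = substF (up 1)

    single-up : ∀ t φ → (↑₁ φ) [ t ]₀ ≡ φ
    single-up t φ = trans (substF-comp _ _ φ) (substF-id φ)

  ∃∧-prenex : ∀ φ ψ → ∃ᶠ φ ∧ᶠ ψ ⊣⊢ ∃ᶠ (φ ∧ᶠ ↑₁ ψ)
  ∃∧-prenex φ ψ =
    ∧E (hyp (here refl)) (∃E (hyp (here refl)) (∃I x0
      (∧I (cast (sym (single-lift-up φ)) (hyp (here refl)))
          (cast (sym (single-lift-up (↑₁ ψ))) (hyp (there (there (here refl)))))))) ,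
    ∃L' (∧E (hyp (here refl)) (∧I (∃I x0 (cast (sym (single-lift-up φ)) (hyp (here refl)))) (hyp (there (here refl)))))

  ∀∧-prenex : ∀ φ ψ → ∀ᶠ φ ∧ᶠ ψ ⊣⊢ ∀ᶠ (φ ∧ᶠ ↑₁ ψ)
  ∀∧-prenex φ ψ =
    ∀R' (∧E (hyp (here refl)) (∧I (cast (single-lift-up φ) (∀E x0 (hyp (here refl)))) (hyp (there (here refl))))) ,
    ∧I (∀R' (∧E (∀E x0 (hyp (here refl))) (cast (single-lift-up φ) (hyp (here refl)))))
       (∧E (∀E 𝟎 (hyp (here refl))) (cast (single-up 𝟎 ψ) (hyp (there (here refl)))))

  -- The classes `Sig` and `Pi` are literal quantifier prefixes, so a conjunction falls into them
  -- only after prenexing, that is up to provable equivalence.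
  SigEq PiEq : ℕ → Formula → Set
  SigEq m φ = Σ Formula λ φ' → Sig m φ' × (φ ⊣⊢ φ')
  PiEq m φ = Σ Formula λ φ' → Pi m φ' × (φ ⊣⊢ φ')

  SigEq-resp : ∀ {m φ ψ} → φ ⊣⊢ ψ → SigEq m ψ → SigEq m φ
  SigEq-resp e (χ , p , f) = χ , p , ⊣⊢-trans e f

  PiEq-resp : ∀ {m φ ψ} → φ ⊣⊢ ψ → PiEq m ψ → PiEq m φ
  PiEq-resp e (χ , p , f) = χ , p , ⊣⊢-trans e f

  SigEq-∃ : ∀ {m φ} → SigEq (suc m) φ → SigEq (suc m) (∃ᶠ φ)
  SigEq-∃ (_ , (k , ψ , refl , p) , f) = _ , (suc k , ψ , refl , p) , ∃-cong f

  PiEq-∀ : ∀ {m φ} → PiEq (suc m) φ → PiEq (suc m) (∀ᶠ φ)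
  PiEq-∀ (_ , (k , ψ , refl , p) , f) = _ , (suc k , ψ , refl , p) , ∀-cong f

  Sig-∧ : ∀ m {φ ψ} → Sig m φ → Sig m ψ → SigEq m (φ ∧ᶠ ψ)
  Pi-∧ : ∀ m {φ ψ} → Pi m φ → Pi m ψ → PiEq m (φ ∧ᶠ ψ)
  Sig-∧ zero p q = _ , b∧ p q , ⊣⊢-refl
  Sig-∧ (suc m) (k , φ , refl , p) (l , ψ , refl , q) = go k l φ ψ p q
    where
    go : ∀ k l φ ψ → Pi m φ → Pi m ψ → SigEq (suc m) (exs k φ ∧ᶠ exs l ψ)
    go zero zero φ ψ p q with χ , r , e ← Pi-∧ m p q = χ , (0 , χ , refl , r) , e
    go zero (suc l) φ ψ p q =
      SigEq-resp (⊣⊢-trans ∧-comm (⊣⊢-trans (∃∧-prenex _ _) (∃-cong ∧-comm))) (SigEq-∃ (go zero l (↑₁ φ) ψ (Pi-subst m _ p) q))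
    go (suc k) l φ ψ p q = SigEq-resp (∃∧-prenex _ _)
      (SigEq-∃ (subst (λ χ → SigEq (suc m) (exs k φ ∧ᶠ χ)) (sym (exs-subst l (up 1) ψ)) (go k l φ _ p (Pi-subst m _ q))))
  Pi-∧ zero p q = _ , b∧ p q , ⊣⊢-refl
  Pi-∧ (suc m) (k , φ , refl , p) (l , ψ , refl , q) = go k l φ ψ p q
    where
    go : ∀ k l φ ψ → Sig m φ → Sig m ψ → PiEq (suc m) (alls k φ ∧ᶠ alls l ψ)
    go zero zero φ ψ p q with χ , r , e ← Sig-∧ m p q = χ , (0 , χ , refl , r) , e
    go zero (suc l) φ ψ p q =
      PiEq-resp (⊣⊢-trans ∧-comm (⊣⊢-trans (∀∧-prenex _ _) (∀-cong ∧-comm))) (PiEq-∀ (go zero l (↑₁ φ) ψ (Sig-subst m _ p) q))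
    go (suc k) l φ ψ p q = PiEq-resp (∀∧-prenex _ _)
      (PiEq-∀ (subst (λ χ → PiEq (suc m) (alls k φ ∧ᶠ χ)) (sym (alls-subst l (up 1) ψ)) (go k l φ _ p (Sig-subst m _ q))))

  SigEq-∧ : ∀ m {φ ψ} → SigEq m φ → SigEq m ψ → SigEq m (φ ∧ᶠ ψ)
  SigEq-∧ m (_ , p , e) (_ , q , f) = SigEq-resp (∧-cong e f) (Sig-∧ m p q)

  SigEq-exs : ∀ {m} k {φ} → SigEq (suc m) φ → SigEq (suc m) (exs k φ)
  SigEq-exs zero p = p
  SigEq-exs (suc k) p = SigEq-∃ (SigEq-exs k p)

  SigEq-subst : ∀ m σ {φ} → SigEq m φ → SigEq m (substF σ φ)
  SigEq-subst m σ (φ' , p , a , b) = _ , Sig-subst m σ p , substP σ a , substP σ b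

  -- The axiom speaks about the prenex form `ψ'`; base case, step and conclusion are carried across
  -- the equivalence.
  sigInd : ∀ {Γ ψ} → SigEq (suc n) ψ → Γ ⊩ ψ [ 𝟎 ]₀ → ψ ∷ ↑ 1 Γ ⊩ substF sucSub ψ → Γ ⊩ ∀ᶠ ψ
  sigInd {Γ} {ψ} (ψ' , p , a , b) base ih =
    ∨E (closedAxiom (Ind ψ') (λ u → inj₂ (ψ' , p , u)))
      (close (weakenL there (via base (substP (single 𝟎) a))) (hyp (here refl)))
      (∨E (hyp (here refl))
        (∃E (hyp (here refl)) (∧E (hyp (here refl))
          (close (weakenL (∷-lub (here refl) (there ∘ there ∘ there ∘ there ∘ there)) ih') (hyp (there (here refl))))))
        (via (hyp (here refl)) (∀-mono b)))
    where
    ih' : ψ' ∷ ↑ 1 Γ ⊩ substF sucSub ψ'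
    ih' = via (have (via (hyp (here refl)) b) (weakenL (∷-lub (here refl) (there ∘ there)) ih)) (substP sucSub a)

  private
    atomInd : ∀ {φ} → Bounded φ → [] ⊩ φ [ 𝟎 ]₀ → φ ∷ [] ⊩ substF sucSub φ → [] ⊩ φ
    atomInd {φ} p base ih = subst ([] ⊩_) (single-lift-up φ)
      (∀E x0 (substP (up 1) (sigInd (φ , Bounded⇒Sig (suc n) p , ⊣⊢-refl) base ih)))

  suc-⊕ : ∀ {Γ} t u → Γ ⊩ S t ⊕ u ≐ S (t ⊕ u)
  suc-⊕ t u = instQ (u • λ _ → t) (atomInd {S x1 ⊕ x0 ≐ S (x1 ⊕ x0)} (b≐ _ _)
    (≐-trans (⊕-zero (S x0)) (S-cong (≐-sym (⊕-zero x0))))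
    (≐-trans (⊕-suc (S x1) x0) (S-cong (≐-trans (hyp (here refl)) (≐-sym (⊕-suc x1 x0))))))

  ⊕-S≢ : ∀ {Γ} t u → Γ ⊩ t ⊕ S u ≠ u
  ⊕-S≢ t u = instQ (u • λ _ → t) (atomInd {x1 ⊕ S x0 ≠ x0} (b≠ _ _)
    (raa (close (≐-trans (≐-sym (⊕-suc x0 𝟎)) (hyp (here refl))) (S≢0 _)))
    (raa (close (S-injective (≐-trans (≐-sym (⊕-suc x1 (S x0))) (hyp (here refl)))) (hyp (there (here refl))))))

  -- Induction on the largest term `v`. Both hypotheses are moved into a disjunction so that the
  -- induction formula is bounded.
  ≺-trans : ∀ {Γ t u v} → Γ ⊩ t ≺ u → Γ ⊩ u ≺ v → Γ ⊩ t ≺ v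
  ≺-trans {t = t} {u} {v} d e =
    ∨E (instQ (v • t • λ _ → u) disj) (close (weakenL there d) (hyp (here refl)))
    (∨E (hyp (here refl)) (close (weakenL (there ∘ there) e) (hyp (here refl))) (hyp (here refl)))
    where
    x2 = var 2
    disj : [] ⊩ (x1 ⊀ x2) ∨ᶠ (x2 ⊀ x0) ∨ᶠ (x1 ≺ x0)
    disj = atomInd (b∨ (b⊀ _ _) (b∨ (b⊀ _ _) (b≺ _ _)))
      (∨I₂ (∨I₁ (raa (⊀0 (hyp (here refl))))))
      (∨E (hyp (here refl)) (∨I₁ (hyp (here refl)))
        (∨E (hyp (here refl))
          (em (x1 ≺ x2)
            (∨I₂ (em (x2 ≺ S x0)
              (∨E (≺S-cases (hyp (here refl)))
                (close (hyp (here refl)) (hyp (there (there (there (here refl))))))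
                (∨I₂ (≺-S-mono (≺-rewʳ (hyp (here refl)) (hyp (there (there (here refl))))))))
              (∨I₁ (hyp (here refl)))))
            (∨I₁ (hyp (here refl))))
          (∨I₂ (∨I₂ (≺-S-mono (hyp (here refl)))))))

  ≺-≤-trans : ∀ {Γ t u v} → Γ ⊩ t ≺ u → Γ ⊩ u ≺ S v → Γ ⊩ t ≺ v
  ≺-≤-trans d e = ∨E (≺S-cases e) (≺-trans (weakenL there d) (hyp (here refl))) (≺-rewʳ (hyp (here refl)) (weakenL there d))

  -- Π-induction for ξ up to t is Σ-induction for ψ(x) = ∃y (y + x = t ∧ ¬ ξ(y)): a failure at t
  -- would descend t + 1 times.
  module _ (ξ : Formula) (t : Term) where
    private
      body ψ : Formula
      body = (x0 ⊕ x1 ≐ wk (wk t)) ∧ᶠ substF (liftS (up 1)) (dual ξ)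
      ψ = ∃ᶠ body

      body-subst : ∀ y ρ → substF (y • ρ) body ≡ (y ⊕ ρ 0 ≐ substT (ρ ∘ suc) t) ∧ᶠ substF (y • (ρ ∘ suc)) (dual ξ)
      body-subst y ρ = cong₂ _∧ᶠ_ (cong (y ⊕ ρ 0 ≐_) (trans (substT-comp _ _ (wk t)) (substT-comp _ _ t)))
        (trans (substF-comp _ _ (dual ξ)) (substF-≗ (dual ξ) λ { zero → refl ; (suc i) → refl }))

      ψ-intro : ∀ {Γ} ρ y → Γ ⊩ y ⊕ ρ 0 ≐ substT (ρ ∘ suc) t → Γ ⊩ substF (y • (ρ ∘ suc)) (dual ξ) → Γ ⊩ substF ρ ψ
      ψ-intro ρ y d e = ∃I y (cast
        (sym (trans (substF-comp _ _ body) (trans (substF-≗ body λ { zero → refl ; (suc i) → single-wkT y (ρ i) }) (body-subst y ρ))))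
        (∧I d e))

      ψ-elim : ∀ {Γ Δ} ρ → Γ ⊩ substF ρ ψ →
        Prov ((x0 ⊕ wk (ρ 0) ≐ substT (wk ∘ ρ ∘ suc) t) ∷ substF (x0 • (wk ∘ ρ ∘ suc)) (dual ξ) ∷ ↑ 1 Γ ⇒ ↑ 1 Δ) → Prov (Γ ⇒ Δ)
      ψ-elim ρ d e = ∃E d (∧E (cast
        (trans (substF-≗ body {liftS ρ} λ { zero → refl ; (suc i) → refl }) (body-subst x0 (wk ∘ ρ)))
        (hyp (here refl))) (weakenL (∷-lub (here refl) (∷-lub (there (here refl)) (there ∘ there ∘ there))) e))

      ξ-rewrite : ∀ {Γ a b} ρ → Γ ⊩ a ≐ b → Γ ⊩ substF (a • ρ) ξ → Γ ⊩ substF (b • ρ) ξ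
      ξ-rewrite {Γ} ρ d e = subst (Γ ⊩_) (eq _) (rewrite' (substF (liftS ρ) ξ) d (subst (Γ ⊩_) (sym (eq _)) e))
        where
        eq : ∀ a → substF (liftS ρ) ξ [ a ]₀ ≡ substF (a • ρ) ξ
        eq a = trans (substF-comp _ _ ξ) (substF-≗ ξ λ { zero → refl ; (suc i) → single-wkT a (ρ i) })

      single-• : ∀ s φ → substF (s • var) φ ≡ φ [ s ]₀
      single-• s φ = substF-≗ φ λ { zero → refl ; (suc i) → refl }

      •-comp : ∀ {Γ} s ρ → map (substF (s • ρ)) (↑ 1 Γ) ≡ map (substF ρ) Γ
      •-comp {Γ} s ρ = substF-map-comp _ _ Γ

    piInd : ∀ {Γ} → SigEq (suc n) (dual ξ) → Γ ⊩ ξ [ 𝟎 ]₀ → ξ ∷ ↑ 1 Γ ⊩ substF sucSub ξ → Γ ⊩ ξ [ t ]₀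
    piInd {Γ} sig base ih = raa (ψ-elim (single (S t)) (∀E (S t) (sigInd ψ-sig ψ-base ψ-step))
        (close (hyp (here refl)) (⊕-S≢ x0 (wk t))))
      where
      ψ-sig : SigEq (suc n) ψ
      ψ-sig = SigEq-∃ (SigEq-∧ (suc n) (_ , Bounded⇒Sig (suc n) (b≐ _ _) , ⊣⊢-refl) (SigEq-subst (suc n) _ sig))

      Γ' = dual (ξ [ t ]₀) ∷ Γ

      ψ-base : Γ' ⊩ ψ [ 𝟎 ]₀
      ψ-base = ψ-intro (single 𝟎) t (cast (cong (t ⊕ 𝟎 ≐_) (sym (substT-id t))) (⊕-zero t))
        (subst (Γ' ⊩_) (trans (dual-substF (single t) ξ) (sym (single-• t (dual ξ)))) (hyp (here refl)))

      at : ℕ → Subst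
      at k i = var (k + i)

      base' : ∀ k → map (substF (at k)) Γ ⊩ substF (𝟎 • at k) ξ
      base' k = cast (trans (substF-comp _ _ ξ) (substF-≗ ξ λ { zero → refl ; (suc i) → refl })) (substP (at k) base)

      ih' : ∀ s ρ → substF (s • ρ) ξ ∷ map (substF ρ) Γ ⊩ substF (S s • ρ) ξ
      ih' s ρ = subst₂ (λ Ξ χ → substF (s • ρ) ξ ∷ Ξ ⊩ χ) (•-comp s ρ)
        (trans (substF-comp _ _ ξ) (substF-≗ ξ λ { zero → refl ; (suc i) → refl })) (substP (s • ρ) ih)

      ↑-fuse : ∀ k → ↑ 1 (map (substF (at k)) Γ) ≡ map (substF (at (suc k))) Γ
      ↑-fuse k = substF-map-comp _ _ Γ

      ψ-step : ψ ∷ ↑ 1 Γ' ⊩ substF sucSub ψ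
      ψ-step = ψ-elim var (cast (sym (substF-id ψ)) (hyp (here refl)))
        -- Here `x0` is the witness at which `ξ` fails. It cannot be zero by `base`, and by `ih` its
        -- predecessor fails too; the predecessor is the next witness.
        (∨E (zero-or-suc x0)
          (close (ξ-rewrite (at 2) (≐-sym (hyp (here refl)))
                   (weakenL (there ∘ there ∘ there ∘ there ∘ there) (castL (sym (↑-fuse 1)) (base' 2))))
                 (cast (sym (dual-substF _ ξ)) (hyp (there (there (here refl))))))
          (∃E (hyp (here refl)) (cast (sym goal) (ψ-intro (S (var 2) • at 3) x0
            (≐-trans (≐-trans (⊕-suc x0 (var 2)) (≐-sym (suc-⊕ x0 (var 2))))
              (≐-trans (⊕-congˡ (var 2) (≐-sym (hyp (here refl))))
                (cast (cong (x1 ⊕ var 2 ≐_) (substT-comp _ _ t)) (hyp (there (there (here refl)))))))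
            (cast (dual-substF _ ξ) (raa
              (close (ξ-rewrite (at 3) (≐-sym (hyp (there (here refl))))
                       (weakenL (∷-lub (here refl) (there ∘ there ∘ there ∘ there ∘ there ∘ there ∘ there))
                         (castL (cong₂ _∷_ (sym (dual-dual _))
                           (sym (trans (cong (↑ 1) (↑-fuse 1)) (↑-fuse 2)))) (ih' x0 (at 3)))))
                     (cast (trans nξ (sym (dual-substF _ ξ))) (hyp (there (there (there (there (here refl))))))))))))))
        where
        goal : substF (up 1) (substF (up 1) (substF sucSub ψ)) ≡ substF (S (var 2) • at 3) ψ
        goal = trans (cong (substF (up 1)) (substF-comp _ _ ψ)) (trans (substF-comp _ _ ψ)
          (substF-≗ ψ λ { zero → refl ; (suc i) → refl }))
        nξ : substF (up 1) (substF (x0 • at 2) (dual ξ)) ≡ substF (x1 • at 3) (dual ξ)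
        nξ = trans (substF-comp _ _ (dual ξ)) (substF-≗ (dual ξ) λ { zero → refl ; (suc i) → refl })

-- Nested induction along a parity condition

-- `good x` stands for a decrease of the number in slot `x`, `bad x` for its loss. Smaller levels
-- are older slots and take precedence.
data Event : Set where
  good bad : ℕ → Event

level : Event → ℕ
level (good x) = x
level (bad x) = x

module Paths {Q : Set} (Edge : Q → Event → Q → Set) where

  Arrow : ℕ → Q → Q → Set
  Arrow p q q' = Σ Event λ e → Edge q e q' × p ≤ level e

  Path : ℕ → Q → Q → Set
  Path p = Star (Arrow p)

  lower : ∀ {p p' q q'} → p ≤ p' → Path p' q q' → Path p q q'
  lower le = gmap (λ q → q) λ (e , ed , l) → e , ed , ≤-trans le l

  -- A `Path p` avoids all levels below `p`, so `p` is the least level on the excluded cycle.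
  NoBadCycle : Q → Set
  NoBadCycle init = ∀ p q q' → Path 0 init q → Path p q q' → ¬ Edge q' (bad p) q

-- After a decrease at level `x` the hypothesis for the target at that level may be invoked, and
-- hypotheses up to `x` persist. After a loss only those strictly older than `x` are still valid.
Discharged : {Q : Set} → (Q → List (ℕ × Q) → Set) → Event → Q → List (ℕ × Q) → Set
Discharged {Q} Der (good x) q V = (x , q) ∈ V ⊎ Σ (List (ℕ × Q)) λ V' → V' ⊆ V × All (λ h → proj₁ h ≤ x) V' × Der q V'
Discharged {Q} Der (bad x) q V = Σ (List (ℕ × Q)) λ V' → V' ⊆ V × All (λ h → proj₁ h < x) V' × Der q V'

-- Der q V reads: q is derivable from the induction hypotheses V, each tagged with its level.
record Unfolding (Q : Set) : Set₁ where
  field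
    {codes} : ℕ
    code : Q → Fin codes
    code-injective : ∀ {q q'} → code q ≡ code q' → q ≡ q'
    top : ℕ
    Edge : Q → Event → Q → Set
    level≤top : ∀ {q e q'} → Edge q e q' → level e ≤ top
    init : Q
    noBadCycle : Paths.NoBadCycle Edge init
    Der : Q → List (ℕ × Q) → Set
    induct : ∀ {q V} p → p ≤ top → All (λ h → proj₁ h ≤ p) V → Der q ((p , q) ∷ V) → Der q V
    descend : ∀ {q V} → All (λ h → proj₁ h ≤ top) V → (∀ e q' → Edge q e q' → Discharged Der e q' V) → Der q V

module Unfold {Q : Set} (U : Unfolding Q) where
  open Unfolding U
  open Paths Edge

  private
    weakenDis : ∀ e {q V V'} → V ⊆ V' → Discharged Der e q V → Discharged Der e q V'
    weakenDis (good x) i (inj₁ m) = inj₁ (i m)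
    weakenDis (good x) i (inj₂ (V'' , j , r)) = inj₂ (V'' , (λ m → i (j m)) , r)
    weakenDis (bad x) i (V'' , j , r) = V'' , (λ m → i (j m)) , r

    Below : ℕ → Q → Q → Set
    Below p q' q = Path 0 init q × ∃ λ q₁ → Path p q q₁ × Edge q₁ (bad p) q'

    CodeBelow : ℕ → Fin codes → Fin codes → Set
    CodeBelow p i j = ∃ λ q → ∃ λ q' → code q ≡ i × code q' ≡ j × Below p q q'

    -- Irreflexivity is exactly the absence of bad cycles, which is why `Below` records
    -- reachability; transitivity concatenates paths. On finitely many codes a strict order is well
    -- founded.
    Below-wellFounded : ∀ p → WellFounded (Below p)
    Below-wellFounded p q = fromCode q (spo-wellFounded spo (code q))
      where
      spo : IsStrictPartialOrder _≡_ (CodeBelow p)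
      spo = record
        { isEquivalence = isEquivalence
        ; irrefl = irr
        ; trans = λ { (q₁ , q₂ , refl , refl , a) (q₃ , q₄ , e , refl , b) → q₁ , q₄ , refl , refl , comp a (code-injective e) b }
        ; <-resp-≈ = (λ { refl r → r }) , (λ { refl r → r })
        }
        where
        irr : ∀ {i j} → i ≡ j → ¬ CodeBelow p i j
        irr refl (q , q' , e , e' , r , q₁ , π , ed) with refl ← code-injective (trans e (sym e')) = noBadCycle p q' q₁ r π ed
        comp : ∀ {a b c d} → Below p a b → c ≡ b → Below p c d → Below p a d
        comp (_ , q₁ , π , ed) refl (r , q₂ , π' , ed') = r , q₁ , π' ◅◅ ((bad p , ed' , ≤-refl) ◅ π) , ed
      fromCode : ∀ q → Acc (CodeBelow p) (code q) → Acc (Below p) q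
      fromCode q (acc rs) = acc λ {q'} b → fromCode q' (rs (q' , q , refl , refl , b))

  -- The part of the caller: it discharges every edge by which a path through levels from `p` on
  -- drops below `p`.
  Outside : ℕ → Q → List (ℕ × Q) → Set
  Outside p q V = ∀ q₁ → Path p q q₁ → ∀ e q₂ → Edge q₁ e q₂ → level e < p → Discharged Der e q₂ V

  -- One loop per level, older levels outside. Between two losses at level `p` each decrease either
  -- meets a state whose hypothesis is in scope or adds a new one; a loss restarts with the
  -- hypotheses of older levels only, and the order `Below p` bounds the restarts.
  derive : ∀ m p → m + p ≡ suc top → ∀ q V → Path 0 init q → All (λ h → proj₁ h < p) V → Outside p q V → Der q V
  derive zero p refl q V r ok out = descend (All.map ≤-pred ok) λ e q' ed → out q ε e q' ed (s≤s (level≤top ed))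
  derive (suc m) p eq q₀ V r₀ ok out₀ = outer q₀ (Below-wellFounded p q₀) r₀ out₀
    where
    p≤top : p ≤ top
    p≤top = ≤-trans (m≤n+m p m) (≤-reflexive (suc-injective eq))

    outer : ∀ q → Acc (Below p) q → Path 0 init q → Outside p q V → Der q V
    outer q (acc rs) r out = inner q ε Sub.⊥ (⊃-wellFounded Sub.⊥) ∉⊥ V same (All.map <⇒≤ ok) λ q' m → ⊥-elim (∉⊥ m)
      where
      -- `W` is the set of states whose hypothesis at level `p` is in scope; it grows with every new
      -- state, so the recursion ends.
      inner : ∀ q₁ → Path p q q₁ → (W : Subset codes) → Acc Sub._⊃_ W → code q₁ Sub.∉ W → (V' : List (ℕ × Q)) → V ⊆ V' →
              All (λ h → proj₁ h ≤ p) V' → (∀ q' → code q' Sub.∈ W → (p , q') ∈ V') → Der q₁ V'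
      inner q₁ π W (acc ws) new V' V⊆V' ok' seen =
        induct p p≤top ok' (derive m (suc p) (trans (+-suc m p) eq) q₁ V₁ (r ◅◅ lower z≤n π) (s≤s ≤-refl ∷ All.map s≤s ok') out₁)
        where
        V₁ = (p , q₁) ∷ V'
        W₁ = W Sub.∪ Sub.⁅ code q₁ ⁆

        seen₁ : ∀ q' → code q' Sub.∈ W₁ → (p , q') ∈ V₁
        seen₁ q' m with x∈p∪q⁻ W _ m
        ... | inj₁ m' = there (seen q' m')
        ... | inj₂ m' with refl ← code-injective (x∈⁅y⁆⇒x≡y _ m') = here refl

        out₁ : Outside (suc p) q₁ V₁
        out₁ q₂ π' e q₃ ed lt with m≤n⇒m<n∨m≡n (≤-pred lt)
        ... | inj₁ lt' = weakenDis e (λ m → there (V⊆V' m)) (out q₂ (π ◅◅ lower (n≤1+n p) π') e q₃ ed lt')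
        out₁ q₂ π' (bad _) q₃ ed lt | inj₂ refl =
          -- Back to `V`: all hypotheses at level `p` are forfeited, but `q₃` is smaller in
          -- `Below p`.
          V , (λ m → there (V⊆V' m)) , ok ,
          outer q₃ (rs (r , q₂ , π₂ , ed)) (r ◅◅ lower z≤n (π₂ ◅◅ step₃)) (λ q₄ π₄ → out q₄ (π₂ ◅◅ step₃ ◅◅ π₄))
          where
          π₂ = π ◅◅ lower (n≤1+n p) π'
          step₃ = (bad p , ed , ≤-refl) ◅ ε
        out₁ q₂ π' (good _) q₃ ed lt | inj₂ refl with code q₃ ∈? W₁
        ... | yes m = inj₁ (seen₁ q₃ m)
        ... | no ¬m = inj₂ (V₁ , (λ m → m) , ≤-refl ∷ ok' ,
          inner q₃ (π ◅◅ lower (n≤1+n p) π' ◅◅ ((good p , ed , ≤-refl) ◅ ε)) W₁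
            (ws (p⊆p∪q _ , code q₁ , q⊆p∪q W _ (x∈⁅x⁆ _) , new)) ¬m V₁ (λ m → there (V⊆V' m)) (≤-refl ∷ ok') seen₁)

  derivable : Der init []
  derivable = derive (suc top) 0 (+-identityʳ _) init [] ε [] λ _ _ _ _ _ ()

-- Infinite runs obtained from a bad cycle

module Runs {Q : Set} (Edge : Q → Event → Q → Set) where
  open Paths Edge

  record Run (init : Q) (p : ℕ) : Set where
    field
      at : ℕ → Q
      event : ℕ → Event
      edge : ∀ i → Edge (at i) (event i) (at (suc i))
      start : at 0 ≡ init
      threshold : ℕ
      eventually : ∀ i → threshold ≤ i → p ≤ level (event i)
      recurrent : ∀ k → ∃ λ i → k ≤ i × event i ≡ bad p

  module _ {init q q' : Q} {p : ℕ} (prefix : Path 0 init q) (loop : Path p q q') (back : Edge q' (bad p) q) where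
    private
      -- A position is the piece of path still to be walked, so the next position, event and edge
      -- are all computed from it.
      data Pos : Q → Set where
        inPrefix : ∀ {q₁ q₂} → Arrow 0 q₁ q₂ → Path 0 q₂ q → Pos q₁
        inLoop : ∀ {q₁} → Path p q₁ q' → Pos q₁

      enter : ∀ {q₁} → Path 0 q₁ q → Pos q₁
      enter ε = inLoop loop
      enter (a ◅ π) = inPrefix a π

      target : ∀ {q₁} → Pos q₁ → Q
      target (inPrefix {q₂ = q₂} _ _) = q₂
      target (inLoop ε) = q
      target (inLoop (_◅_ {j = q₂} _ _)) = q₂

      advance : ∀ {q₁} (s : Pos q₁) → Pos (target s)
      advance (inPrefix _ π) = enter π
      advance (inLoop ε) = inLoop loop
      advance (inLoop (_ ◅ π)) = inLoop π

      ev : ∀ {q₁} → Pos q₁ → Event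
      ev (inPrefix (e , _) _) = e
      ev (inLoop ε) = bad p
      ev (inLoop ((e , _) ◅ _)) = e

      ev-edge : ∀ {q₁} (s : Pos q₁) → Edge q₁ (ev s) (target s)
      ev-edge (inPrefix (_ , ed , _) _) = ed
      ev-edge (inLoop ε) = back
      ev-edge (inLoop ((_ , ed , _) ◅ _)) = ed

      state : ℕ → Σ Q Pos
      state zero = init , enter prefix
      state (suc i) = target (proj₂ (state i)) , advance (proj₂ (state i))

      toLoop : ∀ {q₁} → Pos q₁ → ℕ
      toLoop (inLoop _) = 0
      toLoop (inPrefix _ π) = suc (lengthTo π)
        where
        lengthTo : ∀ {q₁} → Path 0 q₁ q → ℕ
        lengthTo ε = 0
        lengthTo (_ ◅ π) = suc (lengthTo π)

      toLoop-advance : ∀ {q₁} (s : Pos q₁) → toLoop (advance s) ≤ pred (toLoop s)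
      toLoop-advance (inPrefix _ ε) = z≤n
      toLoop-advance (inPrefix _ (_ ◅ π)) = s≤s (≤-reflexive refl)
      toLoop-advance (inLoop ε) = z≤n
      toLoop-advance (inLoop (_ ◅ _)) = z≤n

      looped : ∀ i → toLoop (proj₂ (state i)) ≤ toLoop (enter prefix) ∸ i
      looped zero = ≤-refl
      looped (suc i) = ≤-trans (toLoop-advance (proj₂ (state i)))
        (≤-trans (pred-mono-≤ (looped i)) (≤-reflexive (pred[m∸n]≡m∸[1+n] (toLoop (enter prefix)) i)))

      inLoop-level : ∀ {q₁} (s : Pos q₁) → toLoop s ≡ 0 → p ≤ level (ev s)
      inLoop-level (inLoop ε) _ = ≤-refl
      inLoop-level (inLoop ((_ , _ , le) ◅ _)) _ = le

      inLoopAt : ∀ i → toLoop (enter prefix) ≤ i → toLoop (proj₂ (state i)) ≡ 0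
      inLoopAt i le = n≤0⇒n≡0 (≤-trans (looped i) (≤-reflexive (m≤n⇒m∸n≡0 le)))

      reachBack : ∀ i {q₁} (π : Path p q₁ q') → state i ≡ (q₁ , inLoop π) → ∃ λ j → i ≤ j × ev (proj₂ (state j)) ≡ bad p
      reachBack i ε eq = i , ≤-refl , cong (λ s → ev (proj₂ s)) eq
      reachBack i (_ ◅ π) eq
        with j , le , h ← reachBack (suc i) π (cong (λ s → target (proj₂ s) , advance (proj₂ s)) eq) = j , <⇒≤ le , h

      back-again : ∀ i → toLoop (proj₂ (state i)) ≡ 0 → ∃ λ j → i ≤ j × ev (proj₂ (state j)) ≡ bad p
      back-again i eq with state i in st
      ... | _ , inLoop π = reachBack i π st

    lasso : Run init p
    lasso = record
      { at = λ i → proj₁ (state i)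
      ; event = λ i → ev (proj₂ (state i))
      ; edge = λ i → ev-edge (proj₂ (state i))
      ; start = refl
      ; threshold = toLoop (enter prefix)
      ; eventually = λ i le → inLoop-level (proj₂ (state i)) (inLoopAt i le)
      ; recurrent = λ k → let i = k ⊔ toLoop (enter prefix)
                              j , le , h = back-again i (inLoopAt i (m≤n⊔m k _))
                          in j , ≤-trans (m≤m⊔n k _) le , h
      }

-- Bit vectors, position 0 being the most significant

private
  variable
    m : ℕ

-- Positions beyond the end read as unset, so shifting and truncating need no range conditions.
bit : Vec Bool m → ℕ → Bool
bit [] y = false
bit (b ∷ a) zero = b
bit (b ∷ a) (suc y) = bit a y

_∋_ : Vec Bool m → ℕ → Set
a ∋ y = bit a y ≡ true

zeros : Vec Bool m
zeros = replicate _ false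

bit-zeros : ∀ m y → ¬ (zeros {m} ∋ y)
bit-zeros (suc m) (suc y) h = bit-zeros m y h

∋⇒< : (a : Vec Bool m) → ∀ {y} → a ∋ y → y < m
∋⇒< (b ∷ a) {zero} h = s≤s z≤n
∋⇒< (b ∷ a) {suc y} h = s≤s (∋⇒< a h)

anyBit : Vec Bool m → Bool
anyBit [] = false
anyBit (true ∷ a) = true
anyBit (false ∷ a) = anyBit a

anyAbove : ℕ → Vec Bool m → Bool
anyAbove y [] = false
anyAbove zero (b ∷ a) = anyBit a
anyAbove (suc y) (b ∷ a) = anyAbove y a

anyBit-complete : (a : Vec Bool m) → ∀ {y} → a ∋ y → anyBit a ≡ true
anyBit-complete (true ∷ a) h = refl
anyBit-complete (false ∷ a) {suc y} h = anyBit-complete a h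

anyBit-sound : (a : Vec Bool m) → anyBit a ≡ true → ∃ λ y → a ∋ y
anyBit-sound (true ∷ a) h = 0 , refl
anyBit-sound (false ∷ a) h with y , h' ← anyBit-sound a h = suc y , h'

anyAbove-complete : ∀ x (a : Vec Bool m) {y} → x < y → a ∋ y → anyAbove x a ≡ true
anyAbove-complete zero (b ∷ a) {suc y} lt h = anyBit-complete a h
anyAbove-complete (suc x) (b ∷ a) {suc y} (s≤s lt) h = anyAbove-complete x a lt h

anyAbove-sound : ∀ x (a : Vec Bool m) → anyAbove x a ≡ true → ∃ λ y → x < y × a ∋ y
anyAbove-sound zero (b ∷ a) h with y , h' ← anyBit-sound a h = suc y , s≤s z≤n , h'
anyAbove-sound (suc x) (b ∷ a) h with y , lt , h' ← anyAbove-sound x a h = suc y , s≤s lt , h'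

keep : ℕ → Vec Bool m → Vec Bool m
keep l [] = []
keep zero a = zeros
keep (suc l) (b ∷ a) = b ∷ keep l a

keep-∋ : ∀ l (a : Vec Bool m) {y} → keep l a ∋ y → a ∋ y × y < l
keep-∋ {suc m} zero (b ∷ a) {suc y} h = ⊥-elim (bit-zeros m y h)
keep-∋ (suc l) (b ∷ a) {zero} h = h , s≤s z≤n
keep-∋ (suc l) (b ∷ a) {suc y} h with h' , lt ← keep-∋ l a h = h' , s≤s lt

keep-id : ∀ l (a : Vec Bool m) → (∀ y → a ∋ y → y < l) → keep l a ≡ a
keep-id l [] h = refl
keep-id zero (true ∷ a) h with () ← h 0 refl
keep-id zero (false ∷ a) h = cong (false ∷_) (zeros-unique a λ y e → ⊥-elim (n≮0 (h (suc y) e)))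
  where
  zeros-unique : ∀ {m} (a : Vec Bool m) → (∀ y → ¬ (a ∋ y)) → zeros ≡ a
  zeros-unique [] h = refl
  zeros-unique (true ∷ a) h = ⊥-elim (h 0 refl)
  zeros-unique (false ∷ a) h = cong (false ∷_) (zeros-unique a λ y → h (suc y))
keep-id (suc l) (b ∷ a) h = cong (b ∷_) (keep-id l a λ y e → ≤-pred (h (suc y) e))

set : ℕ → Vec Bool m → Vec Bool m
set y [] = []
set zero (b ∷ a) = true ∷ a
set (suc y) (b ∷ a) = b ∷ set y a

set-∋ : ∀ y (a : Vec Bool m) {z} → set y a ∋ z → z ≡ y ⊎ a ∋ z
set-∋ zero (b ∷ a) {zero} h = inj₁ refl
set-∋ zero (b ∷ a) {suc z} h = inj₂ h
set-∋ (suc y) (b ∷ a) {zero} h = inj₂ h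
set-∋ (suc y) (b ∷ a) {suc z} h with set-∋ y a h
... | inj₁ e = inj₁ (cong suc e)
... | inj₂ h' = inj₂ h'

set-new : ∀ y (a : Vec Bool m) → y < m → set y a ∋ y
set-new zero (b ∷ a) lt = refl
set-new (suc y) (b ∷ a) (s≤s lt) = set-new y a lt

cutAbove : ℕ → Vec Bool m → Vec Bool m
cutAbove x [] = []
cutAbove zero (b ∷ a) = b ∷ zeros
cutAbove (suc x) (b ∷ a) = b ∷ cutAbove x a

cutAbove-∋ : ∀ x (a : Vec Bool m) {y} → cutAbove x a ∋ y → a ∋ y × y ≤ x
cutAbove-∋ zero (b ∷ a) {zero} h = h , z≤n
cutAbove-∋ {suc m} zero (b ∷ a) {suc y} h = ⊥-elim (bit-zeros m y h)
cutAbove-∋ (suc x) (b ∷ a) {zero} h = h , z≤n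
cutAbove-∋ (suc x) (b ∷ a) {suc y} h with h' , le ← cutAbove-∋ x a h = h' , s≤s le

cutAbove-at : ∀ x (a : Vec Bool m) → a ∋ x → cutAbove x a ∋ x
cutAbove-at zero (b ∷ a) h = h
cutAbove-at (suc x) (b ∷ a) h = cutAbove-at x a h

resetAt : ℕ → Vec Bool m → Vec Bool m
resetAt x a = if bit a x then cutAbove x a else a

remove : ℕ → Vec Bool m → Vec Bool m
remove x [] = []
remove zero (b ∷ a) = a ∷ʳ false
remove (suc x) (b ∷ a) = b ∷ remove x a

bit-∷ʳ : (a : Vec Bool m) → ∀ y → bit (a ∷ʳ false) y ≡ bit a y
bit-∷ʳ [] zero = refl
bit-∷ʳ [] (suc y) = refl
bit-∷ʳ (b ∷ a) zero = refl
bit-∷ʳ (b ∷ a) (suc y) = bit-∷ʳ a y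

bit-remove-< : ∀ x (a : Vec Bool m) {y} → y < x → bit (remove x a) y ≡ bit a y
bit-remove-< x [] lt = refl
bit-remove-< (suc x) (b ∷ a) {zero} lt = refl
bit-remove-< (suc x) (b ∷ a) {suc y} (s≤s lt) = bit-remove-< x a lt

bit-remove-≥ : ∀ x (a : Vec Bool m) {y} → x ≤ y → bit (remove x a) y ≡ bit a (suc y)
bit-remove-≥ x [] le = refl
bit-remove-≥ zero (b ∷ a) {y} le = bit-∷ʳ a y
bit-remove-≥ (suc x) (b ∷ a) {suc y} (s≤s le) = bit-remove-≥ x a le

≡false : ∀ {b} → b ≢ true → b ≡ false
≡false {true} h = ⊥-elim (h refl)
≡false {false} h = refl

resetAt-yes : ∀ x (a : Vec Bool m) → a ∋ x → resetAt x a ≡ cutAbove x a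
resetAt-yes x a h rewrite h = refl

resetAt-no : ∀ x (a : Vec Bool m) → ¬ (a ∋ x) → resetAt x a ≡ a
resetAt-no x a h rewrite ≡false h = refl

resetAt-∋ : ∀ x (a : Vec Bool m) {y} → resetAt x a ∋ y → a ∋ y
resetAt-∋ x a h with bit a x
... | true = proj₁ (cutAbove-∋ x a h)
... | false = h

remove-∋ : ∀ x (a : Vec Bool m) {y} → remove x a ∋ y → (y < x × a ∋ y) ⊎ (x ≤ y × a ∋ suc y)
remove-∋ x a {y} h with y <? x
... | yes lt = inj₁ (lt , trans (sym (bit-remove-< x a lt)) h)
... | no ¬lt = inj₂ (≮⇒≥ ¬lt , trans (sym (bit-remove-≥ x a (≮⇒≥ ¬lt))) h)

-- pot p compares vectors by their first p bits and then by the first position set from p on: along a trace it grows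
-- whenever slot p is discarded.

weight : Bool → ℕ → ℕ
weight true m = 2 ^ m
weight false m = 0

value : Vec Bool m → ℕ
value [] = 0
value {suc m} (b ∷ a) = weight b m + value a

pot : ℕ → Vec Bool m → ℕ
pot p [] = 0
pot {suc m} zero (true ∷ a) = suc m
pot zero (false ∷ a) = pot zero a
pot {suc m} (suc p) (b ∷ a) = weight b m + pot p a

Hit : ℕ → Vec Bool m → Set
Hit p a = ∃ λ y → p ≤ y × a ∋ y

private
  weight≤ : ∀ b m → weight b m + 2 ^ m ≤ 2 ^ suc m
  weight≤ true m = ≤-reflexive (cong (2 ^ m +_) (sym (+-identityʳ (2 ^ m))))
  weight≤ false m = m≤m+n (2 ^ m) _

value< : (a : Vec Bool m) → value a < 2 ^ m
value< [] = s≤s z≤n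
value< {suc m} (b ∷ a) = <-≤-trans (+-monoʳ-< (weight b m) (value< a)) (weight≤ b m)

pot₀≤ : (a : Vec Bool m) → pot 0 a ≤ m
pot₀≤ [] = z≤n
pot₀≤ (true ∷ a) = ≤-refl
pot₀≤ (false ∷ a) = m≤n⇒m≤1+n (pot₀≤ a)

pot< : ∀ p (a : Vec Bool m) → pot p a < 2 ^ m
pot< p [] = s≤s z≤n
pot< {m} zero a@(_ ∷ _) = ≤-<-trans (pot₀≤ a) (n<2^n m)
  where
  n<2^n : ∀ n → n < 2 ^ n
  n<2^n zero = s≤s z≤n
  n<2^n (suc n) = begin-strict
    suc n ≡⟨ +-comm 1 n ⟩
    n + 1 <⟨ +-mono-<-≤ (n<2^n n) (^-monoʳ-≤ 2 {0} {n} z≤n) ⟩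
    2 ^ n + 2 ^ n ≡⟨ cong (2 ^ n +_) (sym (+-identityʳ _)) ⟩
    2 ^ suc n ∎
    where open ≤-Reasoning
pot< {suc m} (suc p) (b ∷ a) = <-≤-trans (+-monoʳ-< (weight b m) (pot< p a)) (weight≤ b m)

-- A step may lose its hits only while it raises the potential; in this form the property composes
-- along a trace.
Advance : ℕ → Vec Bool m → Vec Bool m → Set
Advance p a a' = pot p a < pot p a' ⊎ (pot p a ≡ pot p a' × (Hit p a → Hit p a'))

Advance-refl : ∀ p (a : Vec Bool m) → Advance p a a
Advance-refl p a = inj₂ (refl , λ h → h)

Advance-trans : ∀ p (a b c : Vec Bool m) → Advance p a b → Advance p b c → Advance p a c
Advance-trans p a b c (inj₁ x) (inj₁ y) = inj₁ (<-trans x y)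
Advance-trans p a b c (inj₁ x) (inj₂ (e , _)) = inj₁ (<-≤-trans x (≤-reflexive e))
Advance-trans p a b c (inj₂ (e , _)) (inj₁ y) = inj₁ (≤-<-trans (≤-reflexive e) y)
Advance-trans p a b c (inj₂ (e , f)) (inj₂ (e' , g)) = inj₂ (trans e e' , λ h → g (f h))

private
  Hit-∷ : ∀ {p b} {a : Vec Bool m} → Hit p a → Hit (suc p) (b ∷ a)
  Hit-∷ (y , le , h) = suc y , s≤s le , h

  Hit-tail : ∀ {p b} {a : Vec Bool m} → Hit (suc p) (b ∷ a) → Hit p a
  Hit-tail (suc y , s≤s le , h) = y , le , h

  Hit₀-∷ : ∀ {b} {a : Vec Bool m} → Hit 0 a → Hit 0 (b ∷ a)
  Hit₀-∷ (y , le , h) = suc y , z≤n , h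

  Hit₀-tail : ∀ {a : Vec Bool m} → Hit 0 (false ∷ a) → Hit 0 a
  Hit₀-tail (suc y , le , h) = y , z≤n , h

  Advance-∷ : ∀ {p} b {a a' : Vec Bool m} → Advance p a a' → Advance (suc p) (b ∷ a) (b ∷ a')
  Advance-∷ {m} b (inj₁ lt) = inj₁ (+-monoʳ-< (weight b m) lt)
  Advance-∷ {m} b (inj₂ (e , f)) = inj₂ (cong (weight b m +_) e , λ h → Hit-∷ (f (Hit-tail h)))

  Advance₀-∷ : ∀ {a a' : Vec Bool m} → Advance 0 a a' → Advance 0 (false ∷ a) (false ∷ a')
  Advance₀-∷ (inj₁ lt) = inj₁ lt
  Advance₀-∷ (inj₂ (e , f)) = inj₂ (e , λ h → Hit₀-∷ (f (Hit₀-tail h)))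

  Advance₀-true : ∀ {a a' : Vec Bool m} → Advance 0 (true ∷ a) (true ∷ a')
  Advance₀-true = inj₂ (refl , λ _ → 0 , z≤n , refl)

  value-contra : ∀ {A : Set} (a a' : Vec Bool m) → value (true ∷ a) ≤ value (false ∷ a') → A
  value-contra {m} a a' le = ⊥-elim (<-irrefl refl (<-≤-trans (value< a') (≤-trans (m≤m+n (2 ^ m) (value a)) le)))

-- Comparing values is comparing lexicographically, and `pot p` is a coarsening: a first difference
-- before position `p` raises the prefix, and a later one cannot push the first hit back.
value-Advance : ∀ p (a a' : Vec Bool m) → value a ≤ value a' → Advance p a a'
value-Advance p [] [] le = Advance-refl p []
value-Advance zero (true ∷ a) (true ∷ a') le = Advance₀-true
value-Advance zero (false ∷ a) (true ∷ a') le = inj₁ (s≤s (pot₀≤ a))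
value-Advance zero (true ∷ a) (false ∷ a') le = value-contra a a' le
value-Advance zero (false ∷ a) (false ∷ a') le = Advance₀-∷ (value-Advance zero a a' le)
value-Advance {suc m} (suc p) (true ∷ a) (true ∷ a') le = Advance-∷ true (value-Advance p a a' (+-cancelˡ-≤ (2 ^ m) _ _ le))
value-Advance {suc m} (suc p) (false ∷ a) (true ∷ a') le = inj₁ (<-≤-trans (pot< p a) (m≤m+n (2 ^ m) _))
value-Advance (suc p) (true ∷ a) (false ∷ a') le = value-contra a a' le
value-Advance (suc p) (false ∷ a) (false ∷ a') le = Advance-∷ false (value-Advance p a a' le)

value-set : ∀ y (a : Vec Bool m) → value a ≤ value (set y a)
value-set y [] = z≤n
value-set {suc m} zero (true ∷ a) = ≤-refl
value-set {suc m} zero (false ∷ a) = m≤n+m (value a) (2 ^ m)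
value-set {suc m} (suc y) (b ∷ a) = +-monoʳ-≤ (weight b m) (value-set y a)

-- Position `x` survives the cut and lies at or after `p`, so the first position set from `p` on is
-- unchanged.
cut-Advance : ∀ p x (a : Vec Bool m) → p ≤ x → a ∋ x → Advance p a (cutAbove x a)
cut-Advance zero zero (true ∷ a) le h = Advance₀-true
cut-Advance zero (suc x) (true ∷ a) le h = Advance₀-true
cut-Advance zero (suc x) (false ∷ a) le h = Advance₀-∷ (cut-Advance zero x a z≤n h)
cut-Advance (suc p) (suc x) (b ∷ a) (s≤s le) h = Advance-∷ b (cut-Advance p x a le h)

reset-Advance : ∀ p x (a : Vec Bool m) → p ≤ x → Advance p a (resetAt x a)
reset-Advance p x a le with bit a x in e
... | true = cut-Advance p x a le e
... | false = Advance-refl p a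

private
  pot-∷ʳ : (a : Vec Bool m) → Hit 0 a → pot 0 a < pot 0 (a ∷ʳ false)
  pot-∷ʳ (true ∷ a) h = ≤-refl
  pot-∷ʳ (false ∷ a) h = pot-∷ʳ a (Hit₀-tail h)

  pot-∷ʳ≤ : (a : Vec Bool m) → pot 0 a ≤ pot 0 (a ∷ʳ false)
  pot-∷ʳ≤ [] = z≤n
  pot-∷ʳ≤ (true ∷ a) = n≤1+n _
  pot-∷ʳ≤ (false ∷ a) = pot-∷ʳ≤ a

-- Only unset bits disappear, so the first hit stays or moves towards the front.
remove-Advance : ∀ p x (a : Vec Bool m) → p ≤ x → ¬ (a ∋ x) → Advance p a (remove x a)
remove-Advance p x [] le h = Advance-refl p []
remove-Advance zero zero (true ∷ a) le h = ⊥-elim (h refl)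
remove-Advance zero zero (false ∷ a) le h with m≤n⇒m<n∨m≡n (pot-∷ʳ≤ a)
... | inj₁ lt = inj₁ lt
... | inj₂ e = inj₂ (e , λ hit → ⊥-elim (<-irrefl e (pot-∷ʳ a (Hit₀-tail hit))))
remove-Advance zero (suc x) (true ∷ a) le h = Advance₀-true
remove-Advance zero (suc x) (false ∷ a) le h = Advance₀-∷ (remove-Advance zero x a z≤n h)
remove-Advance (suc p) (suc x) (b ∷ a) (s≤s le) h = Advance-∷ b (remove-Advance p x a le h)

-- Every hit lies after the unset position `p`, hence moves one place forward.
remove-strict : ∀ p (a : Vec Bool m) → ¬ (a ∋ p) → Hit p a → pot p a < pot p (remove p a)
remove-strict zero (true ∷ a) h hit = ⊥-elim (h refl)
remove-strict zero (false ∷ a) h hit = pot-∷ʳ a (Hit₀-tail hit)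
remove-strict {suc m} (suc p) (b ∷ a) h hit = +-monoʳ-< (weight b m) (remove-strict p a h (Hit-tail hit))

-- Every hit that is followed by a loss raises the potential, which is bounded.
module _ (a : ℕ → Vec Bool m) (p : ℕ) (advance : ∀ i → Advance p (a i) (a (suc i)))
         (hits : ∀ k → ∃ λ i → k ≤ i × (pot p (a i) < pot p (a (suc i)) ⊎ Hit p (a (suc i))))
         (losses : ∀ k → ∃ λ i → k ≤ i × (Hit p (a i) → pot p (a i) < pot p (a (suc i)))) where
  private
    advances : ∀ {i j} → i ≤′ j → Advance p (a i) (a j)
    advances {i} ≤′-refl = Advance-refl p (a i)
    advances {i} (≤′-step {j} le) = Advance-trans p (a i) (a j) (a (suc j)) (advances le) (advance j)

    pot-≤ : ∀ {i j} → i ≤ j → pot p (a i) ≤ pot p (a j)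
    pot-≤ le with advances (≤⇒≤′ le)
    ... | inj₁ lt = <⇒≤ lt
    ... | inj₂ (e , _) = ≤-reflexive e

    fromHit : ∀ i → Hit p (a i) → ∃ λ j → pot p (a i) < pot p (a j)
    fromHit i hit with j , le , lose ← losses i with advances (≤⇒≤′ le)
    ... | inj₁ lt = j , lt
    ... | inj₂ (e , f) = suc j , ≤-<-trans (≤-reflexive e) (lose (f hit))

    increases : ∀ k → ∃ λ j → pot p (a k) < pot p (a j)
    increases k with hits k
    ... | i , le , inj₁ lt = suc i , ≤-<-trans (pot-≤ le) lt
    ... | i , le , inj₂ hit with j , lt ← fromHit (suc i) hit = j , ≤-<-trans (pot-≤ (m≤n⇒m≤1+n le)) lt

    exceeds : ∀ b → ∃ λ j → b ≤ pot p (a j)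
    exceeds zero = 0 , z≤n
    exceeds (suc b) with j , le ← exceeds b with j' , lt ← increases j = j' , ≤-<-trans le lt

  no-recurrence : ⊥
  no-recurrence with j , le ← exceeds (2 ^ m) = <-irrefl refl (<-≤-trans (pot< p (a j)) le)

-- Occurrences of terms

_≟ᵗ_ : (t u : Term) → Dec (t ≡ u)
var i ≟ᵗ var j = map′ (cong var) (λ { refl → refl }) (i ≟ j)
(var _) ≟ᵗ 𝟎 = no λ ()
(var _) ≟ᵗ (S _) = no λ ()
(var _) ≟ᵗ (_ ⊕ _) = no λ ()
(var _) ≟ᵗ (_ ⊗ _) = no λ ()
𝟎 ≟ᵗ (var _) = no λ ()
𝟎 ≟ᵗ 𝟎 = yes refl
𝟎 ≟ᵗ (S _) = no λ ()
𝟎 ≟ᵗ (_ ⊕ _) = no λ ()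
𝟎 ≟ᵗ (_ ⊗ _) = no λ ()
(S _) ≟ᵗ (var _) = no λ ()
(S _) ≟ᵗ 𝟎 = no λ ()
S t ≟ᵗ S u = map′ (cong S) (λ { refl → refl }) (t ≟ᵗ u)
(S _) ≟ᵗ (_ ⊕ _) = no λ ()
(S _) ≟ᵗ (_ ⊗ _) = no λ ()
(_ ⊕ _) ≟ᵗ (var _) = no λ ()
(_ ⊕ _) ≟ᵗ 𝟎 = no λ ()
(_ ⊕ _) ≟ᵗ (S _) = no λ ()
(t ⊕ t') ≟ᵗ (u ⊕ u') = map′ (λ { (refl , refl) → refl }) (λ { refl → refl , refl }) (t ≟ᵗ u ×-dec t' ≟ᵗ u')
(_ ⊕ _) ≟ᵗ (_ ⊗ _) = no λ ()
(_ ⊗ _) ≟ᵗ (var _) = no λ ()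
(_ ⊗ _) ≟ᵗ 𝟎 = no λ ()
(_ ⊗ _) ≟ᵗ (S _) = no λ ()
(_ ⊗ _) ≟ᵗ (_ ⊕ _) = no λ ()
(t ⊗ t') ≟ᵗ (u ⊗ u') = map′ (λ { (refl , refl) → refl }) (λ { refl → refl , refl }) (t ≟ᵗ u ×-dec t' ≟ᵗ u')

subTerm? : ∀ u t → Dec (SubTerm u t)
subTerm? u t with u ≟ᵗ t
subTerm? u t | yes refl = yes here
subTerm? u (var i) | no ≢ = no λ { here → ≢ refl }
subTerm? u 𝟎 | no ≢ = no λ { here → ≢ refl }
subTerm? u (S t) | no ≢ = map′ inS (λ { here → ⊥-elim (≢ refl) ; (inS s) → s }) (subTerm? u t)
subTerm? u (t ⊕ t') | no ≢ = map′ Sum.[ ⊕l , ⊕r ] (λ { here → ⊥-elim (≢ refl) ; (⊕l s) → inj₁ s ; (⊕r s) → inj₂ s }) (subTerm? u t ⊎-dec subTerm? u t')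
subTerm? u (t ⊗ t') | no ≢ = map′ Sum.[ ⊗l , ⊗r ] (λ { here → ⊥-elim (≢ refl) ; (⊗l s) → inj₁ s ; (⊗r s) → inj₂ s }) (subTerm? u t ⊎-dec subTerm? u t')

occF? : ∀ t φ → Dec (OccF t φ)
occF? t (u ≐ v) = subTerm? t u ⊎-dec subTerm? t v
occF? t (u ≠ v) = subTerm? t u ⊎-dec subTerm? t v
occF? t (u ≺ v) = subTerm? t u ⊎-dec subTerm? t v
occF? t (u ⊀ v) = subTerm? t u ⊎-dec subTerm? t v
occF? t (φ ∧ᶠ ψ) = occF? t φ ⊎-dec occF? t ψ
occF? t (φ ∨ᶠ ψ) = occF? t φ ⊎-dec occF? t ψ
occF? t (∀ᶠ φ) = occF? (wk t) φ
occF? t (∃ᶠ φ) = occF? (wk t) φ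

subterms : Term → List Term
subterms t@(var _) = t ∷ []
subterms 𝟎 = 𝟎 ∷ []
subterms (S t) = S t ∷ subterms t
subterms (t ⊕ u) = t ⊕ u ∷ subterms t ++ subterms u
subterms (t ⊗ u) = t ⊗ u ∷ subterms t ++ subterms u

∈-subterms : ∀ {u t} → SubTerm u t → u ∈ subterms t
∈-subterms {t = var _} here = here refl
∈-subterms {t = 𝟎} here = here refl
∈-subterms {t = S t} here = here refl
∈-subterms {t = t ⊕ u} here = here refl
∈-subterms {t = t ⊗ u} here = here refl
∈-subterms (inS s) = there (∈-subterms s)
∈-subterms (⊕l s) = there (∈-++⁺ˡ (∈-subterms s))
∈-subterms (⊕r {t} s) = there (∈-++⁺ʳ (subterms t) (∈-subterms s))
∈-subterms (⊗l s) = there (∈-++⁺ˡ (∈-subterms s))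
∈-subterms (⊗r {t} s) = there (∈-++⁺ʳ (subterms t) (∈-subterms s))

private
  down : Term → Term
  down = substT (var ∘ pred)

  down-wk : ∀ t → down (wk t) ≡ t
  down-wk t = trans (substT-comp _ _ t) (substT-id t)

-- Under a quantifier `down` undoes `wk`. Terms with the bound variable turn into others that need
-- not occur, which is harmless: only a finite list covering all occurrences is wanted.
occurring : Formula → List Term
occurring (t ≐ u) = subterms t ++ subterms u
occurring (t ≠ u) = subterms t ++ subterms u
occurring (t ≺ u) = subterms t ++ subterms u
occurring (t ⊀ u) = subterms t ++ subterms u
occurring (φ ∧ᶠ ψ) = occurring φ ++ occurring ψ
occurring (φ ∨ᶠ ψ) = occurring φ ++ occurring ψ
occurring (∀ᶠ φ) = map down (occurring φ)
occurring (∃ᶠ φ) = map down (occurring φ)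

private
  either : ∀ {A B : Set} {t : Term} {xs ys} → (A → t ∈ xs) → (B → t ∈ ys) → A ⊎ B → t ∈ xs ++ ys
  either f g (inj₁ a) = ∈-++⁺ˡ (f a)
  either {xs = xs} f g (inj₂ b) = ∈-++⁺ʳ xs (g b)

∈-occurring : ∀ {t} φ → OccF t φ → t ∈ occurring φ
∈-occurring (u ≐ v) = either ∈-subterms ∈-subterms
∈-occurring (u ≠ v) = either ∈-subterms ∈-subterms
∈-occurring (u ≺ v) = either ∈-subterms ∈-subterms
∈-occurring (u ⊀ v) = either ∈-subterms ∈-subterms
∈-occurring (φ ∧ᶠ ψ) = either (∈-occurring φ) (∈-occurring ψ)
∈-occurring (φ ∨ᶠ ψ) = either (∈-occurring φ) (∈-occurring ψ)
∈-occurring {t} (∀ᶠ φ) o = subst (_∈ map down (occurring φ)) (down-wk t) (∈-map⁺ down (∈-occurring φ o))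
∈-occurring {t} (∃ᶠ φ) o = subst (_∈ map down (occurring φ)) (down-wk t) (∈-map⁺ down (∈-occurring φ o))

subTerm-free : ∀ {a u t} → SubTerm u t → FreeT a u → FreeT a t
subTerm-free here f = f
subTerm-free (inS s) f = subTerm-free s f
subTerm-free (⊕l s) f = inj₁ (subTerm-free s f)
subTerm-free (⊕r s) f = inj₂ (subTerm-free s f)
subTerm-free (⊗l s) f = inj₁ (subTerm-free s f)
subTerm-free (⊗r s) f = inj₂ (subTerm-free s f)

FreeT-wk : ∀ t {a} → FreeT a t → FreeT (suc a) (wk t)
FreeT-wk (var i) refl = refl
FreeT-wk (S t) f = FreeT-wk t f
FreeT-wk (t ⊕ u) = Sum.map (FreeT-wk t) (FreeT-wk u)
FreeT-wk (t ⊗ u) = Sum.map (FreeT-wk t) (FreeT-wk u)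

occF-free : ∀ {a t} φ → OccF t φ → FreeT a t → FreeF a φ
occF-free (u ≐ v) o f = Sum.map (λ s → subTerm-free s f) (λ s → subTerm-free s f) o
occF-free (u ≠ v) o f = Sum.map (λ s → subTerm-free s f) (λ s → subTerm-free s f) o
occF-free (u ≺ v) o f = Sum.map (λ s → subTerm-free s f) (λ s → subTerm-free s f) o
occF-free (u ⊀ v) o f = Sum.map (λ s → subTerm-free s f) (λ s → subTerm-free s f) o
occF-free (φ ∧ᶠ ψ) o f = Sum.map (λ o → occF-free φ o f) (λ o → occF-free ψ o f) o
occF-free (φ ∨ᶠ ψ) o f = Sum.map (λ o → occF-free φ o f) (λ o → occF-free ψ o f) o
occF-free {t = t} (∀ᶠ φ) o f = occF-free φ o (FreeT-wk t f)
occF-free {t = t} (∃ᶠ φ) o f = occF-free φ o (FreeT-wk t f)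

-- Precursors and eigenvariables, rule by rule

SameValue : Seq → Term → Term → Set
SameValue s t t' = ((t' ≐ t) ∈ ante s) ⊎ (t' ≡ t)

sameValue? : ∀ s t t' → Dec (SameValue s t t')
sameValue? s t t' = any? isEq? (ante s) ⊎-dec (t' ≟ᵗ t)
  where
  isEq? : ∀ φ → Dec ((t' ≐ t) ≡ φ)
  isEq? (u ≐ v) = map′ (λ { (refl , refl) → refl }) (λ { refl → refl , refl }) (t' ≟ᵗ u ×-dec t ≟ᵗ v)
  isEq? (_ ≠ _) = no λ ()
  isEq? (_ ≺ _) = no λ ()
  isEq? (_ ⊀ _) = no λ ()
  isEq? (_ ∧ᶠ _) = no λ ()
  isEq? (_ ∨ᶠ _) = no λ ()
  isEq? (∀ᶠ _) = no λ ()
  isEq? (∃ᶠ _) = no λ ()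

eigenBound : ∀ {c ps} → CStep c ps → ℕ
eigenBound (logic (∀R a _)) = suc a
eigenBound (logic (∃L a _)) = suc a
eigenBound _ = 0

Admissible : ∀ {c ps} → CStep c ps → List Formula → Set
Admissible {c} r Θ = ∀ a → a < eigenBound r → FreshIn a (formulasOf c) → FreshIn a Θ

-- `Precursor` and `Fits` reduce only once the rule is known. The view makes that case split once;
-- afterwards just substitution, the other logical rules and the axioms of `Q` are distinguished.
data View : ∀ {c ps} → CStep c ps → Set₁ where
  isSub : ∀ {Γ Δ} θ → View (logic (sub {Γ} {Δ} θ))
  isLogic : ∀ {c ps} {r : Inst c ps} → (∀ s t t' → Precursor (logic r) s t t' ≡ SameValue s t t') →
            (∀ Θ → Admissible (logic r) Θ → Fits Θ r) → View (logic r)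
  isQ : ∀ {c} {r : QInit c} → View (qinit r)

view : ∀ {c ps} (r : CStep c ps) → View r
view (logic (id _)) = isLogic (λ _ _ _ → refl) (λ _ _ → tt)
view (logic (eqRefl _)) = isLogic (λ _ _ _ → refl) (λ _ _ → tt)
view (logic (eqSub _ _ _)) = isLogic (λ _ _ _ → refl) (λ _ _ → tt)
view (logic (negL _)) = isLogic (λ _ _ _ → refl) (λ _ _ → tt)
view (logic (negR _)) = isLogic (λ _ _ _ → refl) (λ _ _ → tt)
view (logic (weak _ _)) = isLogic (λ _ _ _ → refl) (λ _ _ → tt)
view (logic (cut _)) = isLogic (λ _ _ _ → refl) (λ _ _ → tt)
view (logic ∧L) = isLogic (λ _ _ _ → refl) (λ _ _ → tt)
view (logic ∧R) = isLogic (λ _ _ _ → refl) (λ _ _ → tt)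
view (logic ∨L) = isLogic (λ _ _ _ → refl) (λ _ _ → tt)
view (logic ∨R) = isLogic (λ _ _ _ → refl) (λ _ _ → tt)
view (logic (∀L _)) = isLogic (λ _ _ _ → refl) (λ _ _ → tt)
view (logic (∃R _)) = isLogic (λ _ _ _ → refl) (λ _ _ → tt)
view (logic (∀R {Γ} {Δ} {φ} a f)) = isLogic (λ _ _ _ → refl) λ Θ ok → ok a ≤-refl (reorder f)
  where
  reorder : FreshIn a (∀ᶠ φ ∷ Γ ++ Δ) → FreshIn a (Γ ++ ∀ᶠ φ ∷ Δ)
  reorder (g ∷ h) = All.++⁺ (All.++⁻ˡ Γ h) (g ∷ All.++⁻ʳ Γ h)
view (logic (∃L a f)) = isLogic (λ _ _ _ → refl) λ Θ ok → ok a ≤-refl f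
view (logic (sub θ)) = isSub θ
view (qinit _) = isQ

precursor? : ∀ {c ps} (r : CStep c ps) s t t' → Dec (Precursor r s t t')
precursor? r s t t' with view r
... | isSub θ = substT θ t' ≟ᵗ t
... | isLogic eq _ = subst Dec (sym (eq s t t')) (sameValue? s t t')
... | isQ = sameValue? s t t'

module Automaton (P : Preproof) where

  open Preproof P

  -- The trace automaton

  Occ : Fin size → Term → Set
  Occ v t = OccS P t (seqAt v)

  occ? : ∀ v t → Dec (Occ v t)
  occ? v t = map′ find (λ (φ , m , o) → lose m o) (any? (occF? t) (formulasOf (seqAt v)))

  terms : List Term
  terms = concatMap (λ v → concatMap occurring (formulasOf (seqAt v))) (allFin size)

  N : ℕ
  N = length terms

  tm : Fin N → Term
  tm = List.lookup terms

  Occ⇒tm : ∀ {v t} → Occ v t → ∃ λ i → tm i ≡ t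
  Occ⇒tm {v} {t} (φ , m , o) = Any.index t∈ , sym (lookup-index t∈)
    where
    t∈ : t ∈ terms
    t∈ = ∈-concatMap⁺ _ (lose (∈-allFin v) (∈-concatMap⁺ occurring (lose m (∈-occurring φ o))))

  Prec′ : Fin size → Term → Term → Set
  Prec′ v = Precursor (LabelledStep.rule (stepAt v)) (seqAt v)

  Prog′ : Fin size → Fin size → Term → Term → Set
  Prog′ v w t t' = Σ Term λ t'' → Prec′ v t t'' × ((t' ≺ t'') ∈ ante (seqAt w))

  prec? : ∀ v t t' → Dec (Prec′ v t t')
  prec? v = precursor? (LabelledStep.rule (stepAt v)) (seqAt v)

  prog? : ∀ v w t t' → Dec (Prog′ v w t t')
  prog? v w t t' = map′ to from (any? test (ante (seqAt w)))
    where
    Test : Formula → Set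
    Test φ = Σ Term λ t'' → Prec′ v t t'' × (t' ≺ t'') ≡ φ
    test : ∀ φ → Dec (Test φ)
    test (u ≺ t'') = map′ (λ { (p , refl) → t'' , p , refl }) (λ { (_ , p , refl) → p , refl }) (prec? v t t'' ×-dec t' ≟ᵗ u)
    test (_ ≐ _) = no λ ()
    test (_ ≠ _) = no λ ()
    test (_ ⊀ _) = no λ ()
    test (_ ∧ᶠ _) = no λ ()
    test (_ ∨ᶠ _) = no λ ()
    test (∀ᶠ _) = no λ ()
    test (∃ᶠ _) = no λ ()
    to : Any.Any Test (ante (seqAt w)) → Prog′ v w t t'
    to a with _ , m , t'' , p , refl ← find a = t'' , p , m
    from : Prog′ v w t t' → Any.Any Test (ante (seqAt w))
    from (t'' , p , m) = lose m (t'' , p , refl)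

  -- Slots 0 … N-1 survive a round, slot N stays empty, and slot N+1+j is opened for a trace that progresses to term j.
  K : ℕ
  K = suc N + N

  Bits : Set
  Bits = Vec Bool K

  Config : Set
  Config = Vec Bits N

  -- A slot is owned if it is the youngest slot of some term. A used slot without owner is ready for
  -- a decrease, since all its traces have entered younger slots; and different slots have different
  -- owners.
  Used Own : Config → ℕ → Set
  Used A y = ∃ λ i → lookup A i ∋ y
  Own A y = ∃ λ i → lookup A i ∋ y × anyAbove y (lookup A i) ≡ false

  used? : ∀ A y → Dec (Used A y)
  used? A y = Fin.any? λ i → bit (lookup A i) y Bool.≟ true

  own? : ∀ A y → Dec (Own A y)
  own? A y = Fin.any? λ i → (bit (lookup A i) y Bool.≟ true) ×-dec (anyAbove y (lookup A i) Bool.≟ false)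

  Stay Fall : Fin size → Fin size → Fin N → Fin N → Set
  Stay v w i j = Occ v (tm i) × Occ w (tm j) × Prec′ v (tm i) (tm j)
  Fall v w i j = Occ v (tm i) × Occ w (tm j) × Prog′ v w (tm i) (tm j)

  stay? : ∀ v w i j → Dec (Stay v w i j)
  stay? v w i j = occ? v _ ×-dec occ? w _ ×-dec prec? v _ _

  fall? : ∀ v w i j → Dec (Fall v w i j)
  fall? v w i j = occ? v _ ×-dec occ? w _ ×-dec prog? v w _ _

  newSlot : Fin N → ℕ
  newSlot j = suc N + toℕ j

  newSlot<K : ∀ j → newSlot j < K
  newSlot<K j = +-monoʳ-< (suc N) (Fin.toℕ<n j)

  private
    when : {A : Set} → Dec A → Bits → List Bits
    when (yes _) a = a ∷ []
    when (no _) a = []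

    when-∈ : {A : Set} (d : Dec A) {a b : Bits} → b ∈ when d a → A × b ≡ a
    when-∈ (yes x) (here e) = x , e

    ∈-when : {A : Set} (d : Dec A) {a : Bits} → A → a ∈ when d a
    ∈-when (yes _) x = here refl
    ∈-when (no ¬x) x = ⊥-elim (¬x x)

  candidatesFrom : Fin size → Fin size → Config → Fin N → Fin N → List Bits
  candidatesFrom v w A j i =
    when (stay? v w i j) (keep N (lookup A i)) ++ when (fall? v w i j) (set (newSlot j) (keep N (lookup A i)))

  candidates : Fin size → Fin size → Config → Fin N → List Bits
  candidates v w A j = concatMap (candidatesFrom v w A j) (allFin N)

  -- Of the traces arriving at a term the most significant set of slots survives, so older slots win
  -- and no trace loses value by being merged. The default `zeros` leaves an unreached term without
  -- slots.
  best : Fin size → Fin size → Config → Fin N → Bits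
  best v w A j = argmax value zeros (candidates v w A j)

  stepConfig : Fin size → Fin size → Config → Config
  stepConfig v w A = tabulate (best v w A)

  data Source (v w : Fin size) (A : Config) (j : Fin N) : Bits → Set where
    empty : Source v w A j zeros
    stays : ∀ i → Stay v w i j → Source v w A j (keep N (lookup A i))
    falls : ∀ i → Fall v w i j → Source v w A j (set (newSlot j) (keep N (lookup A i)))

  best-source : ∀ v w A j → Source v w A j (best v w A j)
  best-source v w A j with argmax-sel value zeros (candidates v w A j)
  ... | inj₁ e = subst (Source v w A j) (sym e) empty
  ... | inj₂ m with i , m' ← Any.satisfied (∈-concatMap⁻ (candidatesFrom v w A j) {xs = allFin N} m)
    with ∈-++⁻ (when (stay? v w i j) _) m'
  ... | inj₁ m'' with s , e ← when-∈ (stay? v w i j) m'' = subst (Source v w A j) (sym e) (stays i s)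
  ... | inj₂ m'' with s , e ← when-∈ (fall? v w i j) m'' = subst (Source v w A j) (sym e) (falls i s)

  private
    best-≥ : ∀ v w A i j {a} → a ∈ candidatesFrom v w A j i → value a ≤ value (best v w A j)
    best-≥ v w A i j m = All.lookup (f[xs]≤f[argmax] zeros (candidates v w A j))
      (∈-concatMap⁺ (candidatesFrom v w A j) (lose (∈-allFin i) m))

  best-stay : ∀ v w A i j → Stay v w i j → value (keep N (lookup A i)) ≤ value (best v w A j)
  best-stay v w A i j s = best-≥ v w A i j (∈-++⁺ˡ (∈-when (stay? v w i j) s))

  best-fall : ∀ v w A i j → Fall v w i j → value (set (newSlot j) (keep N (lookup A i))) ≤ value (best v w A j)
  best-fall v w A i j s = best-≥ v w A i j (∈-++⁺ʳ (when (stay? v w i j) _) (∈-when (fall? v w i j) s))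

  record State : Set where
    constructor ⟨_,_,_⟩
    field
      node : Fin size
      conf : Config
      phase : Fin (suc (K + K))
  open State public

  data Edge : State → Event → State → Set where
    infers : ∀ {v A w} → w ∈ kids v →
      Edge ⟨ v , A , Fin.zero ⟩ (bad (suc N)) ⟨ w , stepConfig v w A , fromℕ (K + K) ⟩
    deletes : ∀ {v A} k → toℕ k < K → ¬ Used A (toℕ k) →
      Edge ⟨ v , A , Fin.suc k ⟩ (bad (toℕ k)) ⟨ v , Vec.map (remove (toℕ k)) A , inject₁ k ⟩
    keeps : ∀ {v A} k → toℕ k < K → Used A (toℕ k) → Edge ⟨ v , A , Fin.suc k ⟩ (bad K) ⟨ v , A , inject₁ k ⟩
    resets : ∀ {v A} k x → K ≤ toℕ k → x + suc (toℕ k) ≡ K + K → Used A x → ¬ Own A x →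
      Edge ⟨ v , A , Fin.suc k ⟩ (good x) ⟨ v , Vec.map (resetAt x) A , inject₁ k ⟩
    skips : ∀ {v A} k x → K ≤ toℕ k → x + suc (toℕ k) ≡ K + K → ¬ (Used A x × ¬ Own A x) →
      Edge ⟨ v , A , Fin.suc k ⟩ (bad K) ⟨ v , A , inject₁ k ⟩

  initial : State
  initial = ⟨ root , Vec.replicate N zeros , Fin.zero ⟩

  x<K : ∀ {x k} → K ≤ k → x + suc k ≡ K + K → x < K
  x<K {x} {k} le eq = +-cancelʳ-< K x K (≤-trans (≤-reflexive (sym (+-suc x K))) (≤-trans (+-monoʳ-≤ x (s≤s le)) (≤-reflexive eq)))

  level≤K : ∀ {q e q'} → Edge q e q' → level e ≤ K
  level≤K (infers _) = m≤m+n (suc N) N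
  level≤K (deletes k lt _) = <⇒≤ lt
  level≤K (keeps _ _ _) = ≤-refl
  level≤K (resets k x le eq _ _) = <⇒≤ (x<K le eq)
  level≤K (skips _ _ _ _ _) = ≤-refl

  private
    vecCode : ∀ {A : Set} {m n} → (A → Fin m) → Vec A n → Fin (m ^ n)
    vecCode f [] = Fin.zero
    vecCode f (x ∷ xs) = combine (f x) (vecCode f xs)

    vecCode-injective : ∀ {A : Set} {m n} (f : A → Fin m) → (∀ {x y} → f x ≡ f y → x ≡ y) →
      {xs ys : Vec A n} → vecCode f xs ≡ vecCode f ys → xs ≡ ys
    vecCode-injective f inj {[]} {[]} e = refl
    vecCode-injective f inj {x ∷ xs} {y ∷ ys} e with e₁ , e₂ ← Fin.combine-injective (f x) (vecCode f xs) (f y) (vecCode f ys) e =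
      cong₂ _∷_ (inj e₁) (vecCode-injective f inj e₂)

    boolCode : Bool → Fin 2
    boolCode false = Fin.zero
    boolCode true = Fin.suc Fin.zero

    boolCode-injective : ∀ {x y} → boolCode x ≡ boolCode y → x ≡ y
    boolCode-injective {false} {false} e = refl
    boolCode-injective {true} {true} e = refl

  stateCode : State → Fin (size * (suc (K + K) * (2 ^ K) ^ N))
  stateCode ⟨ v , A , k ⟩ = combine v (combine k (vecCode (vecCode boolCode) A))

  stateCode-injective : ∀ {q q'} → stateCode q ≡ stateCode q' → q ≡ q'
  stateCode-injective {⟨ v , A , k ⟩} {⟨ v' , A' , k' ⟩} e
    with refl , e₁ ← Fin.combine-injective v (combine k (vecCode (vecCode boolCode) A)) v' (combine k' (vecCode (vecCode boolCode) A')) e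
    with refl , e₂ ← Fin.combine-injective k (vecCode (vecCode boolCode) A) k' (vecCode (vecCode boolCode) A') e₁
    with refl ← vecCode-injective (vecCode boolCode) (vecCode-injective boolCode boolCode-injective) {A} {A'} e₂ = refl

-- The trace condition excludes bad cycles

module Traces (P : Preproof) (cyclic : IsCyclicProof P) where
  open Automaton P

  open Preproof P

  private
    false≢true : ∀ {b} → b ≡ false → b ≢ true
    false≢true refl ()

    ∋-map : ∀ {f : Bits → Bits} (A : Config) i {y} → lookup (Vec.map f A) i ∋ y → f (lookup A i) ∋ y
    ∋-map {f} A i {y} = subst (_∋ y) (lookup-map i f A)

    ∋-map⁺ : ∀ {f : Bits → Bits} (A : Config) i {y} → f (lookup A i) ∋ y → lookup (Vec.map f A) i ∋ y
    ∋-map⁺ {f} A i {y} = subst (_∋ y) (sym (lookup-map i f A))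

    Used⇒<K : ∀ A {y} → Used A y → y < K
    Used⇒<K A (i , h) = ∋⇒< (lookup A i) h

  -- The state of a half-finished round. Slots `y` with `y + phase < K + K` have been tested for a
  -- reset; their owners have no younger slot, so later resets leave them alone. In the deletion
  -- phases the used slots from `phase` on are already contiguous.
  record Invariant (q : State) : Set where
    field
      vacant : N < toℕ (phase q) → ¬ Used (conf q) N
      owned : ∀ y → y + toℕ (phase q) < K + K → Used (conf q) y → Own (conf q) y
      closed : toℕ (phase q) ≤ K → ∀ y z → toℕ (phase q) ≤ y → y ≤ z → Used (conf q) z → Used (conf q) y
  open Invariant

  -- Each used slot has its own owner among the N terms, and the used slots form an initial segment.
  used<N : ∀ {v A} → Invariant ⟨ v , A , Fin.zero ⟩ → ∀ {y} → Used A y → y < N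
  used<N {v} {A} inv {y} u with y <? N
  ... | yes lt = lt
  ... | no ¬lt = ⊥-elim (clash (Fin.pigeonhole (n<1+n N) (λ i → proj₁ (owner i))))
    where
    usedAt : ∀ (i : Fin (suc N)) → Used A (toℕ i)
    usedAt i = closed inv z≤n (toℕ i) y z≤n (≤-trans (≤-pred (Fin.toℕ<n i)) (≮⇒≥ ¬lt)) u
    owner : ∀ (i : Fin (suc N)) → Own A (toℕ i)
    owner i = owned inv (toℕ i) (≤-trans (≤-reflexive (cong suc (+-identityʳ (toℕ i)))) (≤-trans (Used⇒<K A (usedAt i)) (m≤m+n K K))) (usedAt i)
    clash : ∃ (λ i → ∃ λ j → i Fin.< j × proj₁ (owner i) ≡ proj₁ (owner j)) → ⊥
    clash (i , j , lt , e) with owner i | owner j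
    clash (i , j , lt , refl) | t , _ , none | _ , h , _ = false≢true none (anyAbove-complete (toℕ i) (lookup A t) lt h)

  Invariant-initial : Invariant initial
  Invariant-initial = record
    { vacant = λ ()
    ; owned = λ y _ u → ⊥-elim (unused u)
    ; closed = λ _ _ _ _ _ u → ⊥-elim (unused u) }
    where
    unused : ∀ {y} → ¬ Used (Vec.replicate N (zeros {K})) y
    unused {y} (i , h) = bit-zeros K y (subst (_∋ y) (lookup-replicate i (zeros {K})) h)

  private
    <⇒+<K+K : ∀ {y k} → y < K → k ≤ K → y + k < K + K
    <⇒+<K+K = +-mono-<-≤

    stepN : ∀ v w A → ¬ Used (stepConfig v w A) N
    stepN v w A (j , h) = absurd (best-source v w A j) (subst (_∋ N) (lookup∘tabulate (best v w A) j) h)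
      where
      absurd : ∀ {a} → Source v w A j a → ¬ (a ∋ N)
      absurd empty h = bit-zeros K N h
      absurd (stays i _) h = <-irrefl refl (proj₂ (keep-∋ N (lookup A i) h))
      absurd (falls i _) h with set-∋ (newSlot j) (keep N (lookup A i)) h
      ... | inj₁ e = <-irrefl e (s≤s (m≤m+n N (toℕ j)))
      ... | inj₂ h' = <-irrefl refl (proj₂ (keep-∋ N (lookup A i) h'))

    module Delete (A : Config) (k : ℕ) where
      A' = Vec.map (remove k) A

      used⁻ : ∀ {y} → Used A' y → (y < k × Used A y) ⊎ (k ≤ y × Used A (suc y))
      used⁻ (i , h) with remove-∋ k (lookup A i) (∋-map A i h)
      ... | inj₁ (lt , h') = inj₁ (lt , i , h')
      ... | inj₂ (le , h') = inj₂ (le , i , h')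

      own< : ∀ {y} → y < k → Own A y → Own A' y
      own< {y} lt (i , h , none) = i , ∋-map⁺ A i (trans (bit-remove-< k (lookup A i) lt) h) , ≡false λ e →
        contra (anyAbove-sound y (remove k (lookup A i)) (trans (cong (anyAbove y) (sym (lookup-map i (remove k) A))) e))
        where
        contra : ¬ ∃ λ z → y < z × remove k (lookup A i) ∋ z
        contra (z , y<z , h) with remove-∋ k (lookup A i) h
        ... | inj₁ (_ , h') = false≢true none (anyAbove-complete y (lookup A i) y<z h')
        ... | inj₂ (_ , h') = false≢true none (anyAbove-complete y (lookup A i) (m<n⇒m<1+n y<z) h')

      own≥ : ∀ {y} → k ≤ y → Own A (suc y) → Own A' y
      own≥ {y} le (i , h , none) = i , ∋-map⁺ A i (trans (bit-remove-≥ k (lookup A i) le) h) , ≡false λ e →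
        contra (anyAbove-sound y (remove k (lookup A i)) (trans (cong (anyAbove y) (sym (lookup-map i (remove k) A))) e))
        where
        contra : ¬ ∃ λ z → y < z × remove k (lookup A i) ∋ z
        contra (z , y<z , h) with remove-∋ k (lookup A i) h
        ... | inj₁ (z<k , _) = <-irrefl refl (<-≤-trans z<k (≤-trans le (<⇒≤ y<z)))
        ... | inj₂ (_ , h') = false≢true none (anyAbove-complete (suc y) (lookup A i) (s≤s y<z) h')

    module Reset (A : Config) (x : ℕ) where
      A' = Vec.map (resetAt x) A

      used⁻ : ∀ {y} → Used A' y → Used A y
      used⁻ (i , h) = i , resetAt-∋ x (lookup A i) (∋-map A i h)

      own< : ∀ {y} → y < x → Own A y → Own A' y
      own< {y} lt (i , h , none) = i , subst (_∋ y) (sym eq) h , trans (cong (anyAbove y) eq) none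
        where
        eq : lookup A' i ≡ lookup A i
        eq = trans (lookup-map i (resetAt x) A) (resetAt-no x _ λ h' → false≢true none (anyAbove-complete y (lookup A i) lt h'))

      own≡ : Used A x → Own A' x
      own≡ (i , h) = i , subst (_∋ x) (sym eq) (cutAbove-at x (lookup A i) h) , ≡false λ e → contra (anyAbove-sound x (cutAbove x (lookup A i)) (trans (cong (anyAbove x) (sym eq)) e))
        where
        eq : lookup A' i ≡ cutAbove x (lookup A i)
        eq = trans (lookup-map i (resetAt x) A) (resetAt-yes x _ h)
        contra : ¬ ∃ λ z → x < z × cutAbove x (lookup A i) ∋ z
        contra (z , lt , h) = <-irrefl refl (<-≤-trans lt (proj₂ (cutAbove-∋ x (lookup A i) h)))

    y≤x : ∀ {x y k} → x + suc k ≡ K + K → y + k < K + K → y < x ⊎ y ≡ x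
    y≤x {x} {y} {k} eq lt = m≤n⇒m<n∨m≡n (+-cancelʳ-≤ (suc k) y x (≤-trans (≤-reflexive (+-suc y k)) (≤-trans lt (≤-reflexive (sym eq)))))

    below : ∀ {x y k} → x + suc k ≡ K + K → y < x → y + suc k < K + K
    below {k = k} eq lt = <-≤-trans (+-monoˡ-< (suc k) lt) (≤-reflexive eq)

  Invariant-step : ∀ {q e q'} → Edge q e q' → Invariant q → Invariant q'
  Invariant-step (infers {v} {A} {w} _) inv = record
    { vacant = λ _ → stepN v w A
    ; owned = λ y lt _ → ⊥-elim (m+n≮n y (K + K) (subst (λ k → y + k < K + K) (Fin.toℕ-fromℕ (K + K)) lt))
    ; closed = λ le → ⊥-elim (m+n≮m K (N + N) (≤-trans (≤-reflexive lem) (subst (_≤ K) (Fin.toℕ-fromℕ (K + K)) le))) }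
    where
    lem : suc (K + (N + N)) ≡ K + K
    lem = trans (sym (+-suc K (N + N))) refl
  Invariant-step (deletes {v} {A} k lt ¬u) inv = record
    { vacant = vac
    ; owned = own
    ; closed = λ _ y z le le' u → clo y z le le' u }
    where
    k' = toℕ k
    open Delete A k'
    vac : N < toℕ (inject₁ k) → ¬ Used A' N
    vac lt' u rewrite Fin.toℕ-inject₁ k with used⁻ u
    ... | inj₁ (_ , u') = vacant inv (m<n⇒m<1+n lt') u'
    ... | inj₂ (le , _) = <-irrefl refl (<-≤-trans lt' le)
    own : ∀ y → y + toℕ (inject₁ k) < K + K → Used A' y → Own A' y
    own y _ u with used⁻ u
    ... | inj₁ (y<k , u') = own< y<k (owned inv y (<⇒+<K+K (Used⇒<K A u') lt) u')
    ... | inj₂ (k≤y , u') = own≥ k≤y (owned inv (suc y) (<⇒+<K+K (Used⇒<K A u') lt) u')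
    clo : ∀ y z → toℕ (inject₁ k) ≤ y → y ≤ z → Used A' z → Used A' y
    clo y z le y≤z u rewrite Fin.toℕ-inject₁ k with used⁻ u
    ... | inj₁ (z<k , _) = ⊥-elim (<-irrefl refl (<-≤-trans z<k (≤-trans le y≤z)))
    ... | inj₂ (_ , u') with i , h ← closed inv lt (suc y) (suc z) (s≤s le) (s≤s y≤z) u' =
      i , ∋-map⁺ A i (trans (bit-remove-≥ k' (lookup A i) le) h)
  Invariant-step (keeps {v} {A} k lt used) inv = record
    { vacant = λ lt' → vacant inv (m<n⇒m<1+n (subst (N <_) (Fin.toℕ-inject₁ k) lt'))
    ; owned = λ y _ u → owned inv y (<⇒+<K+K (Used⇒<K A u) lt) u
    ; closed = λ _ y z le y≤z u → clo y z (subst (_≤ y) (Fin.toℕ-inject₁ k) le) y≤z u }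
    where
    clo : ∀ y z → toℕ k ≤ y → y ≤ z → Used A z → Used A y
    clo y z le y≤z u with m≤n⇒m<n∨m≡n le
    ... | inj₁ k<y = closed inv lt y z k<y y≤z u
    ... | inj₂ refl = used
  Invariant-step (resets {v} {A} k x K≤k eq used ¬own) inv = record
    { vacant = λ lt' u → vacant inv (m<n⇒m<1+n (subst (N <_) (Fin.toℕ-inject₁ k) lt')) (used⁻ u)
    ; owned = λ y lt u → own y (subst (λ k → y + k < K + K) (Fin.toℕ-inject₁ k) lt) u
    ; closed = λ _ y z le y≤z u → ⊥-elim (<-irrefl refl (<-≤-trans (Used⇒<K A' u)
        (≤-trans K≤k (≤-trans (subst (_≤ y) (Fin.toℕ-inject₁ k) le) y≤z)))) }
    where
    open Reset A x
    own : ∀ y → y + toℕ k < K + K → Used A' y → Own A' y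
    own y lt u with y≤x eq lt
    ... | inj₁ y<x = own< y<x (owned inv y (below eq y<x) (used⁻ u))
    ... | inj₂ refl = own≡ used
  Invariant-step (skips {v} {A} k x K≤k eq ¬both) inv = record
    { vacant = λ lt' → vacant inv (m<n⇒m<1+n (subst (N <_) (Fin.toℕ-inject₁ k) lt'))
    ; owned = λ y lt u → own y (subst (λ k → y + k < K + K) (Fin.toℕ-inject₁ k) lt) u
    ; closed = λ _ y z le y≤z u → ⊥-elim (<-irrefl refl (<-≤-trans (Used⇒<K A u)
        (≤-trans K≤k (≤-trans (subst (_≤ y) (Fin.toℕ-inject₁ k) le) y≤z)))) }
    where
    own : ∀ y → y + toℕ k < K + K → Used A y → Own A y
    own y lt u with y≤x eq lt
    ... | inj₁ y<x = owned inv y (below eq y<x) u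
    ... | inj₂ refl with own? A x
    ... | yes o = o
    ... | no ¬o = ⊥-elim (¬both (u , ¬o))

  module _ {p : ℕ} (p≤N : p ≤ N) where

    silent-Advance : ∀ {q e q' k} → Edge q e q' → p ≤ level e → toℕ (phase q) ≡ suc k →
                     ∀ i → Advance p (lookup (conf q) i) (lookup (conf q') i)
    silent-Advance (deletes {A = A} k lt ¬u) le _ i = subst (Advance p (lookup A i)) (sym (lookup-map i (remove (toℕ k)) A))
      (remove-Advance p (toℕ k) (lookup A i) le λ h → ¬u (i , h))
    silent-Advance (keeps {A = A} _ _ _) le _ i = Advance-refl p (lookup A i)
    silent-Advance (resets {A = A} k x _ _ _ _) le _ i = subst (Advance p (lookup A i)) (sym (lookup-map i (resetAt x) A))
      (reset-Advance p x (lookup A i) le)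
    silent-Advance (skips {A = A} _ _ _ _ _) le _ i = Advance-refl p (lookup A i)

    bad-strict : ∀ {q q'} → Edge q (bad p) q' → ∀ i i' → (∀ {k} → toℕ (phase q) ≡ suc k → i ≡ i') → Hit p (lookup (conf q) i) →
                 pot p (lookup (conf q) i) < pot p (lookup (conf q') i')
    bad-strict (infers _) = ⊥-elim (<-irrefl refl p≤N)
    bad-strict (deletes {A = A} k lt ¬u) i i' eq hit with refl ← eq refl =
      subst (λ a → pot p (lookup A i) < pot p a) (sym (lookup-map i (remove (toℕ k)) A))
        (remove-strict p (lookup A i) (λ h → ¬u (i , h)) hit)
    bad-strict (keeps _ _ _) = ⊥-elim (<-irrefl refl (≤-<-trans p≤N (m≤m+n (suc N) N)))
    bad-strict (skips _ _ _ _ _) = ⊥-elim (<-irrefl refl (≤-<-trans p≤N (m≤m+n (suc N) N)))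

    module _ {v w : Fin size} (A : Config) (i : Fin N) {j : Fin N} (small : ∀ y → lookup A i ∋ y → y < N) where

      private
        kept : keep N (lookup A i) ≡ lookup A i
        kept = keep-id N (lookup A i) small

      stay-Advance : Stay v w i j → Advance p (lookup A i) (best v w A j)
      stay-Advance s = value-Advance p (lookup A i) (best v w A j) (subst (λ a → value a ≤ value (best v w A j)) kept (best-stay v w A i j s))

      private
        opened : Bits
        opened = set (newSlot j) (lookup A i)

        opened≤ : Fall v w i j → value opened ≤ value (best v w A j)
        opened≤ s = subst (λ a → value (set (newSlot j) a) ≤ value (best v w A j)) kept (best-fall v w A i j s)

      fall-Advance : Fall v w i j → Advance p (lookup A i) (best v w A j)
      fall-Advance s = value-Advance p (lookup A i) (best v w A j) (≤-trans (value-set (newSlot j) (lookup A i)) (opened≤ s))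

      -- The opened slot lies beyond `p` and so is a hit. A better candidate that displaces it
      -- either has a hit as well or has raised the potential.
      fall-hits : Fall v w i j → pot p (lookup A i) < pot p (best v w A j) ⊎ Hit p (best v w A j)
      fall-hits s with value-Advance p (lookup A i) opened (value-set (newSlot j) (lookup A i)) | value-Advance p opened (best v w A j) (opened≤ s)
      ... | adv | inj₂ (_ , f) = inj₂ (f (newSlot j , ≤-trans p≤N (≤-trans (n≤1+n N) (m≤m+n (suc N) (toℕ j))) , set-new (newSlot j) (lookup A i) (newSlot<K j)))
      ... | inj₁ lt | inj₁ lt' = inj₁ (<-trans lt lt')
      ... | inj₂ (e , _) | inj₁ lt' = inj₁ (≤-<-trans (≤-reflexive e) lt')

  private
    infer-inv : ∀ {q e q'} → Edge q e q' → toℕ (phase q) ≡ 0 →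
      node q' ∈ kids (node q) × toℕ (phase q') ≡ K + K × conf q' ≡ stepConfig (node q) (node q') (conf q) × phase q ≡ Fin.zero
    infer-inv (infers m) _ = m , Fin.toℕ-fromℕ (K + K) , refl , refl

    silent-inv : ∀ {q e q' k} → Edge q e q' → toℕ (phase q) ≡ suc k → node q' ≡ node q × toℕ (phase q') ≡ k
    silent-inv (deletes k _ _) e = refl , trans (Fin.toℕ-inject₁ k) (suc-injective e)
    silent-inv (keeps k _ _) e = refl , trans (Fin.toℕ-inject₁ k) (suc-injective e)
    silent-inv (resets k _ _ _ _ _) e = refl , trans (Fin.toℕ-inject₁ k) (suc-injective e)
    silent-inv (skips k _ _ _ _) e = refl , trans (Fin.toℕ-inject₁ k) (suc-injective e)

    -- Slot `N` exists for this lemma: being vacant, it is deleted in every round, so no run stays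
    -- above level `N` for ever.
    delete-N : ∀ {q e q'} → Edge q e q' → Invariant q → toℕ (phase q) ≡ suc N → level e ≡ N
    delete-N (deletes k _ _) inv e = suc-injective e
    delete-N (keeps {A = A} k _ u) inv e = ⊥-elim (vacant inv (≤-reflexive (sym e)) (subst (Used A) (suc-injective e) u))
    delete-N (resets k x le _ _ _) inv e = ⊥-elim (m+n≮m N N (≤-trans le (≤-reflexive (suc-injective e))))
    delete-N (skips k x le _ _) inv e = ⊥-elim (m+n≮m N N (≤-trans le (≤-reflexive (suc-injective e))))

  module _ {p : ℕ} (run : Runs.Run Edge initial p) where
    open Runs.Run run

    private
      ph : ℕ → ℕ
      ph j = toℕ (phase (at j))

      nd : ℕ → Fin size
      nd j = node (at j)

      invariant : ∀ j → Invariant (at j)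
      invariant zero = subst Invariant (sym start) Invariant-initial
      invariant (suc j) = Invariant-step (edge j) (invariant j)

      bump : ℕ → ℕ → ℕ
      bump zero i = suc i
      bump (suc _) i = i

      -- the number of inferences made before time j
      idx : ℕ → ℕ
      idx zero = 0
      idx (suc j) = bump (ph j) (idx j)

      skip : ∀ d m j → ph j ≡ d + m → ph (j + d) ≡ m × nd (j + d) ≡ nd j × idx (j + d) ≡ idx j
      skip zero m j e = subst (λ i → ph i ≡ m × nd i ≡ nd j × idx i ≡ idx j) (sym (+-identityʳ j)) (e , refl , refl)
      skip (suc d) m j e
        with nd-e , ph-e ← silent-inv (edge j) e
        with a , b , c ← skip d m (suc j) ph-e =
        subst (λ i → ph i ≡ m × nd i ≡ nd j × idx i ≡ idx j) (sym (+-suc j d))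
          (a , trans b nd-e , trans c (cong (λ k → bump k (idx j)) e))

      time : ℕ → ℕ
      time zero = 0
      time (suc i) = suc (time i) + (K + K)

      ph-time : ∀ i → ph (time i) ≡ 0
      round : ∀ i → ph (suc (time i)) ≡ K + K
      ph-time zero = cong (toℕ ∘ phase) start
      ph-time (suc i) = proj₁ (skip (K + K) 0 (suc (time i)) (trans (round i) (sym (+-identityʳ _))))
      round i = proj₁ (proj₂ (infer-inv (edge (time i)) (ph-time i)))

      nd-time : ∀ i → nd (time (suc i)) ≡ nd (suc (time i))
      nd-time i = proj₁ (proj₂ (skip (K + K) 0 (suc (time i)) (trans (round i) (sym (+-identityʳ _)))))

      idx-time : ∀ i → idx (time i) ≡ i
      idx-time zero = refl
      idx-time (suc i) = trans (proj₂ (proj₂ (skip (K + K) 0 (suc (time i)) (trans (round i) (sym (+-identityʳ _))))))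
        (trans (cong (λ k → bump k (idx (time i))) (ph-time i)) (cong suc (idx-time i)))

      time-≥ : ∀ i → i ≤ time i
      time-≥ zero = z≤n
      time-≥ (suc i) = s≤s (≤-trans (time-≥ i) (m≤m+n (time i) (K + K)))

      time-idx : ∀ j → j + ph j ≡ time (idx j)
      time-idx zero = ph-time 0
      time-idx (suc j) with ph j in e
      ... | zero = cong₂ (λ a b → suc (a + b)) (trans (trans (sym (+-identityʳ j)) (cong (j +_) (sym e))) (time-idx j))
                     (proj₁ (proj₂ (infer-inv (edge j) e)))
      ... | suc k = trans (cong (suc j +_) (proj₂ (silent-inv (edge j) e)))
                     (trans (sym (+-suc j k)) (trans (cong (j +_) (sym e)) (time-idx j)))

      nd-idx : ∀ j → nd j ≡ nd (time (idx j))
      nd-idx j = trans (sym (proj₁ (proj₂ (skip (ph j) 0 j (sym (+-identityʳ _)))))) (cong nd (time-idx j))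

      idx-mono : ∀ d j → idx j ≤ idx (d + j)
      idx-mono zero j = ≤-refl
      idx-mono (suc d) j = ≤-trans (idx-mono d j) (bump≥ (ph (d + j)))
        where
        bump≥ : ∀ k {i} → i ≤ bump k i
        bump≥ zero = n≤1+n _
        bump≥ (suc k) = ≤-refl

      -- Only inferences move in the preproof, so the run sampled at the times of its inferences is
      -- a branch.
      branch : Branch P
      branch = record
        { node = nd ∘ time
        ; start = cong node start
        ; next = λ i → subst (_∈ kids (nd (time i))) (sym (nd-time i)) (proj₁ (infer-inv (edge (time i)) (ph-time i)))
        }

      module Follow (p≤N : p ≤ N) (trace : InfProgTrace P branch) where
        onset = proj₁ trace
        τ = proj₁ (proj₂ trace)
        occurs = proj₁ (proj₂ (proj₂ trace))
        steps = proj₁ (proj₂ (proj₂ (proj₂ trace)))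
        progress = proj₂ (proj₂ (proj₂ (proj₂ trace)))

        ι : ℕ → Fin N
        ι i with onset ≤? i
        ... | yes le = proj₁ (Occ⇒tm (occurs i le))
        -- Before the onset any index serves; the term at the onset supplies one.
        ... | no _ = proj₁ (Occ⇒tm (occurs onset ≤-refl))

        tm-ι : ∀ i → onset ≤ i → tm (ι i) ≡ τ i
        tm-ι i le with onset ≤? i
        ... | yes le' = proj₂ (Occ⇒tm (occurs i le'))
        ... | no ¬le = ⊥-elim (¬le le)

        occurs-ι : ∀ i → onset ≤ i → Occ (nd (time i)) (tm (ι i))
        occurs-ι i le = subst (Occ (nd (time i))) (sym (tm-ι i le)) (occurs i le)

        fallS : ∀ i → onset ≤ i → ProgressAt P branch τ i → Fall (nd (time i)) (nd (time (suc i))) (ι i) (ι (suc i))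
        fallS i le pr = occurs-ι i le , occurs-ι (suc i) le' ,
          subst₂ (Prog′ (nd (time i)) (nd (time (suc i)))) (sym (tm-ι i le)) (sym (tm-ι (suc i) le')) pr
          where le' = m≤n⇒m≤1+n le

        relS : ∀ i → onset ≤ i → Stay (nd (time i)) (nd (time (suc i))) (ι i) (ι (suc i)) ⊎ Fall (nd (time i)) (nd (time (suc i))) (ι i) (ι (suc i))
        relS i le with steps i le
        ... | inj₁ st = inj₁ (occurs-ι i le , occurs-ι (suc i) le' ,
                subst₂ (Prec′ (nd (time i))) (sym (tm-ι i le)) (sym (tm-ι (suc i) le')) st)
          where le' = m≤n⇒m≤1+n le
        ... | inj₂ pr = inj₂ (fallS i le pr)

        bits : ℕ → Bits
        bits j = lookup (conf (at j)) (ι (idx j))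

        small : ∀ j → ph j ≡ 0 → ∀ i y → lookup (conf (at j)) i ∋ y → y < N
        small j e i y h = used<N inv (i , h)
          where
          inv : Invariant ⟨ nd j , conf (at j) , Fin.zero ⟩
          inv = subst (λ k → Invariant ⟨ nd j , conf (at j) , k ⟩) (proj₂ (proj₂ (proj₂ (infer-inv (edge j) e)))) (invariant j)

        idx-zero : ∀ j → ph j ≡ 0 → idx (suc j) ≡ suc (idx j)
        idx-zero j e = cong (λ k → bump k (idx j)) e

        idx-silent : ∀ j {k} → ph j ≡ suc k → idx (suc j) ≡ idx j
        idx-silent j e = cong (λ k → bump k (idx j)) e

        bits-next : ∀ j → ph j ≡ 0 → best (nd j) (nd (suc j)) (conf (at j)) (ι (suc (idx j))) ≡ bits (suc j)
        bits-next j e = sym (trans (cong₂ (λ A i → lookup A (ι i)) (proj₁ (proj₂ (proj₂ (infer-inv (edge j) e)))) (idx-zero j e))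
          (lookup∘tabulate (best (nd j) (nd (suc j)) (conf (at j))) (ι (suc (idx j)))))

        moved : ∀ (R : Fin size → Fin size → Fin N → Fin N → Set) j → ph j ≡ 0 →
          R (nd (time (idx j))) (nd (time (suc (idx j)))) (ι (idx j)) (ι (suc (idx j))) →
          R (nd j) (nd (suc j)) (ι (idx j)) (ι (suc (idx j)))
        moved R j e = subst₂ (λ v w → R v w (ι (idx j)) (ι (suc (idx j)))) (sym (nd-idx j))
          (sym (trans (nd-idx (suc j)) (cong (nd ∘ time) (idx-zero j e))))

        advance : ∀ j → threshold ≤ j → onset ≤ idx j → Advance p (bits j) (bits (suc j))
        advance j le le' = byPhase (ph j) refl
          where
          go : ph j ≡ 0 → _ → Advance p (bits j) (best (nd j) (nd (suc j)) (conf (at j)) (ι (suc (idx j))))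
          go e (inj₁ st) = stay-Advance p≤N (conf (at j)) (ι (idx j)) (small j e _) (moved Stay j e st)
          go e (inj₂ fa) = fall-Advance p≤N (conf (at j)) (ι (idx j)) (small j e _) (moved Fall j e fa)
          byPhase : ∀ k → ph j ≡ k → Advance p (bits j) (bits (suc j))
          byPhase (suc k) e = subst (λ i → Advance p (bits j) (lookup (conf (at (suc j))) (ι i))) (sym (idx-silent j e))
            (silent-Advance p≤N (edge j) (eventually j le) e (ι (idx j)))
          byPhase zero e = subst (Advance p (bits j)) (bits-next j e) (go e (relS (idx j) le'))

        -- From here on the trace has begun and no event has a level below `p`.
        origin : ℕ
        origin = threshold + time onset

        after : ∀ i → threshold ≤ i + origin × onset ≤ idx (i + origin)
        after i = ≤-trans (m≤m+n threshold (time onset)) (m≤n+m origin i) ,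
          ≤-trans (≤-reflexive (sym (idx-time onset)))
            (subst (λ j → idx (time onset) ≤ idx j) (+-assoc i threshold (time onset)) (idx-mono (i + threshold) (time onset)))

        back : ∀ k {j} → k + origin ≤ j → ∃ λ i → k ≤ i × i + origin ≡ j
        back k {j} le = j ∸ origin , ≤-trans (≤-reflexive (sym (m+n∸n≡m k origin))) (∸-monoˡ-≤ origin le) ,
          m∸n+n≡m (≤-trans (m≤n+m origin k) le)

        hits : ∀ k → ∃ λ i → k ≤ i × (pot p (bits (i + origin)) < pot p (bits (suc i + origin)) ⊎ Hit p (bits (suc i + origin)))
        hits k with i , le , m≤i , pr ← progress (k + origin)
          with i' , k≤i' , e ← back k (≤-trans le (time-≥ i)) = i' , k≤i' ,
            subst (λ j → pot p (bits j) < pot p (bits (suc j)) ⊎ Hit p (bits (suc j))) (sym e)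
              (subst (λ a → pot p (bits (time i)) < pot p a ⊎ Hit p a) (bits-next (time i) (ph-time i))
                (fall-hits p≤N (conf (at (time i))) (ι (idx (time i))) (small (time i) (ph-time i) _)
                  (moved Fall (time i) (ph-time i) (subst (λ l → Fall (nd (time l)) (nd (time (suc l))) (ι l) (ι (suc l))) (sym (idx-time i)) (fallS i m≤i pr)))))

        losses : ∀ k → ∃ λ i → k ≤ i × (Hit p (bits (i + origin)) → pot p (bits (i + origin)) < pot p (bits (suc i + origin)))
        losses k with j , le , e ← recurrent (k + origin)
          with i , k≤i , refl ← back k le = i , k≤i ,
            bad-strict p≤N (subst (λ ev → Edge (at (i + origin)) ev (at (suc (i + origin)))) e (edge (i + origin))) _ _
              (λ e' → cong ι (sym (idx-silent (i + origin) e')))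

        impossible : ⊥
        impossible = no-recurrence (λ i → bits (i + origin)) p (λ i → advance (i + origin) (proj₁ (after i)) (proj₂ (after i))) hits losses

    no-run : ⊥
    no-run with p ≤? N
    ... | yes p≤N = Follow.impossible p≤N (cyclic branch)
    ... | no p≰N = p≰N (≤-trans (eventually j late) (≤-reflexive (delete-N (edge j) (invariant j) (proj₁ (skip d (suc N) j₀ eq)))))
      where
      -- Since `K + K` is `d + suc N`, after `d` silent steps of a round the phase is `suc N`, where
      -- slot `N` is deleted.
      d = N + K
      j₀ = suc (time threshold)
      j = j₀ + d
      late : threshold ≤ j
      late = ≤-trans (time-≥ threshold) (≤-trans (n≤1+n _) (m≤m+n j₀ d))
      eq : ph j₀ ≡ d + suc N
      eq = trans (round threshold) (trans (cong (_+ K) (+-comm (suc N) N)) (trans (+-assoc N (suc N) K) (trans (cong (N +_) (+-comm (suc N) K)) (sym (+-assoc N K (suc N))))))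

  noBadCycle : Paths.NoBadCycle Edge initial
  noBadCycle p q q' prefix loop back = no-run (Runs.lasso Edge prefix loop back)

-- Sequents with slot bounds and their induction hypotheses as formulas

module Goals (n : ℕ) (P : Preproof) (onlySig : OnlySig P n) where

  open Preproof P
  open Theory n
  open Arithmetic n
  open Automaton P

  private
    maxOver : ∀ {m} → (Fin m → ℕ) → ℕ
    maxOver {zero} f = 0
    maxOver {suc m} f = f Fin.zero ⊔ maxOver (f ∘ Fin.suc)

    ≤maxOver : ∀ {m} (f : Fin m → ℕ) i → f i ≤ maxOver f
    ≤maxOver f Fin.zero = m≤m⊔n _ _
    ≤maxOver f (Fin.suc i) = ≤-trans (≤maxOver (f ∘ Fin.suc) i) (m≤n⊔m (f Fin.zero) _)

    maxFormula : List Formula → ℕ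
    maxFormula [] = 0
    maxFormula (φ ∷ Γ) = bndF φ ⊔ maxFormula Γ

    ≤maxFormula : ∀ {φ Γ} → φ ∈ Γ → bndF φ ≤ maxFormula Γ
    ≤maxFormula (here refl) = m≤m⊔n _ _
    ≤maxFormula {Γ = ψ ∷ Γ} (there m) = ≤-trans (≤maxFormula m) (m≤n⊔m (bndF ψ) _)

    nodeBound : Fin size → ℕ
    nodeBound v = maxFormula (formulasOf (seqAt v)) ⊔ eigenBound (LabelledStep.rule (stepAt v))

  -- Variables below B belong to P; variable B + x holds the number attached to slot x.
  B : ℕ
  B = maxOver nodeBound

  free<B : ∀ {v φ a} → φ ∈ formulasOf (seqAt v) → FreeF a φ → a < B
  free<B {v} {φ} m f = <-≤-trans (free<bndF φ f) (≤-trans (≤maxFormula m) (≤-trans (m≤m⊔n _ _) (≤maxOver nodeBound v)))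

  eigen≤B : ∀ v → eigenBound (LabelledStep.rule (stepAt v)) ≤ B
  eigen≤B v = ≤-trans (m≤n⊔m (maxFormula (formulasOf (seqAt v))) _) (≤maxOver nodeBound v)

  occ<B : ∀ {v t a} → Occ v t → FreeT a t → a < B
  occ<B (φ , m , o) f = free<B m (occF-free φ o f)

  -- Slots 0 to `K` receive a variable each. Bit vectors end before `K`, but `K` is also a level,
  -- and induction at that level needs a number.
  M : ℕ
  M = B + suc K

  c : ℕ → Term
  c x = var (B + x)

  B+<M : ∀ {x} → x ≤ K → B + x < M
  B+<M le = +-monoʳ-< B (s≤s le)

  <B⇒<M : ∀ {a} → a < B → a < M
  <B⇒<M lt = <-≤-trans lt (m≤m+n B (suc K))

  -- A younger slot is entered when the trace descends, so strictness at the older slot records that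
  -- progress; it is what makes a later decrement possible.
  atom : Bits → Term → ℕ → Formula
  atom a t x = if anyAbove x a then t ≺ c x else t ≺ S (c x)

  private
    atoms : Config → Fin N → ℕ → List Formula
    atoms A i x = if bit (lookup A i) x then atom (lookup A i) (tm i) x ∷ [] else []

    atomsOf : Fin size → Config → Fin N → List Formula
    atomsOf v A i with occ? v (tm i)
    ... | yes _ = concatMap (atoms A i) (upTo K)
    ... | no _ = []

  inv : Fin size → Config → List Formula
  inv v A = concatMap (atomsOf v A) (allFin N)

  ∈-inv⁻ : ∀ {v A φ} → φ ∈ inv v A → ∃ λ i → ∃ λ x → Occ v (tm i) × lookup A i ∋ x × φ ≡ atom (lookup A i) (tm i) x
  ∈-inv⁻ {v} {A} {φ} m with i , m₁ ← Any.satisfied (∈-concatMap⁻ (atomsOf v A) {xs = allFin N} m)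
    with occ? v (tm i)
  ... | yes o with x , m₂ ← Any.satisfied (∈-concatMap⁻ (atoms A i) {xs = upTo K} m₁) with bit (lookup A i) x in e | m₂
  ... | true | here eq = i , x , o , e , eq

  ∈-inv⁺ : ∀ {v A} i {x} → Occ v (tm i) → lookup A i ∋ x → atom (lookup A i) (tm i) x ∈ inv v A
  ∈-inv⁺ {v} {A} i {x} o h = ∈-concatMap⁺ (atomsOf v A) (lose (∈-allFin i) part)
    where
    single∈ : atom (lookup A i) (tm i) x ∈ atoms A i x
    single∈ rewrite h = here refl
    part : atom (lookup A i) (tm i) x ∈ atomsOf v A i
    part with occ? v (tm i)
    ... | yes _ = ∈-concatMap⁺ (atoms A i) (lose (∈-upTo⁺ (∋⇒< (lookup A i) h)) single∈)
    ... | no ¬o = ⊥-elim (¬o o)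

  core : State → List Formula
  core q = inv (node q) (conf q) ++ ante (seqAt (node q))

  right : State → List Formula
  right q = Defs.succ (seqAt (node q))

  Below : ℕ → List Formula → Set
  Below m Γ = ∀ {φ} → φ ∈ Γ → ∀ a → FreeF a φ → a < m

  private
    ante∈ : ∀ s {φ} → φ ∈ ante s → φ ∈ formulasOf s
    ante∈ (Γ ⇒ Δ) m = ∈-++⁺ˡ m

    succ∈ : ∀ s {φ} → φ ∈ Defs.succ s → φ ∈ formulasOf s
    succ∈ (Γ ⇒ Δ) m = ∈-++⁺ʳ Γ m

  ante-below : ∀ v → Below B (ante (seqAt v))
  ante-below v m a = free<B (ante∈ (seqAt v) m)

  succ-below : ∀ v → Below B (Defs.succ (seqAt v))
  succ-below v m a = free<B (succ∈ (seqAt v) m)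

  atom-free : ∀ b t x {a} → FreeF a (atom b t x) → FreeT a t ⊎ a ≡ B + x
  atom-free b t x f with anyAbove x b | f
  ... | true | inj₁ f' = inj₁ f'
  ... | true | inj₂ e = inj₂ e
  ... | false | inj₁ f' = inj₁ f'
  ... | false | inj₂ e = inj₂ e

  core-below : ∀ q → Below M (core q)
  core-below q m a f with ∈-++⁻ (inv (node q) (conf q)) m
  ... | inj₂ m' = <B⇒<M (ante-below (node q) m' a f)
  ... | inj₁ m' with i , x , o , h , refl ← ∈-inv⁻ m' with atom-free (lookup (conf q) i) (tm i) x f
  ... | inj₁ f' = <B⇒<M (occ<B o f')
  ... | inj₂ refl = B+<M (<⇒≤ (∋⇒< (lookup (conf q) i) h))

  right-below : ∀ q → Below M (right q)
  right-below q m a f = <B⇒<M (succ-below (node q) m a f)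

  map-fixed : ∀ {m σ Γ} → Below m Γ → (∀ a → a < m → σ a ≡ var a) → map (substF σ) Γ ≡ Γ
  map-fixed {σ = σ} {[]} b h = refl
  map-fixed {Γ = φ ∷ Γ} b h = cong₂ _∷_ (substF-≗id φ λ a f → h a (b (here refl) a f)) (map-fixed (λ m → b (there m)) h)

  map-agree : ∀ {m σ τ Γ} → Below m Γ → (∀ a → a < m → σ a ≡ τ a) → map (substF σ) Γ ≡ map (substF τ) Γ
  map-agree {Γ = []} b h = refl
  map-agree {Γ = φ ∷ Γ} b h = cong₂ _∷_ (substF-cong φ λ a f → h a (b (here refl) a f)) (map-agree (λ m → b (there m)) h)

  seqFormula-subst : ∀ σ Γ Δ → substF σ (seqFormula (Γ ⇒ Δ)) ≡ seqFormula (map (substF σ) Γ ⇒ map (substF σ) Δ)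
  seqFormula-subst σ Γ Δ = trans (bigOr-subst (map dual Γ ++ Δ)) (cong bigOr (trans (map-++ (substF σ) (map dual Γ) Δ)
    (cong (_++ map (substF σ) Δ) (trans (sym (map-∘ Γ)) (trans (map-cong (λ φ → sym (dual-substF σ φ)) Γ) (map-∘ Γ))))))
    where
    bigOr-subst : ∀ L → substF σ (bigOr L) ≡ bigOr (map (substF σ) L)
    bigOr-subst [] = refl
    bigOr-subst (φ ∷ L) = cong (substF σ φ ∨ᶠ_) (bigOr-subst L)

  -- The block binds the variables of the preproof and all slots, so whatever stays free comes from
  -- `gs`, whose outer terms must be shifted by `M`.
  guarded : State → List Formula → Formula
  guarded q gs = alls M (seqFormula (gs ++ core q ⇒ right q))

  guarded-subst : ∀ σ q gs → substF σ (guarded q gs) ≡ guarded q (map (substF (liftN M σ)) gs)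
  guarded-subst σ q gs = trans (alls-subst M σ _) (cong (alls M) (trans (seqFormula-subst σ' (gs ++ core q) (right q))
    (cong₂ (λ Γ Δ → seqFormula (Γ ⇒ Δ)) (trans (map-++ (substF σ') gs (core q)) (cong (map (substF σ') gs ++_) (map-fixed (core-below q) fixed)))
      (map-fixed (right-below q) fixed))))
    where
    σ' = liftN M σ
    fixed : ∀ a → a < M → σ' a ≡ var a
    fixed a lt = liftN-lt M σ a lt

  guarded-intro : ∀ {Γ} q gs → Prov ((gs ++ core q) ++ ↑ M Γ ⇒ right q) → Γ ⊩ guarded q gs
  guarded-intro q gs d = allsI M (seqFormulaI d)

  guarded-map : ∀ {Γ} q gs gs' → Γ ⊩ guarded q gs → All (((gs' ++ core q) ++ ↑ M Γ) ⊩_) gs → Γ ⊩ guarded q gs'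
  guarded-map {Γ} q gs gs' d ds = guarded-intro q gs' (seqFormulaE (weakenL (xs⊆ys++xs (↑ M Γ) (gs' ++ core q)) (allsE-self M (substP (up M) d)))
    (All.++⁺ ds (All.tabulate λ m → hyp (∈-++⁺ˡ (∈-++⁺ʳ gs' m))))
    (All.tabulate λ m → weaken (∷-lub (here refl) []⊆) (∷-lub m []⊆) (hyp (here refl))))

  guarded-use : ∀ {Γ Δ} q gs s → Γ ⊩ guarded q gs → All (Γ ⊩_) (map (substF (inst M s)) gs) →
    All (Γ ⊩_) (map (substF s) (core q)) → map (substF s) (right q) ⊆ Δ → Prov (Γ ⇒ Δ)
  guarded-use {Γ} {Δ} q gs s d ds cs incl = seqFormulaE
    (cast (seqFormula-subst (inst M s) (gs ++ core q) (right q)) (allsE M s d))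
    (subst (All (Γ ⊩_)) (sym (trans (map-++ (substF (inst M s)) gs (core q)) (cong (map (substF (inst M s)) gs ++_) (map-agree (core-below q) agree))))
      (All.++⁺ ds cs))
    (subst (All (λ δ → Prov (δ ∷ Γ ⇒ Δ))) (sym (map-agree (right-below q) agree))
      (All.tabulate λ m → weaken (∷-lub (here refl) []⊆) (∷-lub (incl m) []⊆) (hyp (here refl))))
    where
    agree : ∀ a → a < M → inst M s a ≡ s a
    agree a lt = inst-lt M s lt

  ↑ᵗ : Term → Term
  ↑ᵗ = substT (up M)

  -- Lexicographic descent at slot `p`: older slots agree with `e`, slot `p` is below `t`, younger
  -- slots are arbitrary.
  guards : ℕ → (ℕ → Term) → Term → List Formula
  guards p e t = map (λ j → c j ≐ e j) (upTo p) ++ (c p ≺ t) ∷ []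

  ∈-guards₁ : ∀ {p e t j} → j < p → (c j ≐ e j) ∈ guards p e t
  ∈-guards₁ {p} {e} lt = ∈-++⁺ˡ (∈-map⁺ (λ j → c j ≐ e j) (∈-upTo⁺ lt))

  ∈-guards₂ : ∀ {p e t} → (c p ≺ t) ∈ guards p e t
  ∈-guards₂ {p} {e} = ∈-++⁺ʳ (map (λ j → c j ≐ e j) (upTo p)) (here refl)

  All-guards : ∀ {Γ p e t} → (∀ j → j < p → Γ ⊩ c j ≐ e j) → Γ ⊩ c p ≺ t → All (Γ ⊩_) (guards p e t)
  All-guards {p = p} f g = All.++⁺ (All.map⁺ (All.tabulate λ {j} m → f j (∈-upTo⁻ m))) (g ∷ [])

  guards-subst : ∀ σ p e t → (∀ j → j ≤ p → σ (B + j) ≡ c j) →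
    map (substF σ) (guards p e t) ≡ guards p (substT σ ∘ e) (substT σ t)
  guards-subst σ p e t h = trans (map-++ (substF σ) (map (λ j → c j ≐ e j) (upTo p)) _) (cong₂ _++_
    (trans (sym (map-∘ (upTo p))) (map-cong-local (All.tabulate λ {j} m → cong (_≐ substT σ (e j)) (h j (<⇒≤ (∈-upTo⁻ m))))))
    (cong (λ u → (u ≺ substT σ t) ∷ []) (h p ≤-refl)))

  hypothesis : ℕ → State → (ℕ → Term) → Term → Formula
  hypothesis p q e t = guarded q (guards p (↑ᵗ ∘ e) (↑ᵗ t))

  lift-↑ᵗ : ∀ σ t → substT (liftN M σ) (↑ᵗ t) ≡ ↑ᵗ (substT σ t)
  lift-↑ᵗ σ t = trans (substT-comp _ _ t) (trans (substT-cong t λ a _ → liftN-ge M σ a) (sym (substT-comp _ _ t)))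

  guards-cong : ∀ p {e e' t t'} → (∀ j → e j ≡ e' j) → t ≡ t' → guards p e t ≡ guards p e' t'
  guards-cong p h refl = cong (_++ _) (map-cong (λ j → cong (c j ≐_) (h j)) (upTo p))

  hypothesis-subst : ∀ σ p q e t → p ≤ K → substF σ (hypothesis p q e t) ≡ hypothesis p q (substT σ ∘ e) (substT σ t)
  hypothesis-subst σ p q e t le = trans (guarded-subst σ q (guards p (↑ᵗ ∘ e) (↑ᵗ t))) (cong (guarded q)
    (trans (guards-subst (liftN M σ) p (↑ᵗ ∘ e) (↑ᵗ t) λ j j≤p → liftN-lt M σ (B + j) (B+<M (≤-trans j≤p le)))
      (guards-cong p (λ j → lift-↑ᵗ σ (e j)) (lift-↑ᵗ σ t))))

  private
    shifted : ∀ {Γ φ} Ξ → Γ ⊩ φ → Ξ ++ ↑ M Γ ⊩ substF (up M) φ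
    shifted {Γ} Ξ d = weakenL (xs⊆ys++xs (↑ M Γ) Ξ) (substP (up M) d)

  -- Equal values in the older slots and a bound no larger at `p` only narrow the range over which
  -- the hypothesis speaks.
  hypothesis-mono : ∀ {Γ} p q e t e' t' → Γ ⊩ hypothesis p q e t → (∀ j → j < p → Γ ⊩ e' j ≐ e j) → Γ ⊩ t' ≺ S t →
    Γ ⊩ hypothesis p q e' t'
  hypothesis-mono p q e t e' t' d f g = guarded-map q (guards p (↑ᵗ ∘ e) (↑ᵗ t)) gs' d (All-guards
    (λ j lt → ≐-trans (hyp (∈-++⁺ˡ (∈-++⁺ˡ (∈-guards₁ lt)))) (shifted (gs' ++ core q) (f j lt)))
    (≺-≤-trans (hyp (∈-++⁺ˡ (∈-++⁺ˡ (∈-guards₂ {p})))) (shifted (gs' ++ core q) g)))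
    where gs' = guards p (↑ᵗ ∘ e') (↑ᵗ t')

  hypOf : ℕ × State → Formula
  hypOf (p , q) = hypothesis p q c (c p)

  Hyps : List (ℕ × State) → List Formula
  Hyps = map hypOf

  Goal : State → List (ℕ × State) → Set
  Goal q V = Prov (Hyps V ++ core q ⇒ right q)

  private
    dualOr-SigEq : ∀ L → All (SigEq (suc n) ∘ dual) L → SigEq (suc n) (dual (bigOr L))
    dualOr-SigEq [] [] = _ , Bounded⇒Sig (suc n) (b≐ _ _) , ⊣⊢-refl
    dualOr-SigEq (φ ∷ L) (s ∷ ss) = SigEq-∧ (suc n) s (dualOr-SigEq L ss)

    atom-bounded : ∀ a t x → Bounded (atom a t x)
    atom-bounded a t x with anyAbove x a
    ... | true = b≺ _ _
    ... | false = b≺ _ _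

    -- The dual is an existential block over a conjunction. Guards and slot bounds are bounded,
    -- antecedents are `Sig n`, duals of succedents are `Pi n`; all of these lie in `Sig (suc n)`,
    -- as `piInd` requires.
    guarded-SigEq : ∀ q gs → All Bounded gs → SigEq (suc n) (dual (guarded q gs))
    guarded-SigEq q gs bs = subst (SigEq (suc n)) (sym (dual-alls M _)) (SigEq-exs M (dualOr-SigEq _
      (All.++⁺ (All.map⁺ (All.map (λ {φ} s → φ' φ s) (All.++⁺ (All.map (Bounded⇒Sig (suc n)) bs) (All.++⁺ invs antes)))) succs)))
      where
      φ' : ∀ φ → Sig (suc n) φ → SigEq (suc n) (dual (dual φ))
      φ' φ s = subst (SigEq (suc n)) (sym (dual-dual φ)) (φ , s , ⊣⊢-refl)
      invs : All (Sig (suc n)) (inv (node q) (conf q))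
      invs = All.tabulate λ m → bounded (∈-inv⁻ m)
        where
        bounded : ∀ {φ} → ∃ (λ i → ∃ λ x → Occ (node q) (tm i) × lookup (conf q) i ∋ x × φ ≡ atom (lookup (conf q) i) (tm i) x) → Sig (suc n) φ
        bounded (i , x , _ , _ , refl) = Bounded⇒Sig (suc n) (atom-bounded (lookup (conf q) i) (tm i) x)
      antes : All (Sig (suc n)) (ante (seqAt (node q)))
      antes = All.tabulate λ m → Sig-suc n (All.lookup (onlySig (node q)) (ante∈ (seqAt (node q)) m))
      succs : All (SigEq (suc n) ∘ dual) (right q)
      succs = All.tabulate λ m → _ , (0 , _ , refl , Sig-dual n (All.lookup (onlySig (node q)) (succ∈ (seqAt (node q)) m))) , ⊣⊢-refl

  module _ (p : ℕ) (p≤K : p ≤ K) (q : State) (V : List (ℕ × State)) (levels : All (λ h → proj₁ h ≤ p) V) where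
    private
      -- Strong induction on the number in slot p; the bound r is the value of slot p at the start.
      gsΞ : (ℕ → Term) → Term → Term → List Formula
      gsΞ e r b = (c p ≺ S (↑ᵗ r)) ∷ guards p (↑ᵗ ∘ e) (↑ᵗ b)

      Ξ : (ℕ → Term) → Term → Term → Formula
      Ξ e r b = guarded q (gsΞ e r b)

      Ξ-subst : ∀ σ e r b {e' r' b'} → (∀ j → substT σ (e j) ≡ e' j) → substT σ r ≡ r' → substT σ b ≡ b' →
        substF σ (Ξ e r b) ≡ Ξ e' r' b'
      Ξ-subst σ e r b he refl refl = trans (guarded-subst σ q (gsΞ e r b)) (cong (guarded q) (cong₂ _∷_
        (cong₂ _≺_ (fixed p ≤-refl) (cong S (lift-↑ᵗ σ r)))
        (trans (guards-subst (liftN M σ) p (↑ᵗ ∘ e) (↑ᵗ b) fixed)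
          (guards-cong p (λ j → trans (lift-↑ᵗ σ (e j)) (cong ↑ᵗ (he j))) (lift-↑ᵗ σ b)))))
        where
        fixed : ∀ j → j ≤ p → liftN M σ (B + j) ≡ c j
        fixed j le = liftN-lt M σ (B + j) (B+<M (≤-trans le p≤K))

      ĉ : ℕ → Term
      ĉ j = wk (c j)

      ξ : Formula
      ξ = Ξ ĉ (ĉ p) x0

      ξ-at : ∀ t → ξ [ t ]₀ ≡ Ξ c (c p) t
      ξ-at t = Ξ-subst (single t) ĉ (ĉ p) x0 (λ j → refl) refl refl

      gsΞ-bounded : ∀ e r b → All Bounded (gsΞ e r b)
      gsΞ-bounded e r b = b≺ _ _ ∷ All.++⁺ (All.map⁺ (All.universal (λ j → b≐ _ _) (upTo p))) (b≺ _ _ ∷ [])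

      base : Hyps V ⊩ ξ [ 𝟎 ]₀
      base = cast (sym (ξ-at 𝟎)) (guarded-intro q (gsΞ c (c p) 𝟎) (⊀0 (hyp (∈-++⁺ˡ (∈-++⁺ˡ (there (∈-guards₂ {p})))))))

      module Step (premise : Goal q ((p , q) ∷ V)) where
        Φ gs Θ : List Formula
        Φ = ξ ∷ ↑ 1 (Hyps V)
        gs = gsΞ ĉ (ĉ p) (S x0)
        Θ = (gs ++ core q) ++ ↑ M Φ

        d : ℕ → Term
        d j = ↑ᵗ (ĉ j)

        below-d : Θ ⊩ c p ≺ S (d p)
        below-d = hyp (here refl)

        same-d : ∀ j → j < p → Θ ⊩ c j ≐ d j
        same-d j lt = hyp (∈-++⁺ˡ (∈-++⁺ˡ (there (∈-guards₁ lt))))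

        below-b : Θ ⊩ c p ≺ S (↑ᵗ x0)
        below-b = hyp (∈-++⁺ˡ (∈-++⁺ˡ (there (∈-guards₂ {p}))))

        ξ' : Θ ⊩ Ξ d (d p) (↑ᵗ x0)
        ξ' = cast (Ξ-subst (up M) ĉ (ĉ p) x0 (λ j → refl) refl refl) (hyp (∈-++⁺ʳ (gs ++ core q) (here refl)))

        own : Θ ⊩ hypothesis p q c (c p)
        -- The current number of slot `p` is at most `x0`, so anything below it is below `x0` and
        -- falls under the induction hypothesis.
        own = guarded-map q (gsΞ d (d p) (↑ᵗ x0)) gs' ξ'
          (≺-S-mono (≺-≤-trans last (shifted (gs' ++ core q) below-d))
          ∷ All-guards (λ j lt → ≐-trans (hyp (∈-++⁺ˡ (∈-++⁺ˡ (∈-guards₁ lt)))) (shifted (gs' ++ core q) (same-d j lt)))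
                       (≺-≤-trans last (shifted (gs' ++ core q) below-b)))
          where
          gs' = guards p (↑ᵗ ∘ c) (↑ᵗ (c p))
          last : (gs' ++ core q) ++ ↑ M Θ ⊩ c p ≺ ↑ᵗ (c p)
          last = hyp (∈-++⁺ˡ (∈-++⁺ˡ (∈-guards₂ {p})))

        others : All (Θ ⊩_) (Hyps V)
        others = All.map⁺ (All.tabulate λ m → other _ _ m (All.lookup levels m))
          where
          other : ∀ p' q' → (p' , q') ∈ V → p' ≤ p → Θ ⊩ hypothesis p' q' c (c p')
          other p' q' m le = hypothesis-mono p' q' d (d p') c (c p')
            (cast (trans (cong (substF (up M)) (hypothesis-subst (up 1) p' q' c (c p') (≤-trans le p≤K)))
                         (hypothesis-subst (up M) p' q' ĉ (ĉ p') (≤-trans le p≤K)))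
              (hyp (∈-++⁺ʳ (gs ++ core q) (there (∈-map⁺ (substF (up M)) (∈-map⁺ (substF (up 1)) (∈-map⁺ hypOf m)))))))
            (λ j lt → same-d j (<-≤-trans lt le)) (bound (m≤n⇒m<n∨m≡n le))
            where
            -- Other hypotheses at level `p` hold below the starting number only; the guard that
            -- keeps slot `p` at or below that number makes them usable here.
            bound : p' < p ⊎ p' ≡ p → Θ ⊩ c p' ≺ S (d p')
            bound (inj₁ lt) = ≺-rewʳ (S-cong (same-d p' lt)) (≺-S (c p'))
            bound (inj₂ refl) = below-d

        step-ξ : Φ ⊩ substF sucSub ξ
        step-ξ = cast (sym (Ξ-subst sucSub ĉ (ĉ p) x0 (λ j → refl) refl refl)) (guarded-intro q gs
          (have own (haves (Hyps V) (All.map (weakenL there) others) (weakenL incl premise))))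
          where
          incl : hypothesis p q c (c p) ∷ Hyps V ++ core q ⊆ Hyps V ++ hypothesis p q c (c p) ∷ Θ
          incl = ∷-lub (∈-++⁺ʳ (Hyps V) (here refl)) (∪-lub (Hyps V) ∈-++⁺ˡ (λ m → ∈-++⁺ʳ (Hyps V) (there (∈-++⁺ˡ (∈-++⁺ʳ gs m)))))

    Goal-induct : Goal q ((p , q) ∷ V) → Goal q V
    Goal-induct premise = guarded-use q gs var (weakenL ∈-++⁺ˡ (cast (ξ-at (S (c p)))
        (piInd ξ (S (c p)) (guarded-SigEq q (gsΞ ĉ (ĉ p) x0) (gsΞ-bounded _ _ _)) base (Step.step-ξ premise))))
      (subst (All (_ ⊩_)) (sym (cong₂ _∷_
          (cong₂ _≺_ (inst-lt M var (B+<M p≤K)) (cong S (inst-up M var (c p))))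
          (trans (guards-subst (inst M var) p (↑ᵗ ∘ c) (↑ᵗ (S (c p))) λ j le → inst-lt M var (B+<M (≤-trans le p≤K)))
            (guards-cong p (λ j → inst-up M var (c j)) (inst-up M var (S (c p)))))))
        (≺-S (c p) ∷ All-guards (λ j lt → ≐-refl (c j)) (≺-S (c p))))
      (subst (All (_ ⊩_)) (sym (map-fixed (core-below q) λ _ _ → refl)) (All.tabulate λ m → hyp (∈-++⁺ʳ (Hyps V) m)))
      (subst (_⊆ right q) (sym (map-fixed (right-below q) λ _ _ → refl)) same)
      where gs = gsΞ c (c p) (S (c p))

  -- Bounds are recorded only for terms occurring at the node, so a decrement finds its strict bound
  -- only if every slot sits on such a term.
  Good : State → Set
  Good q = ∀ i y → lookup (conf q) i ∋ y → Occ (node q) (tm i)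

  Der : State → List (ℕ × State) → Set
  Der q V = Good q → Goal q V

  -- Moving a goal along an assignment of terms to the slots

  assign : Subst → (ℕ → Term) → Subst
  assign = glue B

  assign-c : ∀ ρ slots x → substT (assign ρ slots) (c x) ≡ slots x
  assign-c ρ slots x = glue-ge B ρ slots x

  assign-term : ∀ ρ slots {v t} → Occ v t → substT (assign ρ slots) t ≡ substT ρ t
  assign-term ρ slots {t = t} o = substT-cong t λ a f → glue-lt B ρ slots (occ<B o f)

  assign-map : ∀ ρ slots {Γ} → Below B Γ → map (substF (assign ρ slots)) Γ ≡ map (substF ρ) Γ
  assign-map ρ slots b = map-agree b λ a lt → glue-lt B ρ slots lt

  -- Common to deletions, resets and inferences: the goal at the target is instantiated with the new
  -- slot numbers written as terms over the current ones, and its hypotheses and bounds are cut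
  -- against the current context.
  move : ∀ {Θ Δ} q V ρ slots → Goal q V → All (Θ ⊩_) (map (substF (assign ρ slots)) (Hyps V)) →
    All (Θ ⊩_) (map (substF (assign ρ slots)) (inv (node q) (conf q))) →
    map (substF ρ) (ante (seqAt (node q))) ⊆ Θ → map (substF ρ) (right q) ⊆ Δ → Prov (Θ ⇒ Δ)
  move {Θ} q V ρ slots g hs is as rs = haves (H ++ I ++ map (substF ρ) Γ) (All.++⁺ hs (All.++⁺ is (All.tabulate λ m → hyp (as m))))
    (weaken (λ m → ∈-++⁺ˡ m) rs
      (subst₂ (λ Γ Δ → Prov (Γ ⇒ Δ))
        (trans (map-++ (substF σ) (Hyps V) (core q)) (cong (H ++_) (trans (map-++ (substF σ) (inv (node q) (conf q)) Γ)
          (cong (I ++_) (assign-map ρ slots (ante-below (node q)))))))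
        (assign-map ρ slots (succ-below (node q))) (substP σ g)))
    where
    σ = assign ρ slots
    Γ = ante (seqAt (node q))
    H = map (substF σ) (Hyps V)
    I = map (substF σ) (inv (node q) (conf q))

  move-hyps : ∀ {Θ} V ρ slots (e : ℕ → Term) → (∀ p q → (p , q) ∈ V → p ≤ K × Θ ⊩ hypothesis p q e (e p)) →
    (∀ p q → (p , q) ∈ V → (∀ j → j < p → Θ ⊩ slots j ≐ e j) × Θ ⊩ slots p ≺ S (e p)) →
    All (Θ ⊩_) (map (substF (assign ρ slots)) (Hyps V))
  move-hyps {Θ} V ρ slots e hs es = All.map⁺ (All.map⁺ (All.tabulate λ m → one _ _ m))
    where
    σ = assign ρ slots
    one : ∀ p q → (p , q) ∈ V → Θ ⊩ substF σ (hypOf (p , q))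
    one p q m = cast (sym (hypothesis-subst σ p q c (c p) (proj₁ (hs p q m))))
      (hypothesis-mono p q e (e p) (substT σ ∘ c) (substT σ (c p)) (proj₂ (hs p q m))
        (λ j lt → cast (cong (_≐ e j) (sym (assign-c ρ slots j))) (proj₁ (es p q m) j lt))
        (cast (cong (_≺ S (e p)) (sym (assign-c ρ slots p))) (proj₂ (es p q m))))

  move-inv : ∀ {Θ} v A ρ slots → (∀ i y → Occ v (tm i) → lookup A i ∋ y →
      (Θ ⊩ substT ρ (tm i) ≺ S (slots y)) × (anyAbove y (lookup A i) ≡ true → Θ ⊩ substT ρ (tm i) ≺ slots y)) →
    All (Θ ⊩_) (map (substF (assign ρ slots)) (inv v A))
  move-inv {Θ} v A ρ slots f = All.map⁺ (All.tabulate λ m → one (∈-inv⁻ m))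
    where
    σ = assign ρ slots
    one : ∀ {φ} → ∃ (λ i → ∃ λ x → Occ v (tm i) × lookup A i ∋ x × φ ≡ atom (lookup A i) (tm i) x) → Θ ⊩ substF σ φ
    one (i , y , o , h , refl) with anyAbove y (lookup A i) | f i y o h
    ... | true | _ , g = cast (sym (cong₂ _≺_ (assign-term ρ slots o) (assign-c ρ slots y))) (g refl)
    ... | false | g , _ = cast (sym (cong₂ (λ t u → t ≺ S u) (assign-term ρ slots o) (assign-c ρ slots y))) g

  inv-strict : ∀ {Θ v A} i {x} → inv v A ⊆ Θ → Occ v (tm i) → lookup A i ∋ x → anyAbove x (lookup A i) ≡ true → Θ ⊩ tm i ≺ c x
  inv-strict {A = A} i {x} incl o h e = cast (cong (λ b → if b then tm i ≺ c x else tm i ≺ S (c x)) e) (hyp (incl (∈-inv⁺ i o h)))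

  inv-weak : ∀ {Θ v A} i {x} → inv v A ⊆ Θ → Occ v (tm i) → lookup A i ∋ x → Θ ⊩ tm i ≺ S (c x)
  inv-weak {A = A} i {x} incl o h with anyAbove x (lookup A i) in e
  ... | true = ≺-S-mono (inv-strict i incl o h e)
  ... | false = cast (cong (λ b → if b then tm i ≺ c x else tm i ≺ S (c x)) e) (hyp (incl (∈-inv⁺ i o h)))

  private
    context : State → List (ℕ × State) → List Formula
    context q V = Hyps V ++ core q

    inv⊆ : ∀ q V → inv (node q) (conf q) ⊆ context q V
    inv⊆ q V m = ∈-++⁺ʳ (Hyps V) (∈-++⁺ˡ m)

    ante⊆ : ∀ q V → ante (seqAt (node q)) ⊆ context q V
    ante⊆ q V m = ∈-++⁺ʳ (Hyps V) (∈-++⁺ʳ (inv (node q) (conf q)) m)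

    ids : ∀ Γ → map (substF var) Γ ≡ Γ
    ids Γ = trans (map-cong substF-id Γ) (map-id Γ)

  module Delete (v : Fin size) (A : Config) (k : Fin (K + K)) (¬used : ¬ Used A (toℕ k)) where
    private
      x = toℕ k
      A' = Vec.map (remove x) A
      q = ⟨ v , A , Fin.suc k ⟩
      q' = ⟨ v , A' , Fin.inject₁ k ⟩

      slots : ℕ → Term
      slots y with y <? x
      ... | yes _ = c y
      ... | no _ = c (suc y)

      slots-< : ∀ {y} → y < x → slots y ≡ c y
      slots-< {y} lt with y <? x
      ... | yes _ = refl
      ... | no ¬lt = ⊥-elim (¬lt lt)

      slots-≥ : ∀ {y} → x ≤ y → slots y ≡ c (suc y)
      slots-≥ {y} le with y <? x
      ... | yes lt = ⊥-elim (<⇒≱ lt le)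
      ... | no _ = refl

      bits' : ∀ i {y} → lookup A' i ∋ y → (y < x × lookup A i ∋ y) ⊎ (x ≤ y × lookup A i ∋ suc y)
      bits' i {y} h = remove-∋ x (lookup A i) (subst (_∋ y) (lookup-map i (remove x) A) h)

      above : ∀ i y → anyAbove y (lookup A' i) ≡ true → (y < x → anyAbove y (lookup A i) ≡ true) × (x ≤ y → anyAbove (suc y) (lookup A i) ≡ true)
      above i y e with z , y<z , h ← anyAbove-sound y (lookup A' i) e with bits' i h
      ... | inj₁ (z<x , h') = (λ _ → anyAbove-complete y (lookup A i) y<z h') , λ x≤y → ⊥-elim (<⇒≱ (<-trans y<z z<x) x≤y)
      ... | inj₂ (_ , h') = (λ _ → anyAbove-complete y (lookup A i) (m<n⇒m<1+n y<z) h') , λ _ → anyAbove-complete (suc y) (lookup A i) (s≤s y<z) h'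

    good' : Good q → Good q'
    good' g i y h with bits' i h
    ... | inj₁ (_ , h') = g i y h'
    ... | inj₂ (_ , h') = g i (suc y) h'

    step-delete : ∀ {V V'} → V' ⊆ V → All (λ h → proj₁ h ≤ K) V → All (λ h → proj₁ h < x) V' → Goal q' V' → Goal q V
    step-delete {V} {V'} V'⊆V levels small g = move q' V' var slots g
      (move-hyps V' var slots c (λ p r m → All.lookup levels (V'⊆V m) , hyp (∈-++⁺ˡ (∈-map⁺ hypOf (V'⊆V m))))
        λ p r m → (λ j lt → cast (cong (_≐ c j) (sym (slots-< (<-trans lt (All.lookup small m))))) (≐-refl (c j))) ,
                  cast (cong (_≺ S (c p)) (sym (slots-< (All.lookup small m)))) (≺-S (c p)))
      (move-inv v A' var slots λ i y o h → invariant i y o (bits' i h) (above i y))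
      (λ m → ante⊆ q V (subst (_ ∈_) (ids _) m))
      (λ m → subst (_ ∈_) (ids _) m)
      where
      Θ = context q V
      invariant : ∀ i y → Occ v (tm i) → (y < x × lookup A i ∋ y) ⊎ (x ≤ y × lookup A i ∋ suc y) →
        (anyAbove y (lookup A' i) ≡ true → (y < x → anyAbove y (lookup A i) ≡ true) × (x ≤ y → anyAbove (suc y) (lookup A i) ≡ true)) →
        (Θ ⊩ substT var (tm i) ≺ S (slots y)) × (anyAbove y (lookup A' i) ≡ true → Θ ⊩ substT var (tm i) ≺ slots y)
      invariant i y o (inj₁ (lt , h)) ab =
        cast (sym (cong₂ (λ t u → t ≺ S u) (substT-id (tm i)) (slots-< lt))) (inv-weak i (inv⊆ q V) o h) ,
        λ e → cast (sym (cong₂ _≺_ (substT-id (tm i)) (slots-< lt))) (inv-strict i (inv⊆ q V) o h (proj₁ (ab e) lt))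
      invariant i y o (inj₂ (le , h)) ab =
        cast (sym (cong₂ (λ t u → t ≺ S u) (substT-id (tm i)) (slots-≥ le))) (inv-weak i (inv⊆ q V) o h) ,
        λ e → cast (sym (cong₂ _≺_ (substT-id (tm i)) (slots-≥ le))) (inv-strict i (inv⊆ q V) o h (proj₂ (ab e) le))

  module Reset (v : Fin size) (A : Config) (k : Fin (K + K)) (x : ℕ) (x≤K : x ≤ K) (used : Used A x) (¬own : ¬ Own A x) where
    private
      A' = Vec.map (resetAt x) A
      q = ⟨ v , A , Fin.suc k ⟩
      q' = ⟨ v , A' , Fin.inject₁ k ⟩

      above-x : ∀ i → lookup A i ∋ x → anyAbove x (lookup A i) ≡ true
      above-x i h with anyAbove x (lookup A i) in e
      ... | true = refl
      ... | false = ⊥-elim (¬own (i , h , e))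

      bits' : ∀ i {y} → lookup A' i ∋ y → lookup A i ∋ y
      bits' i {y} h = resetAt-∋ x (lookup A i) (subst (_∋ y) (lookup-map i (resetAt x) A) h)

      above' : ∀ i y → anyAbove y (lookup A' i) ≡ true → anyAbove y (lookup A i) ≡ true
      above' i y e with z , y<z , h ← anyAbove-sound y (lookup A' i) e = anyAbove-complete y (lookup A i) y<z (bits' i h)

      cut-x : ∀ i → lookup A' i ∋ x → anyAbove x (lookup A' i) ≢ true
      cut-x i h e with z , x<z , h' ← anyAbove-sound x (lookup A' i) e =
        <⇒≱ x<z (proj₂ (cutAbove-∋ x (lookup A i) (subst (_∋ z) (trans (lookup-map i (resetAt x) A) (resetAt-yes x (lookup A i) (bits' i h))) h')))

    good' : Good q → Good q'
    good' g i y h = g i y (bits' i h)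

    module _ (good : Good q) (V : List (ℕ × State)) (levels : All (λ h → proj₁ h ≤ K) V) where
      private
        i₀ = proj₁ used
        Θ = context q V

        -- The slot holds t₀ + S z for the witness z of t₀ < c x, so its predecessor is t₀ + z.
        pre : Term
        pre = wk (tm i₀) ⊕ x0

        eqn : Formula
        eqn = wk (tm i₀) ⊕ S x0 ≐ wk (c x)

        Θ' : List Formula
        Θ' = eqn ∷ ↑ 1 Θ

        S-pre : Θ' ⊩ wk (c x) ≐ S pre
        S-pre = ≐-trans (≐-sym (hyp (here refl))) (⊕-suc (wk (tm i₀)) x0)

        slots : ℕ → Term
        slots y with y ≟ x
        ... | yes _ = pre
        ... | no _ = wk (c y)

        slots-≡ : slots x ≡ pre
        slots-≡ with x ≟ x
        ... | yes _ = refl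
        ... | no ¬e = ⊥-elim (¬e refl)

        slots-≢ : ∀ {y} → y ≢ x → slots y ≡ wk (c y)
        slots-≢ {y} ne with y ≟ x
        ... | yes e = ⊥-elim (ne e)
        ... | no _ = refl

        shift : ∀ {φ} → Θ ⊩ φ → Θ' ⊩ substF (up 1) φ
        shift d = weakenL there (substP (up 1) d)

        invs : All (Θ' ⊩_) (map (substF (assign (up 1) slots)) (inv v A'))
        invs = move-inv v A' (up 1) slots λ i y o h → invariant i y o h (y ≟ x)
          where
          invariant : ∀ i y → Occ v (tm i) → lookup A' i ∋ y → Dec (y ≡ x) →
            (Θ' ⊩ wk (tm i) ≺ S (slots y)) × (anyAbove y (lookup A' i) ≡ true → Θ' ⊩ wk (tm i) ≺ slots y)
          invariant i y o h (yes refl) =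
            cast (cong (λ u → wk (tm i) ≺ S u) (sym slots-≡))
              (≺-rewʳ S-pre (shift (inv-strict i (inv⊆ q V) o (bits' i h) (above-x i (bits' i h))))) ,
            λ e → ⊥-elim (cut-x i h e)
          invariant i y o h (no ne) =
            cast (cong (λ u → wk (tm i) ≺ S u) (sym (slots-≢ ne))) (shift (inv-weak i (inv⊆ q V) o (bits' i h))) ,
            λ e → cast (cong (wk (tm i) ≺_) (sym (slots-≢ ne))) (shift (inv-strict i (inv⊆ q V) o (bits' i h) (above' i y e)))

        hyps : ∀ p r → (p , r) ∈ V → Θ' ⊩ hypothesis p r (wk ∘ c) (wk (c p))
        hyps p r m = cast (hypothesis-subst (up 1) p r c (c p) (All.lookup levels m)) (shift (hyp (∈-++⁺ˡ (∈-map⁺ hypOf m))))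

        pre≺ : Θ' ⊩ pre ≺ wk (c x)
        pre≺ = ≺-rewʳ (≐-sym S-pre) (≺-S pre)

        open-slot : Prov (Θ' ⇒ ↑ 1 (right q)) → Goal q V
        open-slot d = ∃E (≺-elim (inv-strict i₀ (inv⊆ q V) (good i₀ x (proj₂ used)) (proj₂ used) (above-x i₀ (proj₂ used)))) d

        antes⊆ : ↑ 1 (ante (seqAt v)) ⊆ Θ'
        antes⊆ m = there (map⁺ (substF (up 1)) (ante⊆ q V) m)

      -- Older slots are untouched, and a hypothesis at level `x` only needs slot `x` not to grow,
      -- so all levels up to `x` are preserved.
      step-reset : ∀ {V'} → V' ⊆ V → All (λ h → proj₁ h ≤ x) V' → Goal q' V' → Goal q V
      step-reset {V'} V'⊆V small g = open-slot (move q' V' (up 1) slots g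
        (move-hyps V' (up 1) slots (wk ∘ c) (λ p r m → All.lookup levels (V'⊆V m) , hyps p r (V'⊆V m))
          λ p r m → (λ j lt → cast (cong (_≐ wk (c j)) (sym (slots-≢ (<⇒≢ (<-≤-trans lt (All.lookup small m)))))) (≐-refl (wk (c j)))) ,
                    last p (m≤n⇒m<n∨m≡n (All.lookup small m)))
        invs antes⊆ (λ m → m))
        where
        last : ∀ p → p < x ⊎ p ≡ x → Θ' ⊩ slots p ≺ S (wk (c p))
        last p (inj₁ lt) = cast (cong (_≺ S (wk (c p))) (sym (slots-≢ (<⇒≢ lt)))) (≺-S (wk (c p)))
        last p (inj₂ refl) = cast (cong (_≺ S (wk (c p))) (sym slots-≡)) (≺-S-mono pre≺)

      -- Here a cycle closes: the number in slot `x` has strictly decreased, so the hypothesis for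
      -- `q'` applies and nothing is left to unfold.
      step-hypothesis : (x , q') ∈ V → Goal q V
      step-hypothesis m = open-slot (guarded-use q' (guards x (↑ᵗ ∘ wk ∘ c) (↑ᵗ (wk (c x)))) σ (hyps x q' m)
        (subst (All (Θ' ⊩_)) (sym (map-guards)) (All.++⁺ (All.map⁺ (All.tabulate λ {j} j∈ →
            cast (cong (_≐ wk (c j)) (sym (slots-≢ (<⇒≢ (∈-upTo⁻ j∈))))) (≐-refl (wk (c j)))))
          (cast (cong (_≺ wk (c x)) (sym slots-≡)) pre≺ ∷ [])))
        (subst (All (Θ' ⊩_)) (sym (map-++ (substF σ) (inv v A') (ante (seqAt v)))) (All.++⁺ invs
          (subst (All (Θ' ⊩_)) (sym (assign-map (up 1) slots (ante-below v))) (All.tabulate λ m → hyp (antes⊆ m)))))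
        (λ m → subst (_ ∈_) (assign-map (up 1) slots (succ-below v)) m))
        where
        σ = assign (up 1) slots
        τ = inst M σ
        at-slot : ∀ j → j ≤ K → τ (B + j) ≡ slots j
        at-slot j le = trans (inst-lt M σ (B+<M le)) (assign-c (up 1) slots j)
        map-guards : map (substF τ) (guards x (↑ᵗ ∘ wk ∘ c) (↑ᵗ (wk (c x)))) ≡
                     map (λ j → slots j ≐ wk (c j)) (upTo x) ++ (slots x ≺ wk (c x)) ∷ []
        map-guards = trans (map-++ (substF τ) (map (λ j → c j ≐ ↑ᵗ (wk (c j))) (upTo x)) _) (cong₂ _++_
          (trans (sym (map-∘ (upTo x))) (map-cong-local (All.tabulate λ {j} m →
            cong₂ _≐_ (at-slot j (≤-trans (<⇒≤ (∈-upTo⁻ m)) x≤K)) (inst-up M σ (wk (c j))))))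
          (cong (_∷ []) (cong₂ _≺_ (at-slot x x≤K) (inst-up M σ (wk (c x))))))

  module Infer (v : Fin size) (A : Config) (V : List (ℕ × State)) (levels : All (λ h → proj₁ h ≤ K) V) where
    private
      q = ⟨ v , A , Fin.zero ⟩
      Θ = context q V

    successor : Fin size → State
    successor w = ⟨ w , stepConfig v w A , Fin.fromℕ (K + K) ⟩

    good' : ∀ w → Good (successor w)
    good' w j y h = fromSource (best-source v w A j) (subst (_∋ y) (lookup∘tabulate (best v w A) j) h)
      where
      fromSource : ∀ {a} → Source v w A j a → a ∋ y → Occ w (tm j)
      fromSource empty h = ⊥-elim (bit-zeros K y h)
      fromSource (stays i (_ , o , _)) h = o
      fromSource (falls i (_ , o , _)) h = o

    module _ (w : Fin size) (θ : Subst)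
             (precursor : ∀ t t' → Prec′ v t t' → Θ ++ map (substF θ) (ante (seqAt w)) ⊩ substT θ t' ≐ t) where
      private
        Θ₁ = Θ ++ map (substF θ) (ante (seqAt w))

        -- A slot opened at a term starts with the value of that term, the least admissible bound;
        -- `𝟎` fills the positions to which no term belongs.
        new : ℕ → Term
        new z with z <? N
        ... | yes lt = substT θ (tm (fromℕ< lt))
        ... | no _ = 𝟎

        slots : ℕ → Term
        slots = glue (suc N) c new

        slots-old : ∀ {y} → y < suc N → slots y ≡ c y
        slots-old = glue-lt (suc N) c new

        slots-new : ∀ j → slots (newSlot j) ≡ substT θ (tm j)
        slots-new j = trans (glue-ge (suc N) c new (toℕ j)) at
          where
          at : new (toℕ j) ≡ substT θ (tm j)
          at with toℕ j <? N
          ... | yes lt = cong (substT θ ∘ tm) (Fin.fromℕ<-toℕ j lt)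
          ... | no ¬lt = ⊥-elim (¬lt (Fin.toℕ<n j))

        incl : inv v A ⊆ Θ₁
        incl m = ∈-++⁺ˡ (inv⊆ q V m)

        above-keep : ∀ i y → anyAbove y (keep N (lookup A i)) ≡ true → anyAbove y (lookup A i) ≡ true
        above-keep i y e with z , y<z , h ← anyAbove-sound y (keep N (lookup A i)) e =
          anyAbove-complete y (lookup A i) y<z (proj₁ (keep-∋ N (lookup A i) h))

        Holds : Fin N → ℕ → Bits → Set
        Holds j y a = (Θ₁ ⊩ substT θ (tm j) ≺ S (slots y)) × (anyAbove y a ≡ true → Θ₁ ⊩ substT θ (tm j) ≺ slots y)

        -- A staying trace keeps its bounds because precursors have equal values. A falling one ends
        -- strictly below a term that met the old bounds, and gains the strictness that its new slot
        -- demands.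
        holds : ∀ j y {a} → Source v w A j a → a ∋ y → Holds j y a
        holds j y empty h = ⊥-elim (bit-zeros K y h)
        holds j y (stays i (o , _ , pr)) h with h' , y<N ← keep-∋ N (lookup A i) h =
          ≺-rewˡ (≐-sym (precursor _ _ pr)) (cast (cong (λ u → tm i ≺ S u) (sym (slots-old (m<n⇒m<1+n y<N)))) (inv-weak i incl o h')) ,
          λ e → ≺-rewˡ (≐-sym (precursor _ _ pr)) (cast (cong (tm i ≺_) (sym (slots-old (m<n⇒m<1+n y<N)))) (inv-strict i incl o h' (above-keep i y e)))
        holds j y (falls i (o , _ , t'' , pr , m)) h with set-∋ (newSlot j) (keep N (lookup A i)) h
        ... | inj₂ h' with h'' , y<N ← keep-∋ N (lookup A i) h' = ≺-S-mono strict , λ _ → strict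
          where
          strict : Θ₁ ⊩ substT θ (tm j) ≺ slots y
          strict = cast (cong (substT θ (tm j) ≺_) (sym (slots-old (m<n⇒m<1+n y<N))))
            (≺-≤-trans (hyp (∈-++⁺ʳ Θ (∈-map⁺ (substF θ) m))) (≺-rewˡ (≐-sym (precursor _ _ pr)) (inv-weak i incl o h'')))
        ... | inj₁ refl = cast (cong (λ u → substT θ (tm j) ≺ S u) (sym (slots-new j))) (≺-S (substT θ (tm j))) , λ e → ⊥-elim (topmost e)
          where
          topmost : anyAbove (newSlot j) (set (newSlot j) (keep N (lookup A i))) ≢ true
          topmost e with z , lt , h ← anyAbove-sound (newSlot j) (set (newSlot j) (keep N (lookup A i))) e
            with set-∋ (newSlot j) (keep N (lookup A i)) h
          ... | inj₁ refl = <-irrefl refl lt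
          ... | inj₂ h' = <-irrefl refl (<-trans (<-≤-trans (proj₂ (keep-∋ N (lookup A i) h')) (≤-trans (n≤1+n N) (m≤m+n (suc N) (toℕ j)))) lt)

      child : ∀ {V'} → V' ⊆ V → All (λ h → proj₁ h < suc N) V' → Goal (successor w) V' →
        Prov (Θ₁ ⇒ map (substF θ) (Defs.succ (seqAt w)))
      child {V'} V'⊆V small g = move (successor w) V' θ slots g
        (move-hyps V' θ slots c (λ p r m → All.lookup levels (V'⊆V m) , hyp (∈-++⁺ˡ (∈-++⁺ˡ (∈-map⁺ hypOf (V'⊆V m)))))
          λ p r m → (λ j lt → cast (cong (_≐ c j) (sym (slots-old (<-trans lt (All.lookup small m))))) (≐-refl (c j))) ,
                    cast (cong (_≺ S (c p)) (sym (slots-old (All.lookup small m)))) (≺-S (c p)))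
        (move-inv w (stepConfig v w A) θ slots λ j y o h →
          subst (Holds j y) (sym (lookup∘tabulate (best v w A) j))
            (holds j y (best-source v w A j) (subst (_∋ y) (lookup∘tabulate (best v w A) j) h)))
        (∈-++⁺ʳ Θ) (λ m → m)

    private
      -- Only slot variables are free in a hypothesis, and these start at `B`, beyond all
      -- eigenvariables.
      hypothesis-fresh : ∀ {a} → a < B → ∀ h → proj₁ h ≤ K → ¬ FreeF a (hypOf h)
      hypothesis-fresh {a} a<B (p , r) le f = absurd (bigOr-free _ (alls-free M f))
        where
        alls-free : ∀ m {a φ} → FreeF a (alls m φ) → FreeF (m + a) φ
        alls-free zero f = f
        alls-free (suc m) {a} {φ} f = subst (λ i → FreeF i φ) (+-suc m a) (alls-free m f)
        bigOr-free : ∀ L {a} → FreeF a (bigOr L) → ∃ λ φ → φ ∈ L × FreeF a φ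
        bigOr-free [] (inj₁ ())
        bigOr-free [] (inj₂ ())
        bigOr-free (φ ∷ L) (inj₁ f) = φ , here refl , f
        bigOr-free (φ ∷ L) (inj₂ f) with ψ , m , f' ← bigOr-free L f = ψ , there m , f'
        dual-free : ∀ φ {a} → FreeF a (dual φ) → FreeF a φ
        dual-free (t ≐ u) f = f
        dual-free (t ≠ u) f = f
        dual-free (t ≺ u) f = f
        dual-free (t ⊀ u) f = f
        dual-free (φ ∧ᶠ ψ) (inj₁ f) = inj₁ (dual-free φ f)
        dual-free (φ ∧ᶠ ψ) (inj₂ f) = inj₂ (dual-free ψ f)
        dual-free (φ ∨ᶠ ψ) (inj₁ f) = inj₁ (dual-free φ f)
        dual-free (φ ∨ᶠ ψ) (inj₂ f) = inj₂ (dual-free ψ f)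
        dual-free (∀ᶠ φ) f = dual-free φ f
        dual-free (∃ᶠ φ) f = dual-free φ f
        inner : ∀ {j} → j ≤ K → M + a ≢ B + j
        inner le e = <⇒≢ (<-≤-trans (B+<M le) (m≤m+n M a)) (sym e)
        outer : ∀ {j} → M + a ≢ M + (B + j)
        outer {j} e = <⇒≢ (<-≤-trans a<B (m≤m+n B j)) (+-cancelˡ-≡ M _ _ e)
        guard-fresh : ∀ {φ} → φ ∈ guards p (↑ᵗ ∘ c) (↑ᵗ (c p)) → ¬ FreeF (M + a) φ
        guard-fresh m f with ∈-++⁻ (map (λ j → c j ≐ ↑ᵗ (c j)) (upTo p)) m
        guard-fresh m (inj₁ e) | inj₂ (here refl) = inner le e
        guard-fresh m (inj₂ e) | inj₂ (here refl) = outer e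
        guard-fresh m f | inj₁ m' with ∈-map⁻ (λ j → c j ≐ ↑ᵗ (c j)) m'
        guard-fresh m (inj₁ e) | inj₁ m' | j , j∈ , refl = inner (≤-trans (<⇒≤ (∈-upTo⁻ j∈)) le) e
        guard-fresh m (inj₂ e) | inj₁ m' | j , j∈ , refl = outer e
        gs = guards p (↑ᵗ ∘ c) (↑ᵗ (c p))
        absurd : ¬ ∃ λ φ → φ ∈ map dual (gs ++ core r) ++ right r × FreeF (M + a) φ
        absurd (φ , m , f) with ∈-++⁻ (map dual (gs ++ core r)) m
        ... | inj₂ m' = m+n≮m M a (right-below r m' _ f)
        ... | inj₁ m' with ψ , m'' , refl ← ∈-map⁻ dual m' with ∈-++⁻ gs m''
        ... | inj₁ g = guard-fresh g (dual-free ψ f)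
        ... | inj₂ co = m+n≮m M a (core-below r co _ (dual-free ψ f))

      formulas⊆ : ∀ {s s'} → s ≈S s' → formulasOf s ⊆ formulasOf s'
      formulas⊆ {Γ ⇒ Δ} {Γ' ⇒ Δ'} ((f , _) , (g , _)) = ∪-lub Γ (λ m → ∈-++⁺ˡ (f m)) (λ m → ∈-++⁺ʳ Γ' (g m))

      -- The bounds mention only terms of the current sequent, so a variable fresh for the sequent
      -- is fresh for them.
      admissible : ∀ {c' ps} (r : CStep c' ps) → eigenBound r ≤ B → seqAt v ≈S c' → Admissible r Θ
      admissible {c'} r le eq a a< fresh = All.++⁺ (All.map⁺ (All.map (λ {h} → hypothesis-fresh a<B h) levels))
          (All.++⁺ (All.tabulate λ m → invs (∈-inv⁻ m)) (All.tabulate λ m → All.lookup fresh (formulas⊆ eq (ante∈ (seqAt v) m))))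
        where
        a<B = <-≤-trans a< le
        invs : ∀ {φ} → ∃ (λ i → ∃ λ x → Occ v (tm i) × lookup A i ∋ x × φ ≡ atom (lookup A i) (tm i) x) → ¬ FreeF a φ
        invs (i , x , (ψ , m , o) , _ , refl) f with atom-free (lookup A i) (tm i) x f
        ... | inj₁ f' = All.lookup fresh (formulas⊆ eq m) (occF-free ψ o f')
        ... | inj₂ refl = m+n≮m B x a<B

      premises : ∀ {ws ps} → Pointwise _≈S_ (map seqAt ws) ps → (∀ w → w ∈ ws → Prov (Θ +L seqAt w)) → All (Prov ∘ (Θ +L_)) ps
      premises {[]} [] f = []
      premises {w ∷ ws} {p ∷ ps} (eq ∷ eqs) f = one eq (f w (here refl)) ∷ premises eqs (λ w m → f w (there m))
        where
        one : ∀ {s s'} → s ≈S s' → Prov (Θ +L s) → Prov (Θ +L s')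
        one {Γ ⇒ Δ} {Γ' ⇒ Δ'} ((i , _) , (j , _)) d = weaken (++⁺ʳ Θ i) j d

      conclude : ∀ {s} → seqAt v ≈S s → Prov (Θ +L s) → Goal q V
      conclude {Γ ⇒ Δ} eq d = go eq refl d
        where
        go : ∀ {s} → s ≈S (Γ ⇒ Δ) → s ≡ seqAt v → Prov (Θ ++ Γ ⇒ Δ) → Goal q V
        go {Γ' ⇒ Δ'} ((_ , i) , (_ , j)) e d = weaken (∪-lub Θ same (λ m → ante⊆ q V (subst (λ s → _ ∈ ante s) e (i m))))
          (λ m → subst (λ s → _ ∈ Defs.succ s) e (j m)) d

    private
      Child : Fin size → Set
      Child w = Σ (List (ℕ × State)) λ V' → V' ⊆ V × All (λ h → proj₁ h < suc N) V' × Goal (successor w) V'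

      Step : LabelledStep → Set
      Step s = seqAt v ≈S LabelledStep.concl s × Pointwise _≈S_ (map seqAt (kids v)) (LabelledStep.premises s)

      precBy : ∀ {s} → stepAt v ≡ s → ∀ {t t'} → Prec′ v t t' → Precursor (LabelledStep.rule s) (seqAt v) t t'
      precBy refl p = p

    step-infer : (∀ w → w ∈ kids v → Child w) → Goal q V
    step-infer children = byStep (stepAt v) refl (correct v)
      where
      byStep : ∀ s → stepAt v ≡ s → Step s → Goal q V
      byStep (step cl ps r) e (eq , prs) with view r
      ... | isQ {r = q₀} = conclude eq (inContextLeaf (QInit-sound q₀))
        where
        inContextLeaf : ∀ {s} → Prov s → Prov (Θ +L s)
        inContextLeaf {Γ ⇒ Δ} d = weakenL (xs⊆ys++xs Γ Θ) d
      ... | isLogic {r = r'} same-prec fits = conclude eq (inContext Prov infer Θ r' (fits Θ (admissible (logic r') bound eq)) (premises prs prem))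
        where
        bound : eigenBound (logic r') ≤ B
        bound = subst (λ s → eigenBound (LabelledStep.rule s) ≤ B) e (eigen≤B v)
        prem : ∀ w → w ∈ kids v → Prov (Θ +L seqAt w)
        prem w m with V' , i , small , g ← children w m = subst (Prov ∘ (Θ +L_)) (sym (seq-η (seqAt w)))
          (subst₂ (λ Γ Δ → Prov (Θ ++ Γ ⇒ Δ)) (ids (ante (seqAt w))) (ids (Defs.succ (seqAt w))) (child w var prec i small g))
          where
          prec : ∀ t t' → Prec′ v t t' → Θ ++ map (substF var) (ante (seqAt w)) ⊩ substT var t' ≐ t
          prec t t' pr with subst (λ X → X) (same-prec (seqAt v) t t') (precBy e pr)
          ... | inj₁ m' = cast (cong (_≐ t) (sym (substT-id t'))) (hyp (∈-++⁺ˡ (ante⊆ q V m')))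
          ... | inj₂ refl = cast (cong (_≐ t) (sym (substT-id t))) (≐-refl t)
      -- The context is not invariant under `θ`, so the rule is not applied in context; the goal of
      -- the premise is instantiated by `θ` instead.
      ... | isSub {Γ} {Δ} θ = conclude eq (go (kids v) refl prs)
        where
        go : ∀ ws → kids v ≡ ws → Pointwise _≈S_ (map seqAt ws) ((Γ ⇒ Δ) ∷ []) → Prov (Θ ++ map (substF θ) Γ ⇒ map (substF θ) Δ)
        go (w ∷ []) ks (eq' ∷ []) with V' , i , small , g ← children w (subst (w ∈_) (sym ks) (here refl)) =
          relabel eq' (child w θ (λ t t' pr → cast (cong (substT θ t' ≐_) (precBy e pr)) (≐-refl (substT θ t'))) i small g)
          where
          relabel : ∀ {s} → s ≈S (Γ ⇒ Δ) → Prov (Θ ++ map (substF θ) (ante s) ⇒ map (substF θ) (Defs.succ s)) →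
            Prov (Θ ++ map (substF θ) Γ ⇒ map (substF θ) Δ)
          relabel {Γ' ⇒ Δ'} ((i , _) , (j , _)) = weaken (++⁺ʳ Θ (map⁺ (substF θ) i)) (map⁺ (substF θ) j)

  descend : ∀ {q V} → All (λ h → proj₁ h ≤ K) V → (∀ e q' → Edge q e q' → Discharged Der e q' V) → Der q V
  descend {⟨ v , A , Fin.zero ⟩} {V} levels next ok = Infer.step-infer v A V levels λ w m →
    let V' , i , small , d = next _ _ (infers m) in V' , i , small , d (Infer.good' v A V levels w)
  descend {⟨ v , A , Fin.suc k ⟩} {V} levels next ok with toℕ k <? K
  ... | yes k<K with used? A (toℕ k)
  ...   | yes u with V' , i , _ , d ← next _ _ (keeps k k<K u) =
          weakenL (∪-lub (Hyps V') (λ m → ∈-++⁺ˡ (map⁺ hypOf i m)) (∈-++⁺ʳ (Hyps V))) (d ok)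
  ...   | no ¬u with V' , i , small , d ← next _ _ (deletes k k<K ¬u) =
          Delete.step-delete v A k ¬u i levels small (d (Delete.good' v A k ¬u ok))
  descend {⟨ v , A , Fin.suc k ⟩} {V} levels next ok | no k≮K = byReset (used? A x) (own? A x)
    where
    x = (K + K) ∸ suc (toℕ k)
    eq : x + suc (toℕ k) ≡ K + K
    eq = m∸n+n≡m (Fin.toℕ<n k)
    K≤k = ≮⇒≥ k≮K
    skip : ¬ (Used A x × ¬ Own A x) → Goal ⟨ v , A , Fin.suc k ⟩ V
    skip ¬both with V' , i , _ , d ← next _ _ (skips k x K≤k eq ¬both) =
      weakenL (∪-lub (Hyps V') (λ m → ∈-++⁺ˡ (map⁺ hypOf i m)) (∈-++⁺ʳ (Hyps V))) (d ok)
    byReset : Dec (Used A x) → Dec (Own A x) → Goal ⟨ v , A , Fin.suc k ⟩ V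
    byReset (no ¬u) _ = skip λ (u , _) → ¬u u
    byReset (yes _) (yes o) = skip λ (_ , ¬o) → ¬o o
    byReset (yes u) (no ¬o) with next _ _ (resets k x K≤k eq u ¬o)
    ... | inj₁ m = Reset.step-hypothesis v A k x (<⇒≤ (x<K K≤k eq)) u ¬o ok V levels m
    ... | inj₂ (V' , i , small , d) =
      Reset.step-reset v A k x (<⇒≤ (x<K K≤k eq)) u ¬o ok V levels i small (d (Reset.good' v A k x (<⇒≤ (x<K K≤k eq)) u ¬o ok))

-- From cyclic proofs to theorems

module _ (n : ℕ) where
  open Theory n

  cyclic-sound : ∀ P → IsCyclicProof P → OnlySig P n → Prov (conclusion P)
  cyclic-sound P cyclic onlySig = atRoot (seqAt root) refl
    where
    open Preproof P
    open Automaton P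
    open Goals n P onlySig

    system : Unfolding State
    system = record
      { code = stateCode
      ; code-injective = stateCode-injective
      ; top = K
      ; Edge = Edge
      ; level≤top = level≤K
      ; init = initial
      ; noBadCycle = Traces.noBadCycle P cyclic
      ; Der = Der
      ; induct = λ {q} {V} p le levels d ok → Goal-induct p le q V levels (d ok)
      ; descend = descend
      }

    no-bits : ∀ i y → lookup (conf initial) i ∋ y → ⊥
    no-bits i y h = bit-zeros K y (subst (_∋ y) (lookup-replicate i (zeros {K})) h)

    empty-inv : ∀ {φ} → φ ∈ inv root (conf initial) → ⊥
    empty-inv m with i , x , _ , h , _ ← ∈-inv⁻ {A = conf initial} m = no-bits i x h

    -- Initially no slot is in use, so there are neither bounds nor hypotheses and the goal is the
    -- end sequent itself.
    goal : Goal initial []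
    goal = Unfold.derivable system λ i y h → ⊥-elim (no-bits i y h)

    atRoot : ∀ s → seqAt root ≡ s → Prov s
    atRoot (Γ ⇒ Δ) e = subst Prov (trans (sym (seq-η (seqAt root))) e) (weakenL (∪-lub (inv root (conf initial)) (λ m → ⊥-elim (empty-inv m)) same) goal)

  CΣ-sound : ∀ {φ} → CΣ n φ → [] ⊩ φ
  CΣ-sound (P , cyclic , onlySig , k , refl , _) with conclusion P | cyclic-sound P cyclic onlySig
  ... | Γ ⇒ Δ | d = allsI k (seqFormulaI (weakenL (xs⊆xs++ys Γ []) d))

  Prov⇒⊢ : ∀ {φ} → [] ⊩ φ → IΣ (suc n) ⊢ φ
  Prov⇒⊢ d with Ax , ok , d' ← extract d = Ax , ok , by (weak (∪-lub Ax same []⊆) same) (d' ∷ [])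

  cut-CΣ : ∀ {φ} → CΣ n ⊢ φ → [] ⊩ φ
  cut-CΣ (Γ , axs , d) = haves Γ (All.map CΣ-sound axs) (weakenL (xs⊆xs++ys Γ []) (fromDeriv d))

theorem7p3 : ∀ (n : ℕ) (φ : Formula) → CΣ n ⊢ φ → IΣ (suc n) ⊢ φ
theorem7p3 n φ d = Prov⇒⊢ n (cut-CΣ n d)
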